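{- Let $d\ge 2$ be an integer and let $A,B,C\in\mathbb{Q}[z]$ be non-zero polynomials. Let $f(z)\in\mathbb{Q}((z^{ -1}))$ satisfy $$f(z)=\frac{A(z)f(z^d)+C(z)}{B(z)}$$ and suppose that $f$ is not a rational function. Let $(p_k(z)/q_k(z))_{k\ge 0}$ be the sequence of convergents of $f$ and let $d_k=\deg(q_k(z))$. Let $b\in\mathbb{Z}$, $|b|\ge 2$, be inside the disc of convergence of $f$ and such that $A(b^{d^t})B(b^{d^t})\neq 0$ for all $t\in\mathbb{N}$. Then the irrationality exponent of $f(b)$ is $$\mu(f(b))=1+\limsup_{k\to\infty}\frac{d_{k+1}}{d_k}.$$
   Context: $\mathbb{N}=\{0,1,2,\dots\}$. For $\alpha\in\mathbb{R}$, the irrationality exponent $\mu(\alpha)$ is the supremum of the set of $\mu\in\mathbb{R}$ such that $|\alpha-p/q|<q^{ -\mu}$ has infinitely many solutions in integers $p,q$ with $q\ge 1$ (it may be $\infty$). $\mathbb{Q}((z^{ -1}))$ is the set of formal Laurent series $f(z)=\sum_{k=-n}^{\infty}c_kz^{ -k}$ with $n\in\mathbb{Z}$, $c_k\in\mathbb{Q}$; $\deg f$ is the largest exponent of $z$ with non-zero coefficient. There is $\rho\in[0,\infty]$ such that $f(z)$ converges for complex $|z|>\rho$ and diverges for $|z|<\rho$; "$b$ is inside the disc of convergence of $f$" means $|b|>\rho$. Convergents: $\lfloor f\rfloor$ denotes the polynomial part of $f$. For $f$ not a rational function put $a_0=\lfloor f\rfloor$, $f_1=(f-a_0)^{ -1}$,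 and for $n\ge1$ $a_n=\lfloor f_n\rfloor$, $f_{n+1}=(f_n-a_n)^{ -1}$. Put $p_0=a_0$, $q_0=1$, $p_1=a_1a_0+1$, $q_1=a_1$, and $p_n=a_np_{n-1}+p_{n-2}$, $q_n=a_nq_{n-1}+q_{n-2}$ for $n\ge2$. The rational functions $p_n/q_n$ are the convergents of $f$; $p_n,q_n\in\mathbb{Q}[z]$ are coprime and $\deg q_n$ is strictly increasing. -}

module Defs where

import Algebra.Definitions.RawMonoid as RawMonoidDefs
import Algebra.Definitions.RawSemiring as RawSemiringDefs
import Algebra.Properties.Monoid.Sum as MonoidSum
open import Data.Empty using (⊥)
open import Data.Fin.Base using (toℕ)
open import Data.Integer.Base as ℤ using (ℤ; +_; -[1+_])
open import Data.List.Base using (List; []; _∷_; map; reverse; length; applyUpTo)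
open import Data.List.Membership.Propositional using (_∉_)
open import Data.List.Relation.Unary.All using (All; all?)
open import Data.Nat.Base as ℕ using (ℕ; zero; suc)
import Data.Nat.Properties as ℕₚ
open import Data.Nat.Divisibility using (_∣?_; quotient)
open import Data.Product.Base using (∃-syntax; _×_; _,_; proj₁)
open import Data.Rational.Base hiding (floor)
open import Data.Rational.Literals using (fromℤ)
open import Data.Rational.Properties
open import Data.Rational.Solver using (module +-*-Solver)
open import Data.Sum.Base using (_⊎_; inj₁; inj₂)
open import Function.Base using (case_of_)
open import Function.Bundles using (_⇔_)
open import Relation.Binary.PropositionalEquality
open import Relation.Nullary using (¬_; yes; no; contradiction)

open RawMonoidDefs +-0-rawMonoid public using () renaming (sum to Σᶠ)
open MonoidSum +-0-monoid using (sum-cong-≗)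
open RawSemiringDefs +-*-rawSemiring public using (_^_)

-- The inverse is totalised by inv 0 = 0; powers are only used at nonzero points.
inv : ℚ → ℚ
inv x with x ≟ 0ℚ
... | yes _   = 0ℚ
... | no  x≢0 = 1/_ x {{≢-nonZero x≢0}}

infixr 8 _^ℤ_
_^ℤ_ : ℚ → ℤ → ℚ
x ^ℤ (+ n)    = x ^ n
x ^ℤ -[1+ n ] = inv x ^ suc n

------------------------------------------------------------------------
-- Polynomials over ℚ

-- Coefficients, constant term first; trailing zeros are allowed, so distinct
-- lists may denote the same polynomial.
Poly : Set
Poly = List ℚ

IsZeroᴾ : Poly → Set
IsZeroᴾ = All (_≡ 0ℚ)

infixl 6 _+ᴾ_
infixl 7 _*ᴾ_

_+ᴾ_ : Poly → Poly → Poly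
[]      +ᴾ q       = q
(a ∷ p) +ᴾ []      = a ∷ p
(a ∷ p) +ᴾ (b ∷ q) = (a + b) ∷ (p +ᴾ q)

_*ᴾ_ : Poly → Poly → Poly
[]      *ᴾ q = []
(a ∷ p) *ᴾ q = map (a *_) q +ᴾ (0ℚ ∷ (p *ᴾ q))

1ᴾ : Poly
1ᴾ = 1ℚ ∷ []

evalᴾ : Poly → ℚ → ℚ
evalᴾ []      x = 0ℚ
evalᴾ (a ∷ p) x = a + x * evalᴾ p x

-- The degree of the zero polynomial is set to 0.
deg : Poly → ℕ
deg []      = 0
deg (a ∷ p) with all? (_≟ 0ℚ) p
... | yes _ = 0
... | no  _ = suc (deg p)

nth : List ℚ → ℕ → ℚ
nth []       _       = 0ℚ
nth (a ∷ as) zero    = a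
nth (a ∷ as) (suc i) = nth as i

------------------------------------------------------------------------
-- The field ℚ((z⁻¹))

-- top and c represent Σ_{i ≥ 0} c i · z^(top - i).  The coefficient c 0 may
-- vanish, so equality of series is _≈_ below.
record Laurent : Set where
  constructor series
  field
    top : ℤ
    c   : ℕ → ℚ

open Laurent public

coeff : Laurent → ℤ → ℚ
coeff f k with top f ℤ.- k
... | + i      = c f i
... | -[1+ _ ] = 0ℚ

infix 4 _≈_
_≈_ : Laurent → Laurent → Set
f ≈ g = ∀ k → coeff f k ≡ coeff g k

infixl 6 _+ᴸ_ _-ᴸ_
infixl 7 _*ᴸ_

_+ᴸ_ : Laurent → Laurent → Laurent
f +ᴸ g = series n (λ i → coeff f (n ℤ.- + i) + coeff g (n ℤ.- + i))
  where n = top f ℤ.⊔ top g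

-ᴸ_ : Laurent → Laurent
-ᴸ f = series (top f) (λ i → - c f i)

_-ᴸ_ : Laurent → Laurent → Laurent
f -ᴸ g = f +ᴸ (-ᴸ g)

_*ᴸ_ : Laurent → Laurent → Laurent
f *ᴸ g = series (top f ℤ.+ top g)
  (λ n → Σᶠ {suc n} (λ i → c f (toℕ i) * c g (n ℕ.∸ toℕ i)))

⟦_⟧ : Poly → Laurent
⟦ p ⟧ = series (+ length p ℤ.- + 1) (nth (reverse p))

1ᴸ : Laurent
1ᴸ = ⟦ 1ᴾ ⟧

-- f ∘z^ d is f(z^d).
infix 8 _∘z^_
_∘z^_ : Laurent → ℕ → Laurent
f ∘z^ d = series (+ d ℤ.* top f) c′
  where
  c′ : ℕ → ℚ
  c′ i with d ∣? i
  ... | yes d∣i = c f (quotient d∣i)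
  ... | no  _   = 0ℚ

-- The polynomial part; no exponent above ∣ top f ∣ occurs in f.
⌊_⌋ : Laurent → Poly
⌊ f ⌋ = applyUpTo (λ j → coeff f (+ j)) (suc ℤ.∣ top f ∣)

-- f = P / Q for polynomials P and Q ≠ 0.
IsRational : Laurent → Set
IsRational f = ∃[ P ] ∃[ Q ] ¬ IsZeroᴾ Q × ⟦ Q ⟧ *ᴸ f ≈ ⟦ P ⟧

------------------------------------------------------------------------
-- Continued fractions

-- complete 0 is f and complete (n + 1) = (complete n - ⌊ complete n ⌋)⁻¹.
-- The inverse is given by its defining equation, because locating a nonzero
-- coefficient of a series that is merely not zero is not effective.  The
-- complete quotients are unique up to _≈_.
record ContinuedFraction (f : Laurent) : Set where
  field
    complete : ℕ → Laurent
    start    : complete 0 ≈ f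
    step     : ∀ n → complete (suc n) *ᴸ (complete n -ᴸ ⟦ ⌊ complete n ⌋ ⟧) ≈ 1ᴸ

  a : ℕ → Poly
  a n = ⌊ complete n ⌋

  numer : ℕ → Poly
  numer 0             = a 0
  numer 1             = a 1 *ᴾ a 0 +ᴾ 1ᴾ
  numer (suc (suc n)) = a (suc (suc n)) *ᴾ numer (suc n) +ᴾ numer n

  denom : ℕ → Poly
  denom 0             = 1ᴾ
  denom 1             = a 1
  denom (suc (suc n)) = a (suc (suc n)) *ᴾ denom (suc n) +ᴾ denom n

------------------------------------------------------------------------
-- Real numbers, as Cauchy sequences of rationals

IsCauchy : (ℕ → ℚ) → Set
IsCauchy s = ∀ ε → 0ℚ < ε →
  ∃[ N ] (∀ m n → N ℕ.≤ m → N ℕ.≤ n → ∣ s m - s n ∣ < ε)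

record ℝ : Set where
  constructor real
  field
    seq    : ℕ → ℚ
    cauchy : IsCauchy seq

open ℝ public

Eventually : (ℕ → Set) → Set
Eventually P = ∃[ N ] (∀ n → N ℕ.≤ n → P n)

infix 4 _<ᴸ_ _<ᴿ_

_<ᴸ_ : ℚ → ℝ → Set
r <ᴸ x = ∃[ s ] r < s × Eventually (λ n → s ≤ seq x n)

_<ᴿ_ : ℝ → ℚ → Set
x <ᴿ r = ∃[ s ] s < r × Eventually (λ n → seq x n ≤ s)

private
  ∣p∣-∣q∣≤∣p-q∣ : ∀ p q → ∣ p ∣ - ∣ q ∣ ≤ ∣ p - q ∣
  ∣p∣-∣q∣≤∣p-q∣ p q = subst (∣ p ∣ - ∣ q ∣ ≤_) (cancel ∣ p - q ∣ ∣ q ∣)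
    (+-monoˡ-≤ (- ∣ q ∣)
      (subst (λ x → ∣ x ∣ ≤ ∣ p - q ∣ + ∣ q ∣) (cancel′ p q)
        (∣p+q∣≤∣p∣+∣q∣ (p - q) q)))
    where
    open +-*-Solver
    cancel : ∀ x y → x + y - y ≡ x
    cancel = solve 2 (λ x y → x :+ y :- y := x) refl
    cancel′ : ∀ x y → x - y + y ≡ x
    cancel′ = solve 2 (λ x y → x :- y :+ y := x) refl

  ∣∣p∣-∣q∣∣≤∣p-q∣ : ∀ p q → ∣ ∣ p ∣ - ∣ q ∣ ∣ ≤ ∣ p - q ∣
  ∣∣p∣-∣q∣∣≤∣p-q∣ p q with ∣p∣≡p∨∣p∣≡-p (∣ p ∣ - ∣ q ∣)
  ... | inj₁ eq = subst (_≤ ∣ p - q ∣) (sym eq) (∣p∣-∣q∣≤∣p-q∣ p q)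
  ... | inj₂ eq = subst₂ _≤_ (trans (flip ∣ q ∣ ∣ p ∣) (sym eq))
    (trans (cong ∣_∣ (flip q p)) (∣-p∣≡∣p∣ (p - q))) (∣p∣-∣q∣≤∣p-q∣ q p)
    where
    open +-*-Solver
    flip : ∀ x y → x - y ≡ - (y - x)
    flip = solve 2 (λ x y → x :- y := :- (y :- x)) refl

-- The real number ∣ x - r ∣.
dist : ℝ → ℚ → ℝ
dist x r = real (λ n → ∣ seq x n - r ∣) λ ε ε>0 →
  let N , close = cauchy x ε ε>0
  in  N , λ m n N≤m N≤n → ≤-<-trans (∣∣p∣-∣q∣∣≤∣p-q∣ (seq x m - r) (seq x n - r))
        (subst (λ y → ∣ y ∣ < ε) (shift (seq x m) (seq x n) r) (close m n N≤m N≤n))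
  where
  open +-*-Solver
  shift : ∀ x y r → x - y ≡ (x - r) - (y - r)
  shift = solve 3 (λ x y r → x :- y := (x :- r) :- (y :- r)) refl

------------------------------------------------------------------------
-- Evaluation of Laurent series

partialSum : Laurent → ℚ → ℕ → ℚ
partialSum f x n = Σᶠ {n} (λ i → c f (toℕ i) * x ^ℤ (top f ℤ.- + toℕ i))

Converges : Laurent → ℚ → Set
Converges f x = IsCauchy (partialSum f x)

value : (f : Laurent) (x : ℚ) → Converges f x → ℝ
value f x conv = real (partialSum f x) conv

-- Complex numbers, as Cauchy sequences of Gaussian rationals.
infix 6 _+i_
record ℚ[i] : Set where
  constructor _+i_
  field
    re im : ℚ

open ℚ[i] public

norm² : ℚ[i] → ℚ
norm² z = re z * re z + im z * im z

infixl 7 _*ᶜ_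
_*ᶜ_ : ℚ[i] → ℚ[i] → ℚ[i]
z *ᶜ w = (re z * re w - im z * im w) +i (re z * im w + im z * re w)

invᶜ : ℚ[i] → ℚ[i]
invᶜ z = (re z * inv (norm² z)) +i (- im z * inv (norm² z))

infixr 8 _^ᶜ_ _^ᶜℤ_
_^ᶜ_ : ℚ[i] → ℕ → ℚ[i]
z ^ᶜ zero  = 1ℚ +i 0ℚ
z ^ᶜ suc n = z *ᶜ z ^ᶜ n

_^ᶜℤ_ : ℚ[i] → ℤ → ℚ[i]
z ^ᶜℤ (+ n)    = z ^ᶜ n
z ^ᶜℤ -[1+ n ] = invᶜ z ^ᶜ suc n

partialSumᶜ : Laurent → ℚ[i] → ℕ → ℚ[i]
partialSumᶜ f z n =
     Σᶠ {n} (λ i → c f (toℕ i) * re (z ^ᶜℤ (top f ℤ.- + toℕ i)))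
  +i Σᶠ {n} (λ i → c f (toℕ i) * im (z ^ᶜℤ (top f ℤ.- + toℕ i)))

record ℂ : Set where
  constructor complex
  field
    Re Im : ℝ

open ℂ public

approx : ℂ → ℕ → ℚ[i]
approx z j = seq (Re z) j +i seq (Im z) j

-- The order relations ρ < ∣ z ∣, ∣ z ∣ < ρ (for ρ ≥ 0) and z ≠ 0.
_<∣_∣ : ℝ → ℂ → Set
ρ <∣ z ∣ = ∃[ s ] ρ <ᴿ s × Eventually (λ j → s * s ≤ norm² (approx z j))

∣_∣<_ : ℂ → ℝ → Set
∣ z ∣< ρ = ∃[ s ] 0ℚ ≤ s × s <ᴸ ρ × Eventually (λ j → norm² (approx z j) ≤ s * s)

_≉0 : ℂ → Set
z ≉0 = ∃[ s ] 0ℚ < s × Eventually (λ j → s ≤ norm² (approx z j))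

-- The partial sums S_n(z) are Cauchy.  As S_n is continuous at z ≠ 0, the
-- difference S_m(z) - S_n(z) is the limit of S_m(z_j) - S_n(z_j) over the
-- rational approximations z_j of z.
Convergesᶜ : Laurent → ℂ → Set
Convergesᶜ f z = ∀ ε → 0ℚ < ε →
  ∃[ N ] (∀ m n → N ℕ.≤ m → N ℕ.≤ n → Eventually (λ j →
    ∣ re (S m j) - re (S n j) ∣ < ε × ∣ im (S m j) - im (S n j) ∣ < ε))
  where
  S : ℕ → ℕ → ℚ[i]
  S n j = partialSumᶜ f (approx z j) n

-- ρ = ∞ is left out, since no point satisfies ∣ z ∣ > ∞.
record IsRadius (f : Laurent) (ρ : ℝ) : Set where
  field
    0≤ρ      : ¬ ρ <ᴿ 0ℚ
    outside  : ∀ z → ρ <∣ z ∣ → Convergesᶜ f z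
    diverges : ∀ z → z ≉0 → ∣ z ∣< ρ → ¬ Convergesᶜ f z

constant : ℚ → ℝ
constant x = real (λ _ → x) λ ε ε>0 →
  0 , λ _ _ _ _ → subst (λ y → ∣ y ∣ < ε) (sym (+-inverseʳ x)) ε>0

private
  module RealPoint (x : ℚ) where
    open +-*-Solver

    norm²-real : norm² (x +i 0ℚ) ≡ x * x
    norm²-real = solve 1 (λ x → x :* x :+ con 0ℚ :* con 0ℚ := x :* x) refl x

    *ᶜ-real : ∀ y → (x +i 0ℚ) *ᶜ (y +i 0ℚ) ≡ (x * y) +i 0ℚ
    *ᶜ-real y = cong₂ _+i_
      (solve 2 (λ x y → x :* y :- con 0ℚ :* con 0ℚ := x :* y) refl x y)
      (solve 2 (λ x y → x :* con 0ℚ :+ con 0ℚ :* y := con 0ℚ) refl x y)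

    ^ᶜ-real : ∀ n → (x +i 0ℚ) ^ᶜ n ≡ (x ^ n) +i 0ℚ
    ^ᶜ-real zero    = refl
    ^ᶜ-real (suc n) = trans (cong ((x +i 0ℚ) *ᶜ_) (^ᶜ-real n)) (*ᶜ-real (x ^ n))

  x*inv-x≡1 : ∀ x → x ≢ 0ℚ → x * inv x ≡ 1ℚ
  x*inv-x≡1 x x≢0 with x ≟ 0ℚ
  ... | yes x≡0 = contradiction x≡0 x≢0
  ... | no  x≢0 = *-inverseʳ x {{≢-nonZero x≢0}}

  inv-square : ∀ x → x * inv (x * x) ≡ inv x
  inv-square x = case x ≟ 0ℚ of λ where
      (yes refl) → refl
      (no x≢0)   → nonzero x≢0
    where
    open ≡-Reasoning
    open +-*-Solver
    nonzero : x ≢ 0ℚ → x * inv (x * x) ≡ inv x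
    nonzero x≢0 = begin
      x * v                   ≡⟨ *-identityʳ (x * v) ⟨
      x * v * 1ℚ              ≡⟨ cong (x * v *_) x*u≡1 ⟨
      x * v * (x * u)         ≡⟨ solve 3 (λ x u v → x :* v :* (x :* u) := x :* x :* v :* u) refl x u v ⟩
      x * x * v * u           ≡⟨ cong (_* u) (x*inv-x≡1 (x * x) x*x≢0) ⟩
      1ℚ * u                  ≡⟨ *-identityˡ u ⟩
      u                       ∎
      where
      u v : ℚ
      u = inv x
      v = inv (x * x)
      x*u≡1 : x * u ≡ 1ℚ
      x*u≡1 = x*inv-x≡1 x x≢0
      x*x≢0 : x * x ≢ 0ℚ
      x*x≢0 x*x≡0 = x≢0 (begin
        x           ≡⟨ *-identityʳ x ⟨
        x * 1ℚ      ≡⟨ cong (x *_) x*u≡1 ⟨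
        x * (x * u) ≡⟨ *-assoc x x u ⟨
        x * x * u   ≡⟨ cong (_* u) x*x≡0 ⟩
        0ℚ * u      ≡⟨ *-zeroˡ u ⟩
        0ℚ          ∎)

  invᶜ-real : ∀ x → invᶜ (x +i 0ℚ) ≡ inv x +i 0ℚ
  invᶜ-real x = cong₂ _+i_
    (trans (cong (λ y → x * inv y) (RealPoint.norm²-real x)) (inv-square x))
    (*-zeroˡ (inv (norm² (x +i 0ℚ))))

  ^ᶜℤ-real : ∀ x k → re ((x +i 0ℚ) ^ᶜℤ k) ≡ x ^ℤ k
  ^ᶜℤ-real x (+ n)    = cong re (RealPoint.^ᶜ-real x n)
  ^ᶜℤ-real x -[1+ n ] = trans (cong (λ z → re (z ^ᶜ suc n)) (invᶜ-real x))
    (cong re (RealPoint.^ᶜ-real (inv x) (suc n)))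

  partialSum-real : ∀ f x n → re (partialSumᶜ f (x +i 0ℚ) n) ≡ partialSum f x n
  partialSum-real f x n = sum-cong-≗ {n}
    (λ i → cong (c f (toℕ i) *_) (^ᶜℤ-real x (top f ℤ.- + toℕ i)))

  ∣x∣²≤norm² : ∀ x → ∣ x ∣ * ∣ x ∣ ≤ norm² (x +i 0ℚ)
  ∣x∣²≤norm² x = ≤-reflexive (trans (∣x∣²≡x² (∣p∣≡p∨∣p∣≡-p x))
    (sym (RealPoint.norm²-real x)))
    where
    open +-*-Solver
    ∣x∣²≡x² : ∣ x ∣ ≡ x ⊎ ∣ x ∣ ≡ - x → ∣ x ∣ * ∣ x ∣ ≡ x * x
    ∣x∣²≡x² (inj₁ eq) = cong₂ _*_ eq eq
    ∣x∣²≡x² (inj₂ eq) = trans (cong₂ _*_ eq eq)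
      (solve 1 (λ x → :- x :* :- x := x :* x) refl x)

converges : ∀ {f ρ} → IsRadius f ρ → ∀ x → ρ <ᴿ ∣ x ∣ → Converges f x
converges {f} radius x ρ<∣x∣ ε ε>0 =
  let N , close = IsRadius.outside radius (complex (constant x) (constant 0ℚ))
                    (∣ x ∣ , ρ<∣x∣ , 0 , λ _ _ → ∣x∣²≤norm² x) ε ε>0
  in  N , λ m n N≤m N≤n →
        let M , tail = close m n N≤m N≤n
        in  subst₂ (λ p q → ∣ p - q ∣ < ε) (partialSum-real f x m)
              (partialSum-real f x n) (proj₁ (tail M ℕₚ.≤-refl))

------------------------------------------------------------------------
-- Extended real numbers, as open lower cuts of rationals

-- r ∈ cut means that r is strictly below the number.  The empty cut is -∞ and
-- the full cut is +∞, so suprema and upper limits always exist.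
record ℝ∞ : Set₁ where
  field
    cut     : ℚ → Set
    down    : ∀ {r s} → r < s → cut s → cut r
    rounded : ∀ {r} → cut r → ∃[ s ] r < s × cut s

open ℝ∞ public using (cut)

infix 4 _≡∞_
_≡∞_ : ℝ∞ → ℝ∞ → Set
x ≡∞ y = ∀ r → cut x r ⇔ cut y r

sup : (ℝ → Set) → ℝ∞
sup S = record
  { cut     = λ r → ∃[ x ] S x × r <ᴸ x
  ; down    = λ { r<s (x , x∈S , t , s<t , tail) →
                  x , x∈S , t , <-trans r<s s<t , tail }
  ; rounded = λ { (x , x∈S , t , r<t , tail) →
                  let u , r<u , u<t = <-dense r<t
                  in  u , r<u , x , x∈S , t , u<t , tail }
  }

-- r < inf_N sup_{k ≥ N} u k exactly when some s > r lies below infinitely many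
-- terms.
limsup : (ℕ → ℚ) → ℝ∞
limsup u = record
  { cut     = λ r → ∃[ s ] r < s × (∀ N → ∃[ k ] N ℕ.≤ k × s < u k)
  ; down    = λ { q<r (s , r<s , often) → s , <-trans q<r r<s , often }
  ; rounded = λ { (s , r<s , often) →
                  let t , r<t , t<s = <-dense r<s
                  in  t , r<t , s , t<s , often }
  }

infixr 6 1+_
1+_ : ℝ∞ → ℝ∞
1+ x = record
  { cut     = λ r → cut x (r - 1ℚ)
  ; down    = λ r<s → ℝ∞.down x (+-monoˡ-< (- 1ℚ) r<s)
  ; rounded = λ {r} r-1∈x →
      let s , r-1<s , s∈x = ℝ∞.rounded x r-1∈x
      in  s + 1ℚ
        , subst (_< s + 1ℚ) (cancel r) (+-monoˡ-< 1ℚ r-1<s)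
        , subst (cut x) (sym (cancel′ s)) s∈x
  }
  where
  open +-*-Solver
  cancel : ∀ r → r - 1ℚ + 1ℚ ≡ r
  cancel = solve 1 (λ r → r :- con 1ℚ :+ con 1ℚ := r) refl
  cancel′ : ∀ s → s + 1ℚ - 1ℚ ≡ s
  cancel′ = solve 1 (λ s → s :+ con 1ℚ :- con 1ℚ := s) refl

------------------------------------------------------------------------
-- Irrationality exponents

-- For rational r = m / n and s ≥ 0: s ≤ q^(-r) means s^n ≤ q^(-m).
_≤_^-ℚ_ : ℚ → ℕ → ℚ → Set
s ≤ q ^-ℚ r = 0ℚ ≤ s × s ^ ↧ₙ r ≤ fromℤ (+ q) ^ℤ (ℤ.- ↥ r)

-- For q ≥ 1 and real μ: x < q^(-μ), where q^(-μ) is the supremum of q^(-r) over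
-- the rationals r > μ.
_<_^-_ : ℝ → ℕ → ℝ → Set
x < q ^- μ = ∃[ s ] x <ᴿ s × ∃[ r ] μ <ᴿ r × s ≤ q ^-ℚ r

Infinite : {X : Set} → (X → Set) → Set
Infinite P = ∀ xs → ∃[ x ] x ∉ xs × P x

-- (p , q) solves ∣ α - p/q ∣ < q^(-μ) with q ≥ 1.
Approximates : ℝ → ℝ → ℤ × ℕ → Set
Approximates α μ (p , zero)      = ⊥
Approximates α μ (p , q@(suc _)) = dist α (p / q) < q ^- μ

irrationalityExponent : ℝ → ℝ∞
irrationalityExponent α = sup (λ μ → Infinite (Approximates α μ))

-- m / 0 is set to 0.  In a sequence of ratios deg (denom (k + 1)) / deg (denom k)
-- only the term k = 0 is affected, and it does not influence the upper limit.
ratio : ℕ → ℕ → ℚ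
ratio m zero      = 0ℚ
ratio m n@(suc _) = + m / n

{-# OPTIONS --safe #-}

-- Iterating the functional equation gives B_t(z) f(z) = A_t(z) f(z^(d^t)) + C_t(z)
-- with A_t = ∏_{i<t} A(z^(d^i)) and B_t = ∏_{i<t} B(z^(d^i)).  Substituting the
-- convergent p_k/q_k for f at X = b^(d^t) therefore yields fractions P/Q with
--   ∣Q∣ ≈ ∣X∣^(d_k)  and  ∣Q f(b) - P∣ ≈ ∣X∣^(-d_{k+1}),
-- up to factors ∣X∣^(±M) with M independent of k and t; for large k these factors
-- do not matter.  Letting t → ∞ for a fixed large k gives the lower bound.  For the
-- upper bound, a fraction p/q approximating f(b) is compared with the P/Q for which
-- ∣X∣^(d_k) ≤ q ∣X∣^(M+1) < ∣X∣^(d_{k+1}).  Since ∣X∣ is raised to the power d when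
-- t grows by one, such a pair (k, t) exists with k in a bounded range, and so an
-- index k with a large ratio d_{k+1}/d_k is found by a bounded search.
module Submission where

import Algebra.Properties.CommutativeSemiring.Exp as CommutativeSemiringExp
import Algebra.Properties.Monoid.Sum as MonoidSum
import Algebra.Properties.Semiring.Exp as SemiringExp
open import Algebra.Bundles using (CommutativeRing)
open import Data.Empty using (⊥; ⊥-elim)
open import Data.Fin.Base using (toℕ)
open import Data.Integer.Base as ℤ using (ℤ; +_; -[1+_])
import Data.Integer.Properties as ℤₚ
import Data.Integer.Tactic.RingSolver as ℤ-Solver
open import Data.List.Base using (List; []; _∷_; _++_; map; reverse; length; applyUpTo; upTo; cartesianProduct)
open import Data.List.Membership.Propositional using (_∈_; _∉_)
open import Data.List.Membership.Propositional.Properties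
  using (∈-++⁺ˡ; ∈-++⁺ʳ; ∈-map⁺; ∈-upTo⁺; ∈-cartesianProduct⁺)
import Data.List.Properties as Listₚ
open import Data.List.Relation.Unary.All using (all?; []; _∷_)
open import Data.List.Relation.Unary.Any using (here; there)
open import Data.Nat.Base as ℕ using (ℕ; zero; suc)
open import Data.Nat.Divisibility using (_∣_; _∣?_; divides; ∣m+n∣m⇒∣n; >⇒∤)
import Data.Nat.Properties as ℕₚ
import Data.Nat.Tactic.RingSolver as ℕ-Solver
open import Data.Product.Base using (∃-syntax; _×_; _,_; proj₁; proj₂)
open import Data.Rational.Base hiding (floor)
open import Data.Rational.Literals using (fromℤ)
open import Data.Rational.Properties
open import Data.Rational.Unnormalised.Base using (mkℚᵘ; *≡*)
import Data.Rational.Unnormalised.Properties as ℚᵘₚ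
open import Data.Sum.Base using (_⊎_; inj₁; inj₂)
open import Function.Base using (_∘_)
open import Function.Bundles using (mk⇔; module Equivalence)
open import Relation.Binary.Definitions using (tri<; tri≈; tri>)
open import Relation.Binary.PropositionalEquality
open import Relation.Nullary using (¬_; yes; no; contradiction; Dec)
open import Relation.Nullary.Decidable using (_×-dec_; dec⇒maybe)
open import Relation.Unary using (Decidable)
open import Tactic.RingSolver using (solve-∀)
open import Tactic.RingSolver.Core.AlmostCommutativeRing using (AlmostCommutativeRing; fromCommutativeRing)
open import Defs

open CommutativeSemiringExp (CommutativeRing.commutativeSemiring +-*-commutativeRing) using (^-distrib-*)
open MonoidSum +-0-monoid using (sum-cong-≗)
open SemiringExp (CommutativeRing.semiring +-*-commutativeRing) using (^-homo-*; ^-assocʳ)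

-- The power `M` can be independent of `t` because the exponents of the points `b^(d^t)` grow
-- geometrically: if the values of `A` and `B` at `X` are at most `∣X∣^m` after clearing
-- denominators, then the product of such values over all levels below `t` is again at most `∣X∣^m`
-- at level `t`, since `m + m ≤ d * m`. Constants that depend on `k`, such as a common denominator
-- of `p_k` and `q_k` or the leading coefficient of `q_k`, cannot be made uniform; they are absorbed
-- by `∣X∣` once `t` is large in terms of `k`. So each `k` has its own first level, and the upper
-- bound may use only finitely many `k`, for which one common level can be taken. This is why the
-- range of `k` is fixed in advance and why fractions with small denominators are first excluded by
-- a finite list. Real numbers enter only through their approximating sequences: identities hold
-- modulo null sequences, inequalities hold from some index on, and the comparisons that steer the
-- search are between rationals, hence decidable.

ℚ-ring : AlmostCommutativeRing _ _
ℚ-ring = fromCommutativeRing +-*-commutativeRing (λ x → dec⇒maybe (0ℚ ≟ x))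

-- Inequalities and absolute values of rationals.

2ℚ : ℚ
2ℚ = 1ℚ + 1ℚ

0≤1 : 0ℚ ≤ 1ℚ
0≤1 = *≤* (ℤ.+≤+ ℕ.z≤n)

0<1 : 0ℚ < 1ℚ
0<1 = *<* (ℤ.+<+ (ℕ.s≤s ℕ.z≤n))

*-monoʳ-≤ : ∀ {c a b} → 0ℚ ≤ c → a ≤ b → c * a ≤ c * b
*-monoʳ-≤ {c} 0≤c = *-monoˡ-≤-nonNeg c {{nonNegative 0≤c}}

*-monoˡ-≤ : ∀ {c a b} → 0ℚ ≤ c → a ≤ b → a * c ≤ b * c
*-monoˡ-≤ {c} 0≤c = *-monoʳ-≤-nonNeg c {{nonNegative 0≤c}}

*-mono-≤ : ∀ {a b c d} → 0ℚ ≤ a → 0ℚ ≤ d → a ≤ b → c ≤ d → a * c ≤ b * d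
*-mono-≤ 0≤a 0≤d a≤b c≤d = ≤-trans (*-monoʳ-≤ 0≤a c≤d) (*-monoˡ-≤ 0≤d a≤b)

*-cancelˡ-≤ : ∀ {c a b} → 0ℚ < c → c * a ≤ c * b → a ≤ b
*-cancelˡ-≤ {c} 0<c = *-cancelˡ-≤-pos c {{positive 0<c}}

*-monoʳ-< : ∀ {c a b} → 0ℚ < c → a < b → c * a < c * b
*-monoʳ-< {c} 0<c = *-monoʳ-<-pos c {{positive 0<c}}

*-nonNeg : ∀ {a b} → 0ℚ ≤ a → 0ℚ ≤ b → 0ℚ ≤ a * b
*-nonNeg {a} {b} 0≤a 0≤b = subst (_≤ a * b) (*-zeroʳ a) (*-monoʳ-≤ 0≤a 0≤b)

*-pos : ∀ {a b} → 0ℚ < a → 0ℚ < b → 0ℚ < a * b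
*-pos {a} {b} 0<a 0<b = subst (_< a * b) (*-zeroʳ a) (*-monoʳ-< 0<a 0<b)

+-nonNeg : ∀ {a b} → 0ℚ ≤ a → 0ℚ ≤ b → 0ℚ ≤ a + b
+-nonNeg {a} {b} 0≤a 0≤b = +-mono-≤ 0≤a 0≤b

0≤y-x⇒x≤y : ∀ {x y} → 0ℚ ≤ y - x → x ≤ y
0≤y-x⇒x≤y {x} {y} h = subst₂ _≤_ (+-identityˡ x) (lemma x y) (+-monoˡ-≤ x h)
  where
  lemma : ∀ x y → y - x + x ≡ y
  lemma = solve-∀ ℚ-ring

x≤y⇒0≤y-x : ∀ {x y} → x ≤ y → 0ℚ ≤ y - x
x≤y⇒0≤y-x {x} {y} h = subst (_≤ y - x) (+-inverseʳ x) (+-monoˡ-≤ (- x) h)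

x≤∣x∣ : ∀ x → x ≤ ∣ x ∣
x≤∣x∣ x with ≤-total 0ℚ x
... | inj₁ 0≤x = ≤-reflexive (sym (0≤p⇒∣p∣≡p 0≤x))
... | inj₂ x≤0 = ≤-trans x≤0 (0≤∣p∣ x)

∣x∣≤∣y∣+∣x-y∣ : ∀ x y → ∣ x ∣ ≤ ∣ y ∣ + ∣ x - y ∣
∣x∣≤∣y∣+∣x-y∣ x y = subst (λ z → ∣ z ∣ ≤ ∣ y ∣ + ∣ x - y ∣) (lemma x y) (∣p+q∣≤∣p∣+∣q∣ y (x - y))
  where
  lemma : ∀ x y → y + (x - y) ≡ x
  lemma = solve-∀ ℚ-ring

∣x-y∣≡∣y-x∣ : ∀ x y → ∣ x - y ∣ ≡ ∣ y - x ∣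
∣x-y∣≡∣y-x∣ x y = trans (sym (∣-p∣≡∣p∣ (x - y))) (cong ∣_∣ (lemma x y))
  where
  lemma : ∀ x y → - (x - y) ≡ y - x
  lemma = solve-∀ ℚ-ring

x≢0⇒0<∣x∣ : ∀ {x} → x ≢ 0ℚ → 0ℚ < ∣ x ∣
x≢0⇒0<∣x∣ {x} x≢0 = ≤∧≢⇒< (0≤∣p∣ x) (λ eq → x≢0 (∣p∣≡0⇒p≡0 x (sym eq)))
  where
  ≤∧≢⇒< : ∀ {x y} → x ≤ y → x ≢ y → x < y
  ≤∧≢⇒< {x} {y} x≤y x≢y = ≰⇒> (λ y≤x → x≢y (≤-antisym x≤y y≤x))

0<∣x∣⇒x≢0 : ∀ {x} → 0ℚ < ∣ x ∣ → x ≢ 0ℚ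
0<∣x∣⇒x≢0 0<∣x∣ refl = <-irrefl refl 0<∣x∣

-- Powers

1^n≡1 : ∀ n → 1ℚ ^ n ≡ 1ℚ
1^n≡1 zero    = refl
1^n≡1 (suc n) = trans (*-identityˡ (1ℚ ^ n)) (1^n≡1 n)

^-nonNeg : ∀ {x} → 0ℚ ≤ x → ∀ n → 0ℚ ≤ x ^ n
^-nonNeg 0≤x zero    = 0≤1
^-nonNeg 0≤x (suc n) = *-nonNeg 0≤x (^-nonNeg 0≤x n)

^-pos : ∀ {x} → 0ℚ < x → ∀ n → 0ℚ < x ^ n
^-pos 0<x zero    = 0<1
^-pos 0<x (suc n) = *-pos 0<x (^-pos 0<x n)

^-monoˡ-≤ : ∀ {x y} → 0ℚ ≤ x → x ≤ y → ∀ n → x ^ n ≤ y ^ n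
^-monoˡ-≤ 0≤x x≤y zero    = ≤-refl
^-monoˡ-≤ 0≤x x≤y (suc n) =
  *-mono-≤ 0≤x (^-nonNeg (≤-trans 0≤x x≤y) n) x≤y (^-monoˡ-≤ 0≤x x≤y n)

^-monoˡ-< : ∀ {x y} → 0ℚ ≤ x → x < y → ∀ n → .{{ℕ.NonZero n}} → x ^ n < y ^ n
^-monoˡ-< {x} {y} 0≤x x<y (suc n) = ≤-<-trans (*-monoʳ-≤ 0≤x (^-monoˡ-≤ 0≤x (<⇒≤ x<y) n))
  (subst₂ _<_ (*-comm (y ^ n) x) (*-comm (y ^ n) y)
    (*-monoʳ-< (^-pos (≤-<-trans 0≤x x<y) n) x<y))

1≤^ : ∀ {x} → 1ℚ ≤ x → ∀ n → 1ℚ ≤ x ^ n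
1≤^ {x} 1≤x n = subst (_≤ x ^ n) (1^n≡1 n) (^-monoˡ-≤ 0≤1 1≤x n)

^≤1 : ∀ {x} → 0ℚ ≤ x → x ≤ 1ℚ → ∀ n → x ^ n ≤ 1ℚ
^≤1 {x} 0≤x x≤1 n = subst (x ^ n ≤_) (1^n≡1 n) (^-monoˡ-≤ 0≤x x≤1 n)

^-cancel-≤1 : ∀ {x} → 0ℚ ≤ x → ∀ n → .{{ℕ.NonZero n}} → x ^ n ≤ 1ℚ → x ≤ 1ℚ
^-cancel-≤1 {x} 0≤x n xⁿ≤1 = ≮⇒≥ λ 1<x →
  <-irrefl refl (<-≤-trans (subst (_< x ^ n) (1^n≡1 n) (^-monoˡ-< 0≤1 1<x n)) xⁿ≤1)

^-monoʳ-≤ : ∀ {x} → 1ℚ ≤ x → ∀ {m n} → m ℕ.≤ n → x ^ m ≤ x ^ n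
^-monoʳ-≤ {x} 1≤x {m} {n} m≤n = subst₂ _≤_ (*-identityʳ (x ^ m))
  (trans (sym (^-homo-* x m (n ℕ.∸ m))) (cong (x ^_) (ℕₚ.m+[n∸m]≡n m≤n)))
  (*-monoʳ-≤ (^-nonNeg (≤-trans 0≤1 1≤x) m) (1≤^ 1≤x (n ℕ.∸ m)))

^-cancelʳ-≤ : ∀ {x} → 1ℚ < x → ∀ {m n} → x ^ m ≤ x ^ n → m ℕ.≤ n
^-cancelʳ-≤ {x} 1<x {m} {n} xᵐ≤xⁿ = ℕₚ.≮⇒≥ λ n<m →
  <-irrefl refl (<-≤-trans xⁿ<x¹⁺ⁿ (≤-trans (^-monoʳ-≤ (<⇒≤ 1<x) n<m) xᵐ≤xⁿ))
  where
  xⁿ<x¹⁺ⁿ : x ^ n < x ^ suc n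
  xⁿ<x¹⁺ⁿ = subst₂ _<_ (*-identityʳ (x ^ n)) (*-comm (x ^ n) x)
    (*-monoʳ-< (^-pos (<-trans 0<1 1<x) n) 1<x)

∣x^n∣≡∣x∣^n : ∀ x n → ∣ x ^ n ∣ ≡ ∣ x ∣ ^ n
∣x^n∣≡∣x∣^n x zero    = refl
∣x^n∣≡∣x∣^n x (suc n) = trans (∣p*q∣≡∣p∣*∣q∣ x (x ^ n)) (cong (∣ x ∣ *_) (∣x^n∣≡∣x∣^n x n))

-- Inverses

x*inv-x≡1 : ∀ x → x ≢ 0ℚ → x * inv x ≡ 1ℚ
x*inv-x≡1 x x≢0 with x ≟ 0ℚ
... | yes x≡0 = contradiction x≡0 x≢0
... | no  x≢0 = *-inverseʳ x {{≢-nonZero x≢0}}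

inv-pos : ∀ {x} → 0ℚ < x → 0ℚ < inv x
inv-pos {x} 0<x = ≰⇒> λ inv≤0 → <-irrefl refl (<-≤-trans 0<1
  (subst₂ _≤_ (x*inv-x≡1 x (≢-sym (<⇒≢ 0<x))) (*-zeroʳ x) (*-monoʳ-≤ (<⇒≤ 0<x) inv≤0)))

-- Integers as rationals

fromℤ-+ : ∀ i j → fromℤ (i ℤ.+ j) ≡ fromℤ i + fromℤ j
fromℤ-+ i j = toℚᵘ-injective (ℚᵘₚ.≃-trans (*≡* (lemma i j))
  (ℚᵘₚ.≃-sym (toℚᵘ-homo-+ (fromℤ i) (fromℤ j))))
  where
  lemma : ∀ i j → (i ℤ.+ j) ℤ.* + 1 ≡ (i ℤ.* + 1 ℤ.+ j ℤ.* + 1) ℤ.* + 1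
  lemma i j = cong (ℤ._* + 1) (sym (cong₂ ℤ._+_ (ℤₚ.*-identityʳ i) (ℤₚ.*-identityʳ j)))

fromℤ-* : ∀ i j → fromℤ (i ℤ.* j) ≡ fromℤ i * fromℤ j
fromℤ-* i j = toℚᵘ-injective (ℚᵘₚ.≃-trans (*≡* refl)
  (ℚᵘₚ.≃-sym (toℚᵘ-homo-* (fromℤ i) (fromℤ j))))

fromℤ-neg : ∀ i → fromℤ (ℤ.- i) ≡ - fromℤ i
fromℤ-neg (+ zero)  = refl
fromℤ-neg (+ suc n) = refl
fromℤ-neg -[1+ n ]  = refl

fromℤ-∣∣ : ∀ i → ∣ fromℤ i ∣ ≡ fromℤ (+ ℤ.∣ i ∣)
fromℤ-∣∣ (+ n)      = refl
fromℤ-∣∣ (-[1+ n ]) = refl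

fromℤ-mono-≤ : ∀ {i j} → i ℤ.≤ j → fromℤ i ≤ fromℤ j
fromℤ-mono-≤ {i} {j} i≤j = *≤* (subst₂ ℤ._≤_ (sym (ℤₚ.*-identityʳ i)) (sym (ℤₚ.*-identityʳ j)) i≤j)

fromℤ-cancel-≤ : ∀ {i j} → fromℤ i ≤ fromℤ j → i ℤ.≤ j
fromℤ-cancel-≤ {i} {j} (*≤* le) = subst₂ ℤ._≤_ (ℤₚ.*-identityʳ i) (ℤₚ.*-identityʳ j) le

fromℤ-mono-< : ∀ {i j} → i ℤ.< j → fromℤ i < fromℤ j
fromℤ-mono-< {i} {j} i<j = *<* (subst₂ ℤ._<_ (sym (ℤₚ.*-identityʳ i)) (sym (ℤₚ.*-identityʳ j)) i<j)

fromℤ-cancel-< : ∀ {i j} → fromℤ i < fromℤ j → i ℤ.< j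
fromℤ-cancel-< {i} {j} (*<* lt) = subst₂ ℤ._<_ (ℤₚ.*-identityʳ i) (ℤₚ.*-identityʳ j) lt

i≢0⇒1≤∣i∣ : ∀ {i} → i ≢ ℤ.0ℤ → 1ℚ ≤ ∣ fromℤ i ∣
i≢0⇒1≤∣i∣ {i} i≢0 = subst (1ℚ ≤_) (sym (fromℤ-∣∣ i))
  (fromℤ-mono-≤ (ℤ.+≤+ (ℕₚ.n≢0⇒n>0 (λ eq → i≢0 (ℤₚ.∣i∣≡0⇒i≡0 eq)))))

fromℤ-^ : ∀ i n → fromℤ (i ℤ.^ n) ≡ fromℤ i ^ n
fromℤ-^ i zero    = refl
fromℤ-^ i (suc n) = trans (fromℤ-* i (i ℤ.^ n)) (cong (fromℤ i *_) (fromℤ-^ i n))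

↥p≡p*↧p : ∀ p → fromℤ (↥ p) ≡ p * fromℤ (↧ p)
↥p≡p*↧p p@record{} = toℚᵘ-injective (ℚᵘₚ.≃-trans (*≡* (lemma (↥ p) (↧ p)))
  (ℚᵘₚ.≃-sym (toℚᵘ-homo-* p (fromℤ (↧ p)))))
  where
  lemma : ∀ i j → i ℤ.* (j ℤ.* + 1) ≡ (i ℤ.* j) ℤ.* + 1
  lemma i j = sym (ℤₚ.*-assoc i j (+ 1))

/-* : ∀ p q → .{{_ : ℕ.NonZero q}} → (p / q) * fromℤ (+ q) ≡ fromℤ p
/-* p q@(suc q-1) = toℚᵘ-injective (ℚᵘₚ.≃-trans (toℚᵘ-homo-* (p / q) (fromℤ (+ q)))
  (ℚᵘₚ.≃-trans (ℚᵘₚ.*-congʳ (toℚᵘ-fromℚᵘ (mkℚᵘ p q-1))) (*≡* (lemma p (+ q)))))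
  where
  lemma : ∀ i j → (i ℤ.* j) ℤ.* + 1 ≡ i ℤ.* (j ℤ.* + 1)
  lemma i j = ℤₚ.*-assoc i j (+ 1)

-- The numerator serves: `∣ x ∣ ≤ ∣ x ∣ * ↧ x = ∣ ↥ x ∣`, as the denominator is at least 1.
archimedean : ∀ x → ∃[ n ] x ≤ fromℤ (+ n)
archimedean x = ℤ.∣ ↥ x ∣ , ≤-trans (x≤∣x∣ x) (≤-trans
    (subst (_≤ ∣ x ∣ * fromℤ (↧ x)) (*-identityʳ ∣ x ∣)
      (*-monoʳ-≤ (0≤∣p∣ x) (fromℤ-mono-≤ (ℤ.+≤+ (ℕ.s≤s ℕ.z≤n)))))
    (≤-reflexive (trans (trans (sym (∣p*q∣≡∣p∣*∣q∣ x (fromℤ (↧ x)))) (cong ∣_∣ (sym (↥p≡p*↧p x))))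
        (fromℤ-∣∣ (↥ x)))))

fromℕ : ℕ → ℚ
fromℕ n = fromℤ (+ n)

fromℕ-+ : ∀ m n → fromℕ (m ℕ.+ n) ≡ fromℕ m + fromℕ n
fromℕ-+ m n = fromℤ-+ (+ m) (+ n)

fromℕ-* : ∀ m n → fromℕ (m ℕ.* n) ≡ fromℕ m * fromℕ n
fromℕ-* m n = trans (cong fromℤ (ℤₚ.pos-* m n)) (fromℤ-* (+ m) (+ n))

fromℕ-^ : ∀ m n → fromℕ (m ℕ.^ n) ≡ fromℕ m ^ n
fromℕ-^ m zero    = refl
fromℕ-^ m (suc n) = trans (fromℕ-* m (m ℕ.^ n)) (cong (fromℕ m *_) (fromℕ-^ m n))

fromℕ-mono-≤ : ∀ {m n} → m ℕ.≤ n → fromℕ m ≤ fromℕ n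
fromℕ-mono-≤ m≤n = fromℤ-mono-≤ (ℤ.+≤+ m≤n)

fromℕ-mono-< : ∀ {m n} → m ℕ.< n → fromℕ m < fromℕ n
fromℕ-mono-< m<n = fromℤ-mono-< (ℤ.+<+ m<n)

fromℕ-cancel-≤ : ∀ {m n} → fromℕ m ≤ fromℕ n → m ℕ.≤ n
fromℕ-cancel-≤ le = ℤₚ.drop‿+≤+ (fromℤ-cancel-≤ le)

fromℕ-cancel-< : ∀ {m n} → fromℕ m < fromℕ n → m ℕ.< n
fromℕ-cancel-< lt = ℕₚ.≰⇒> λ n≤m → <-irrefl refl (<-≤-trans lt (fromℕ-mono-≤ n≤m))

0≤fromℕ : ∀ n → 0ℚ ≤ fromℕ n
0≤fromℕ n = fromℕ-mono-≤ ℕ.z≤n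

0<fromℕ : ∀ n → .{{ℕ.NonZero n}} → 0ℚ < fromℕ n
0<fromℕ (suc n) = fromℕ-mono-< (ℕ.s≤s ℕ.z≤n)

-- Growth, crossing points and bounds on the natural numbers.

n<m^n : ∀ {m} → 2 ℕ.≤ m → ∀ n → n ℕ.< m ℕ.^ n
n<m^n {m} 2≤m zero    = ℕₚ.≤-refl
n<m^n {m} 2≤m (suc n) = begin-strict
  suc n             <⟨ ℕ.s≤s (n<m^n 2≤m n) ⟩
  1 ℕ.+ m ℕ.^ n     ≤⟨ ℕₚ.+-monoˡ-≤ (m ℕ.^ n) (ℕₚ.≤-trans (ℕ.s≤s ℕ.z≤n) (n<m^n 2≤m n)) ⟩
  m ℕ.^ n ℕ.+ m ℕ.^ n ≡⟨ cong (m ℕ.^ n ℕ.+_) (sym (ℕₚ.+-identityʳ _)) ⟩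
  2 ℕ.* m ℕ.^ n     ≤⟨ ℕₚ.*-monoˡ-≤ (m ℕ.^ n) 2≤m ⟩
  m ℕ.* m ℕ.^ n     ∎
  where open ℕₚ.≤-Reasoning

-- A discrete intermediate value principle. It locates both the level `t` and the index `k` that
-- belong to a given denominator; in both cases the upper end `m + n` comes from a crude growth
-- estimate.
crossing : ∀ {P : ℕ → Set} → Decidable P → ∀ m n → P m → ¬ P (m ℕ.+ n) →
           ∃[ k ] m ℕ.≤ k × k ℕ.< m ℕ.+ n × P k × ¬ P (suc k)
crossing {P} P? m zero    Pm ¬P = contradiction (subst P (sym (ℕₚ.+-identityʳ m)) Pm) ¬P
crossing {P} P? m (suc n) Pm ¬P with P? (m ℕ.+ n)
... | yes Pmn = m ℕ.+ n , ℕₚ.m≤m+n m n , ℕₚ.+-monoʳ-< m ℕₚ.≤-refl , Pmn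
              , subst (λ k → ¬ P k) (ℕₚ.+-suc m n) ¬P
... | no ¬Pmn =
  let k , m≤k , k<m+n , rest = crossing P? m n Pm ¬Pmn
  in  k , m≤k , ℕₚ.<-≤-trans k<m+n (ℕₚ.+-monoʳ-≤ m (ℕₚ.n≤1+n n)) , rest

upperBound : ∀ (u : ℕ → ℕ) n → ∃[ B ] (∀ k → k ℕ.< n → u k ℕ.≤ B)
upperBound u zero    = 0 , λ _ ()
upperBound u (suc n) =
  let B , u≤B = upperBound u n
  in  B ℕ.⊔ u n , λ k k<1+n → case-≤ B u≤B k (ℕₚ.m≤n⇒m<n∨m≡n (ℕ.s≤s⁻¹ k<1+n))
  where
  case-≤ : ∀ B → (∀ k → k ℕ.< n → u k ℕ.≤ B) → ∀ k → k ℕ.< n ⊎ k ≡ n → u k ℕ.≤ B ℕ.⊔ u n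
  case-≤ B u≤B k (inj₁ k<n)  = ℕₚ.≤-trans (u≤B k k<n) (ℕₚ.m≤m⊔n B (u n))
  case-≤ B u≤B k (inj₂ refl) = ℕₚ.m≤n⊔m B (u n)

Eventually-∧ : ∀ {P Q : ℕ → Set} → Eventually P → Eventually Q → Eventually (λ n → P n × Q n)
Eventually-∧ (M , P) (N , Q) = M ℕ.⊔ N , λ n h →
  P n (ℕₚ.≤-trans (ℕₚ.m≤m⊔n M N) h) , Q n (ℕₚ.≤-trans (ℕₚ.m≤n⊔m M N) h)

Eventually-map : ∀ {P Q : ℕ → Set} → (∀ {n} → P n → Q n) → Eventually P → Eventually Q
Eventually-map f (N , P) = N , λ n h → f (P n h)

Eventually-witness : ∀ {P : ℕ → Set} → Eventually P → ∃[ n ] P n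
Eventually-witness (N , P) = N , P N ℕₚ.≤-refl

-- Diophantine approximation

-- Q ≈ X^D and ∣QF - P∣ ≈ X^(-D′), up to factors X^M.
record GoodApproximation (F : ℕ → ℚ) (X : ℚ) (M D D′ : ℕ) : Set where
  field
    P : ℤ
    Q : ℕ
    1≤Q       : 1 ℕ.≤ Q
    Q-lower   : X ^ D ≤ X ^ M * fromℕ Q
    Q-upper   : fromℕ Q ≤ X ^ (D ℕ.+ M)
    err-lower : Eventually λ n → 1ℚ ≤ X ^ (D′ ℕ.+ M) * ∣ fromℕ Q * F n - fromℤ P ∣
    err-upper : Eventually λ n → X ^ D′ * ∣ fromℕ Q * F n - fromℤ P ∣ ≤ X ^ M

m*[p/m]≡p : ∀ p m → .{{_ : ℕ.NonZero m}} → fromℕ m * (p / m) ≡ fromℤ p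
m*[p/m]≡p p m = trans (*-comm (fromℕ m) (p / m)) (/-* p m)

∣mx-p∣ : ∀ x p m → .{{_ : ℕ.NonZero m}} → ∣ fromℕ m * x - fromℤ p ∣ ≡ fromℕ m * ∣ x - p / m ∣
∣mx-p∣ x p m = begin
  ∣ fromℕ m * x - fromℤ p ∣            ≡⟨ cong (λ y → ∣ fromℕ m * x - y ∣) (m*[p/m]≡p p m) ⟨
  ∣ fromℕ m * x - fromℕ m * (p / m) ∣  ≡⟨ cong ∣_∣ (factor (fromℕ m) x (p / m)) ⟩
  ∣ fromℕ m * (x - p / m) ∣            ≡⟨ ∣p*q∣≡∣p∣*∣q∣ (fromℕ m) (x - p / m) ⟩
  fromℕ m * ∣ x - p / m ∣              ∎
  where
  open ≡-Reasoning
  factor : ∀ m x y → m * x - m * y ≡ m * (x - y)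
  factor = solve-∀ ℚ-ring

module CrossMultiplication (x y : ℚ) where
  private
    m e : ℚ
    m = fromℕ (↧ₙ x)
    e = fromℕ (↧ₙ y)
    0<me : 0ℚ < m * e
    0<me = *-pos {m} {e} (0<fromℕ (↧ₙ x)) (0<fromℕ (↧ₙ y))
    eq₁ : ∀ x m e → m * e * x ≡ x * m * e
    eq₁ = solve-∀ ℚ-ring
    eq₂ : ∀ y m e → m * e * (y + 1ℚ) ≡ (y * e + e) * m
    eq₂ = solve-∀ ℚ-ring
    lhs : m * e * x ≡ fromℤ (↥ x ℤ.* ↧ y)
    lhs = trans (eq₁ x m e)
      (trans (cong (_* e) (sym (↥p≡p*↧p x))) (sym (fromℤ-* (↥ x) (↧ y))))
    rhs : m * e * (y + 1ℚ) ≡ fromℤ ((↥ y ℤ.+ ↧ y) ℤ.* ↧ x)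
    rhs = trans (eq₂ y m e)
      (trans (cong (_* m) (trans (cong (_+ e) (sym (↥p≡p*↧p y))) (sym (fromℤ-+ (↥ y) (↧ y)))))
        (sym (fromℤ-* (↥ y ℤ.+ ↧ y) (↧ x))))

  -- Once denominators are cleared, the summand 1 of the theorem turns into the denominator `↧ y`
  -- added to the numerator of `y`.
  x<y+1⇒ : x < y + 1ℚ → ↥ x ℤ.* ↧ y ℤ.< (↥ y ℤ.+ ↧ y) ℤ.* ↧ x
  x<y+1⇒ h = fromℤ-cancel-< (subst₂ _<_ lhs rhs (*-monoʳ-< 0<me h))

  y+1<x⇒ : y + 1ℚ < x → (↥ y ℤ.+ ↧ y) ℤ.* ↧ x ℤ.< ↥ x ℤ.* ↧ y
  y+1<x⇒ h = fromℤ-cancel-< (subst₂ _<_ rhs lhs (*-monoʳ-< 0<me h))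

1≤2 : 1ℚ ≤ 2ℚ
1≤2 = subst (_≤ 2ℚ) (+-identityˡ 1ℚ) (+-monoˡ-≤ 1ℚ 0≤1)

-- Unless p/q = P/Q, the distance ∣p/q - P/Q∣ ≥ 1/(qQ) is at least twice ∣x - P/Q∣.
separation : ∀ {X M D D′ x P Q} p q .{{_ : ℕ.NonZero q}} → 2ℚ ≤ X →
  fromℕ Q ≤ X ^ (D ℕ.+ M) →
  1ℚ ≤ X ^ (D′ ℕ.+ M) * ∣ fromℕ Q * x - fromℤ P ∣ →
  X ^ D′ * ∣ fromℕ Q * x - fromℤ P ∣ ≤ X ^ M →
  fromℕ q * X ^ suc M ≤ X ^ D′ →
  1ℚ ≤ X ^ (D′ ℕ.+ M ℕ.+ suc (D ℕ.+ M)) * ∣ x - p / q ∣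
separation {X} {M} {D} {D′} {x} {P} {Q} p q 2≤X Q≤ 1≤η η≤ q≤ = result
  where
  open ≤-Reasoning
  1≤X : 1ℚ ≤ X
  1≤X = ≤-trans 1≤2 2≤X
  0≤X : 0ℚ ≤ X
  0≤X = ≤-trans 0≤1 1≤X
  η δ Q′ q′ : ℚ
  η  = ∣ fromℕ Q * x - fromℤ P ∣
  δ  = ∣ x - p / q ∣
  Q′ = fromℕ Q
  q′ = fromℕ q
  0≤η : 0ℚ ≤ η
  0≤η = 0≤∣p∣ _
  0≤δ : 0ℚ ≤ δ
  0≤δ = 0≤∣p∣ _
  0≤Q′ : 0ℚ ≤ Q′
  0≤Q′ = 0≤fromℕ Q
  0≤q′ : 0ℚ ≤ q′
  0≤q′ = 0≤fromℕ q
  W : ℚ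
  W = X ^ (D′ ℕ.+ M)
  1≤W : 1ℚ ≤ W
  1≤W = 1≤^ 1≤X (D′ ℕ.+ M)
  0≤W : 0ℚ ≤ W
  0≤W = ≤-trans 0≤1 1≤W
  Y : ℚ
  Y = X ^ (D ℕ.+ M)
  0≤Y : 0ℚ ≤ Y
  0≤Y = ^-nonNeg 0≤X (D ℕ.+ M)
  expand : X ^ (D′ ℕ.+ M ℕ.+ suc (D ℕ.+ M)) * δ ≡ W * (X * Y) * δ
  expand = cong (_* δ) (^-homo-* X (D′ ℕ.+ M) (suc (D ℕ.+ M)))
  N : ℤ
  N = P ℤ.* + q ℤ.- p ℤ.* + Q
  N-expand : fromℤ N ≡ fromℤ P * q′ - fromℤ p * Q′
  N-expand = trans (fromℤ-+ (P ℤ.* + q) (ℤ.- (p ℤ.* + Q)))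
    (cong₂ _+_ (fromℤ-* P (+ q)) (trans (fromℤ-neg (p ℤ.* + Q)) (cong -_ (fromℤ-* p (+ Q)))))
  qδ : q′ * δ ≡ ∣ q′ * x - fromℤ p ∣
  qδ = sym (∣mx-p∣ x p q)
  ∣c*y∣ : ∀ {c} → 0ℚ ≤ c → ∀ y → ∣ c * y ∣ ≡ c * ∣ y ∣
  ∣c*y∣ {c} 0≤c y = trans (∣p*q∣≡∣p∣*∣q∣ c y) (cong (_* ∣ y ∣) (0≤p⇒∣p∣≡p 0≤c))
  -- Here `p/q = P/Q`, so `η = Q′ * δ` and the lower bound on `η` suffices; the spare factor `X`
  -- only matches the exponent of the other case.
  equal : fromℤ N ≡ 0ℚ → 1ℚ ≤ W * (X * Y) * δ
  equal N≡0 = *-cancelˡ-≤ {q′} (0<fromℕ q) (begin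
    q′ * 1ℚ              ≤⟨ *-monoʳ-≤ 0≤q′ 1≤η ⟩
    q′ * (W * η)         ≡⟨ swap q′ W η ⟩
    W * (q′ * η)         ≡⟨ cong (W *_) (sym (∣c*y∣ 0≤q′ (Q′ * x - fromℤ P))) ⟩
    W * ∣ q′ * (Q′ * x - fromℤ P) ∣  ≡⟨ cong (λ y → W * ∣ y ∣) same ⟩
    W * ∣ Q′ * (q′ * x - fromℤ p) ∣  ≡⟨ cong (W *_) (∣c*y∣ 0≤Q′ (q′ * x - fromℤ p)) ⟩
    W * (Q′ * ∣ q′ * x - fromℤ p ∣)  ≡⟨ cong (λ y → W * (Q′ * y)) (sym qδ) ⟩
    W * (Q′ * (q′ * δ))  ≤⟨ *-monoʳ-≤ 0≤W (*-monoˡ-≤ (*-nonNeg 0≤q′ 0≤δ) Q′≤XY) ⟩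
    W * (X * Y * (q′ * δ))  ≡⟨ regroup W (X * Y) q′ δ ⟩
    q′ * (W * (X * Y) * δ)    ∎)
    where
    swap : ∀ a b c → a * (b * c) ≡ b * (a * c)
    swap = solve-∀ ℚ-ring
    regroup : ∀ a b c e → a * (b * (c * e)) ≡ c * (a * b * e)
    regroup = solve-∀ ℚ-ring
    identity : ∀ q Q x P p → q * (Q * x - P) ≡ Q * (q * x - p) - (P * q - p * Q)
    identity = solve-∀ ℚ-ring
    same : q′ * (Q′ * x - fromℤ P) ≡ Q′ * (q′ * x - fromℤ p)
    same = trans (identity q′ Q′ x (fromℤ P) (fromℤ p))
      (trans (cong (λ y → Q′ * (q′ * x - fromℤ p) - y) (trans (sym N-expand) N≡0))
        (+-identityʳ _))
    Q′≤XY : Q′ ≤ X * Y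
    Q′≤XY = ≤-trans Q≤ (subst (_≤ X * Y) (*-identityˡ Y) (*-monoˡ-≤ 0≤Y 1≤X))
  2qη≤1 : 2ℚ * (q′ * η) ≤ 1ℚ
  2qη≤1 = *-cancelˡ-≤ {X ^ M} (<-≤-trans 0<1 (1≤^ 1≤X M)) (begin
    X ^ M * (2ℚ * (q′ * η))  ≤⟨ *-monoʳ-≤ (^-nonNeg 0≤X M) (*-monoˡ-≤ (*-nonNeg 0≤q′ 0≤η) 2≤X) ⟩
    X ^ M * (X * (q′ * η))   ≡⟨ regroup (X ^ M) X q′ η ⟩
    q′ * X ^ suc M * η       ≤⟨ *-monoˡ-≤ 0≤η q≤ ⟩
    X ^ D′ * η               ≤⟨ η≤ ⟩
    X ^ M                    ≡⟨ *-identityʳ (X ^ M) ⟨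
    X ^ M * 1ℚ               ∎)
    where
    regroup : ∀ a b c e → a * (b * (c * e)) ≡ c * (b * a) * e
    regroup = solve-∀ ℚ-ring
  distinct : N ≢ ℤ.0ℤ → 1ℚ ≤ W * (X * Y) * δ
  distinct N≢0 = begin
    -- Twice `1≤sum` and `2qη≤1` add up to this: the part of `1 ≤ q′η + Q′q′δ` that is due to `P/Q`
    -- is at most one half.
    1ℚ                     ≤⟨ 0≤y-x⇒x≤y (subst (0ℚ ≤_) (combine (q′ * η) (Q′ * (q′ * δ)))
                                (+-nonNeg (+-nonNeg (x≤y⇒0≤y-x 1≤sum) (x≤y⇒0≤y-x 1≤sum)) (x≤y⇒0≤y-x 2qη≤1))) ⟩
    2ℚ * (Q′ * (q′ * δ))   ≤⟨ *-mono-≤ (≤-trans 0≤1 1≤2) (*-nonNeg 0≤Y (*-nonNeg 0≤q′ 0≤δ)) 2≤X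
                                (*-monoˡ-≤ (*-nonNeg 0≤q′ 0≤δ) Q≤) ⟩
    X * (Y * (q′ * δ))     ≡⟨ regroup X Y q′ δ ⟩
    q′ * (X * Y * δ)       ≤⟨ *-monoˡ-≤ (*-nonNeg (*-nonNeg 0≤X 0≤Y) 0≤δ) q′≤W ⟩
    W * (X * Y * δ)        ≡⟨ *-assoc W (X * Y) δ ⟨
    W * (X * Y) * δ        ∎
    where
    regroup : ∀ a b c e → a * (b * (c * e)) ≡ c * (a * b * e)
    regroup = solve-∀ ℚ-ring
    combine : ∀ a b → (a + b - 1ℚ) + (a + b - 1ℚ) + (1ℚ - (1ℚ + 1ℚ) * a) ≡ (1ℚ + 1ℚ) * b - 1ℚ
    combine = solve-∀ ℚ-ring
    identity : ∀ q Q x P p → P * q - p * Q ≡ Q * (q * x - p) - q * (Q * x - P)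
    identity = solve-∀ ℚ-ring
    1≤sum : 1ℚ ≤ q′ * η + Q′ * (q′ * δ)
    1≤sum = begin
      1ℚ                       ≤⟨ i≢0⇒1≤∣i∣ N≢0 ⟩
      ∣ fromℤ N ∣              ≡⟨ cong ∣_∣ (trans N-expand (identity q′ Q′ x (fromℤ P) (fromℤ p))) ⟩
      ∣ Q′ * (q′ * x - fromℤ p) - q′ * (Q′ * x - fromℤ P) ∣
                               ≤⟨ ∣p-q∣≤∣p∣+∣q∣ (Q′ * (q′ * x - fromℤ p)) (q′ * (Q′ * x - fromℤ P)) ⟩
      ∣ Q′ * (q′ * x - fromℤ p) ∣ + ∣ q′ * (Q′ * x - fromℤ P) ∣
                               ≡⟨ cong₂ _+_ (∣c*y∣ 0≤Q′ (q′ * x - fromℤ p)) (∣c*y∣ 0≤q′ (Q′ * x - fromℤ P)) ⟩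
      Q′ * ∣ q′ * x - fromℤ p ∣ + q′ * η
                               ≡⟨ cong (λ y → Q′ * y + q′ * η) (sym qδ) ⟩
      Q′ * (q′ * δ) + q′ * η   ≡⟨ +-comm (Q′ * (q′ * δ)) (q′ * η) ⟩
      q′ * η + Q′ * (q′ * δ)   ∎
    q′≤W : q′ ≤ W
    q′≤W = begin
      q′               ≡⟨ *-identityʳ q′ ⟨
      q′ * 1ℚ          ≤⟨ *-monoʳ-≤ 0≤q′ (1≤^ 1≤X (suc M)) ⟩
      q′ * X ^ suc M   ≤⟨ q≤ ⟩
      X ^ D′           ≤⟨ ^-monoʳ-≤ 1≤X (ℕₚ.m≤m+n D′ M) ⟩
      W                ∎
  result : 1ℚ ≤ X ^ (D′ ℕ.+ M ℕ.+ suc (D ℕ.+ M)) * δ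
  result with N ℤₚ.≟ ℤ.0ℤ
  ... | yes N≡0 = subst (1ℚ ≤_) (sym expand) (equal (cong fromℤ N≡0))
  ... | no  N≢0 = subst (1ℚ ≤_) (sym expand) (distinct N≢0)

-- `δ ^ m * q ^ n ≤ 1ℚ` is the root-free form of `δ ≤ q^(-n/m)`. Since `δ` is at least `1/w`, the
-- same bound holds with `1/w` in place of `δ`.
^-bound : ∀ {w δ q : ℚ} m n → 0ℚ ≤ w → 0ℚ ≤ δ → 0ℚ ≤ q →
          1ℚ ≤ w * δ → δ ^ m * q ^ n ≤ 1ℚ → q ^ n ≤ w ^ m
^-bound {w} {δ} {q} m n 0≤w 0≤δ 0≤q 1≤wδ δq≤1 = begin
  q ^ n                    ≡⟨ *-identityˡ (q ^ n) ⟨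
  1ℚ * q ^ n               ≤⟨ *-monoˡ-≤ (^-nonNeg 0≤q n) (1≤^ 1≤wδ m) ⟩
  (w * δ) ^ m * q ^ n      ≡⟨ cong (_* q ^ n) (^-distrib-* w δ m) ⟩
  w ^ m * δ ^ m * q ^ n    ≡⟨ *-assoc (w ^ m) (δ ^ m) (q ^ n) ⟩
  w ^ m * (δ ^ m * q ^ n)  ≤⟨ *-monoʳ-≤ (^-nonNeg 0≤w m) δq≤1 ⟩
  w ^ m * 1ℚ               ≡⟨ *-identityʳ (w ^ m) ⟩
  w ^ m                    ∎
  where open ≤-Reasoning

-- All quantities are compared with powers of `X`, and `1ℚ < X` lets the inequality descend to the
-- exponents. From here on the upper bound is arithmetic of natural numbers.
exponents-≤ : ∀ {X δ q : ℚ} {D K} w m n → 1ℚ < X → 0ℚ ≤ δ → 0ℚ ≤ q →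
  1ℚ ≤ X ^ w * δ → δ ^ m * q ^ n ≤ 1ℚ → X ^ D ≤ q * X ^ K →
  D ℕ.* n ℕ.≤ w ℕ.* m ℕ.+ K ℕ.* n
exponents-≤ {X} {δ} {q} {D} {K} w m n 1<X 0≤δ 0≤q 1≤ δq≤1 D≤ = ^-cancelʳ-≤ 1<X (begin
  X ^ (D ℕ.* n)                  ≡⟨ ^-assocʳ X D n ⟨
  (X ^ D) ^ n                    ≤⟨ ^-monoˡ-≤ (^-nonNeg 0≤X D) D≤ n ⟩
  (q * X ^ K) ^ n                ≡⟨ ^-distrib-* q (X ^ K) n ⟩
  q ^ n * (X ^ K) ^ n            ≤⟨ *-monoˡ-≤ (^-nonNeg (^-nonNeg 0≤X K) n)
      (^-bound m n (^-nonNeg 0≤X w) 0≤δ 0≤q 1≤ δq≤1) ⟩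
  (X ^ w) ^ m * (X ^ K) ^ n      ≡⟨ cong₂ _*_ (^-assocʳ X w m) (^-assocʳ X K n) ⟩
  X ^ (w ℕ.* m) * X ^ (K ℕ.* n)  ≡⟨ ^-homo-* X (w ℕ.* m) (K ℕ.* n) ⟨
  X ^ (w ℕ.* m ℕ.+ K ℕ.* n)      ∎)
  where
  open ≤-Reasoning
  0≤X : 0ℚ ≤ X
  0≤X = ≤-trans 0≤1 (<⇒≤ 1<X)

-- With `s = a/e` and `s₀ = n/m` the hypotheses say `D′/D ≤ s` and `s + 1 < s₀`. The second is a
-- strict inequality of natural numbers, hence leaves a gap of at least 1; after multiplication by
-- `D` one whole `D` remains, and all terms with `M` are independent of `D`.
degree-bound : ∀ {D D′ M a e m n} → e ℕ.* D′ ℕ.≤ a ℕ.* D → (a ℕ.+ e) ℕ.* m ℕ.< n ℕ.* e →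
  D ℕ.* n ℕ.≤ (D′ ℕ.+ M ℕ.+ suc (D ℕ.+ M)) ℕ.* m ℕ.+ suc M ℕ.* n →
  D ℕ.≤ suc (M ℕ.+ M) ℕ.* e ℕ.* m ℕ.+ suc M ℕ.* n ℕ.* e
degree-bound {D} {D′} {M} {a} {e} {m} {n} eD′≤aD lt le =
  ℕₚ.+-cancelˡ-≤ (D ℕ.* ((a ℕ.+ e) ℕ.* m)) D _ (begin
    D ℕ.* ((a ℕ.+ e) ℕ.* m) ℕ.+ D    ≡⟨ ℕₚ.+-comm _ D ⟩
    D ℕ.+ D ℕ.* ((a ℕ.+ e) ℕ.* m)    ≡⟨ ℕₚ.*-suc D _ ⟨
    D ℕ.* suc ((a ℕ.+ e) ℕ.* m)      ≤⟨ ℕₚ.*-monoʳ-≤ D lt ⟩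
    D ℕ.* (n ℕ.* e)                  ≡⟨ ℕₚ.*-assoc D n e ⟨
    D ℕ.* n ℕ.* e                    ≤⟨ ℕₚ.*-monoˡ-≤ e le ⟩
    ((D′ ℕ.+ M ℕ.+ suc (D ℕ.+ M)) ℕ.* m ℕ.+ suc M ℕ.* n) ℕ.* e
                                     ≡⟨ eq₁ D D′ M e m n ⟩
    e ℕ.* D′ ℕ.* m ℕ.+ (D ℕ.* e ℕ.* m ℕ.+ rest)
                                     ≤⟨ ℕₚ.+-monoˡ-≤ _ (ℕₚ.*-monoˡ-≤ m eD′≤aD) ⟩
    a ℕ.* D ℕ.* m ℕ.+ (D ℕ.* e ℕ.* m ℕ.+ rest)
                                     ≡⟨ eq₂ a D M e m n ⟩
    D ℕ.* ((a ℕ.+ e) ℕ.* m) ℕ.+ rest ∎)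
  where
  open ℕₚ.≤-Reasoning
  rest : ℕ
  rest = suc (M ℕ.+ M) ℕ.* e ℕ.* m ℕ.+ suc M ℕ.* n ℕ.* e
  eq₁ : ∀ D D′ M e m n → ((D′ ℕ.+ M ℕ.+ suc (D ℕ.+ M)) ℕ.* m ℕ.+ suc M ℕ.* n) ℕ.* e ≡
    e ℕ.* D′ ℕ.* m ℕ.+ (D ℕ.* e ℕ.* m ℕ.+ (suc (M ℕ.+ M) ℕ.* e ℕ.* m ℕ.+ suc M ℕ.* n ℕ.* e))
  eq₁ = ℕ-Solver.solve-∀
  eq₂ : ∀ a D M e m n → a ℕ.* D ℕ.* m ℕ.+ (D ℕ.* e ℕ.* m ℕ.+ (suc (M ℕ.+ M) ℕ.* e ℕ.* m ℕ.+ suc M ℕ.* n ℕ.* e))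
      ≡
    D ℕ.* ((a ℕ.+ e) ℕ.* m) ℕ.+ (suc (M ℕ.+ M) ℕ.* e ℕ.* m ℕ.+ suc M ℕ.* n ℕ.* e)
  eq₂ = ℕ-Solver.solve-∀

-- Approximation inequalities with rational exponents, written without roots.

↥-nonNeg : ∀ {p} → 0ℚ ≤ p → ↥ p ≡ + ℤ.∣ ↥ p ∣
↥-nonNeg {mkℚ (+ n)    _ _} _  = refl
↥-nonNeg {mkℚ -[1+ n ] d c} le = contradiction le (<⇒≱ (negative⁻¹ (mkℚ -[1+ n ] d c)))
  where
  <⇒≱ : ∀ {x y} → x < y → ¬ y ≤ x
  <⇒≱ x<y y≤x = <-irrefl refl (<-≤-trans x<y y≤x)

inv^*^ : ∀ {x} → x ≢ 0ℚ → ∀ n → inv x ^ n * x ^ n ≡ 1ℚ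
inv^*^ {x} x≢0 n = trans (sym (^-distrib-* (inv x) x n))
  (trans (cong (_^ n) (trans (*-comm (inv x) x) (x*inv-x≡1 x x≢0))) (1^n≡1 n))

^ℤ-neg : ∀ x n → x ^ℤ (ℤ.- + n) ≡ inv x ^ n
^ℤ-neg x zero    = refl
^ℤ-neg x (suc n) = refl

≤^-ℚ⇒ : ∀ {s q r} n → ↥ r ≡ + n → .{{ℕ.NonZero q}} → s ≤ q ^-ℚ r → s ^ ↧ₙ r * fromℕ q ^ n ≤ 1ℚ
≤^-ℚ⇒ {s} {q} {r} n eq (0≤s , le) = subst (s ^ ↧ₙ r * fromℕ q ^ n ≤_) (inv^*^ q≢0 n)
  (*-monoˡ-≤ (^-nonNeg (0≤fromℕ q) n)
    (subst (s ^ ↧ₙ r ≤_) (trans (cong (λ k → fromℕ q ^ℤ (ℤ.- k)) eq) (^ℤ-neg (fromℕ q) n)) le))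
  where
  q≢0 : fromℕ q ≢ 0ℚ
  q≢0 = ≢-sym (<⇒≢ (0<fromℕ q))

^-ℚ⇐ : ∀ {s q r} n → ↥ r ≡ + n → .{{ℕ.NonZero q}} → 0ℚ ≤ s → s ^ ↧ₙ r * fromℕ q ^ n ≤ 1ℚ → s ≤ q ^-ℚ r
^-ℚ⇐ {s} {q} {r} n eq 0≤s le = 0≤s ,
  subst (s ^ ↧ₙ r ≤_) (sym (trans (cong (λ k → fromℕ q ^ℤ (ℤ.- k)) eq) (^ℤ-neg (fromℕ q) n)))
    (*-cancelˡ-≤ {fromℕ q ^ n} (^-pos (0<fromℕ q) n)
      (subst₂ _≤_ (*-comm (s ^ ↧ₙ r) (fromℕ q ^ n)) (trans (sym (inv^*^ q≢0 n)) (*-comm (inv (fromℕ q) ^ n)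
          (fromℕ q ^ n))) le))
  where
  q≢0 : fromℕ q ≢ 0ℚ
  q≢0 = ≢-sym (<⇒≢ (0<fromℕ q))

-- The definition supplies a rational `r` above `μ`, hence above `s`, and `1 ≤ q` allows the
-- exponent `r` to be lowered to `s`. As `r` and `s` have different denominators, the comparison is
-- made after raising to the power `↧ₙ r`; this power can be cancelled because the right-hand side
-- is 1.
approximation-bound : ∀ {α μ p q} s n → ↥ s ≡ + n → 0ℚ ≤ s → .{{_ : ℕ.NonZero q}} →
  Eventually (λ i → s ≤ seq μ i) → dist α (p / q) < q ^- μ →
  Eventually (λ i → ∣ seq α i - p / q ∣ ^ ↧ₙ s * fromℕ q ^ n ≤ 1ℚ)
approximation-bound {α} {μ} {p} {q} s n ↥s≡n 0≤s s≤μ (b , (c , c<b , α≤c) , r , (v , v<r , μ≤v) , b≤q^-r) =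
  Eventually-map (λ {i} δ≤c → ^-cancel-≤1 (*-nonNeg (^-nonNeg (0≤∣p∣ (seq α i - p / q)) m)
      (^-nonNeg (0≤fromℕ q) n)) m′
    (bound (0≤∣p∣ (seq α i - p / q)) (≤-trans δ≤c (<⇒≤ c<b)))) α≤c
  where
  open ≤-Reasoning
  s<r : s < r
  s<r = let i , s≤ , ≤v = Eventually-witness (Eventually-∧ s≤μ μ≤v)
        in  ≤-<-trans (≤-trans s≤ ≤v) v<r
  m m′ n′ : ℕ
  m  = ↧ₙ s
  m′ = ↧ₙ r
  n′ = ℤ.∣ ↥ r ∣
  ↥r≡n′ : ↥ r ≡ + n′
  ↥r≡n′ = ↥-nonNeg (≤-trans 0≤s (<⇒≤ s<r))
  nm′≤n′m : n ℕ.* m′ ℕ.≤ n′ ℕ.* m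
  nm′≤n′m = ℤₚ.drop‿+≤+ (subst₂ ℤ._≤_
    (trans (cong (ℤ._* + m′) ↥s≡n) (sym (ℤₚ.pos-* n m′)))
    (trans (cong (ℤ._* + m) ↥r≡n′) (sym (ℤₚ.pos-* n′ m))) (ℤₚ.<⇒≤ (drop-*<* s<r)))
  Q : ℚ
  Q = fromℕ q
  1≤Q : 1ℚ ≤ Q
  1≤Q = fromℕ-mono-≤ {1} {q} (ℕₚ.n≢0⇒n>0 (ℕ.≢-nonZero⁻¹ q))
  bound : ∀ {δ} → 0ℚ ≤ δ → δ ≤ b → (δ ^ m * Q ^ n) ^ m′ ≤ 1ℚ
  bound {δ} 0≤δ δ≤b = begin
    (δ ^ m * Q ^ n) ^ m′           ≡⟨ ^-distrib-* (δ ^ m) (Q ^ n) m′ ⟩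
    (δ ^ m) ^ m′ * (Q ^ n) ^ m′    ≡⟨ cong₂ _*_ (^-assocʳ δ m m′) (^-assocʳ Q n m′) ⟩
    δ ^ (m ℕ.* m′) * Q ^ (n ℕ.* m′)  ≤⟨ *-mono-≤ (^-nonNeg 0≤δ (m ℕ.* m′)) (^-nonNeg (≤-trans 0≤1 1≤Q)
        (n′ ℕ.* m))
                                          (^-monoˡ-≤ 0≤δ δ≤b (m ℕ.* m′)) (^-monoʳ-≤ 1≤Q nm′≤n′m) ⟩
    b ^ (m ℕ.* m′) * Q ^ (n′ ℕ.* m)  ≡⟨ cong (λ k → b ^ k * Q ^ (n′ ℕ.* m)) (ℕₚ.*-comm m m′) ⟩
    b ^ (m′ ℕ.* m) * Q ^ (n′ ℕ.* m)  ≡⟨ cong₂ _*_ (^-assocʳ b m′ m) (^-assocʳ Q n′ m) ⟨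
    (b ^ m′) ^ m * (Q ^ n′) ^ m      ≡⟨ ^-distrib-* (b ^ m′) (Q ^ n′) m ⟨
    (b ^ m′ * Q ^ n′) ^ m            ≤⟨ ^≤1 (*-nonNeg (^-nonNeg (proj₁ b≤q^-r) m′)
        (^-nonNeg (≤-trans 0≤1 1≤Q) n′))
                                          (≤^-ℚ⇒ {b} {q} {r} n′ ↥r≡n′ b≤q^-r) m ⟩
    1ℚ                               ∎

-- Fractions with bounded numerator and denominator.

cauchy⇒bounded : ∀ x → ∃[ B ] Eventually (λ n → ∣ seq x n ∣ ≤ fromℕ B)
cauchy⇒bounded x =
  let N , close = cauchy x 1ℚ 0<1
      B , ≤B = archimedean (∣ seq x N ∣ + 1ℚ)
  in  B , N , λ n N≤n → ≤-trans (∣x∣≤∣y∣+∣x-y∣ (seq x n) (seq x N))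
        (≤-trans (+-monoʳ-≤ ∣ seq x N ∣ (<⇒≤ (close n N N≤n ℕₚ.≤-refl))) ≤B)

-- `Infinite` produces a solution outside any given list. Given this list, it produces one whose
-- numerator or denominator is large.
box : ℕ → List (ℤ × ℕ)
box B = cartesianProduct (map +_ (upTo (suc B)) ++ map (λ n → ℤ.- + n) (upTo (suc B))) (upTo (suc B))

∈-box : ∀ {B p q} → ℤ.∣ p ∣ ℕ.≤ B → q ℕ.≤ B → (p , q) ∈ box B
∈-box {B} {p} {q} p≤B q≤B = ∈-cartesianProduct⁺ (∈-integers p p≤B) (∈-upTo⁺ (ℕ.s≤s q≤B))
  where
  ∈-integers : ∀ p → ℤ.∣ p ∣ ℕ.≤ B → p ∈ map +_ (upTo (suc B)) ++ map (λ n → ℤ.- + n) (upTo (suc B))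
  ∈-integers (+ n)    le = ∈-++⁺ˡ (∈-map⁺ +_ (∈-upTo⁺ (ℕ.s≤s le)))
  ∈-integers -[1+ n ] le = ∈-++⁺ʳ (map +_ (upTo (suc B))) (∈-map⁺ (λ n → ℤ.- + n) (∈-upTo⁺ (ℕ.s≤s le)))

-- Near a bounded number a small denominator forces a small numerator, so a close fraction outside a
-- suitable box has a large denominator.
numerator-bound : ∀ {x : ℚ} {B Q} p q → .{{_ : ℕ.NonZero q}} → ∣ x ∣ ≤ fromℕ B → ∣ x - p / q ∣ ≤ 1ℚ →
  q ℕ.≤ Q → ℤ.∣ p ∣ ℕ.≤ Q ℕ.* suc B
numerator-bound {x} {B} {Q} p q x≤B δ≤1 q≤Q = ℕₚ.≤-trans (fromℕ-cancel-≤ (begin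
  fromℕ ℤ.∣ p ∣                        ≡⟨ fromℤ-∣∣ p ⟨
  ∣ fromℤ p ∣                          ≤⟨ ∣x∣≤∣y∣+∣x-y∣ (fromℤ p) (fromℕ q * x) ⟩
  ∣ fromℕ q * x ∣ + ∣ fromℤ p - fromℕ q * x ∣
                                       ≡⟨ cong₂ _+_ (trans (∣p*q∣≡∣p∣*∣q∣ (fromℕ q) x)
                                           (cong (_* ∣ x ∣) (0≤p⇒∣p∣≡p (0≤fromℕ q))))
                                            (trans (∣x-y∣≡∣y-x∣ (fromℤ p) (fromℕ q * x)) (∣mx-p∣ x p q)) ⟩
  fromℕ q * ∣ x ∣ + fromℕ q * ∣ x - p / q ∣
                                       ≤⟨ +-mono-≤ (*-monoʳ-≤ (0≤fromℕ q) x≤B) (*-monoʳ-≤ (0≤fromℕ q) δ≤1) ⟩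
  fromℕ q * fromℕ B + fromℕ q * 1ℚ     ≡⟨ cong₂ _+_ (sym (fromℕ-* q B)) (*-identityʳ (fromℕ q)) ⟩
  fromℕ (q ℕ.* B) + fromℕ q            ≡⟨ fromℕ-+ (q ℕ.* B) q ⟨
  fromℕ (q ℕ.* B ℕ.+ q)                ≡⟨ cong fromℕ (trans (ℕₚ.+-comm (q ℕ.* B) q) (sym (ℕₚ.*-suc q B))) ⟩
  fromℕ (q ℕ.* suc B)                  ∎)) (ℕₚ.*-monoˡ-≤ (suc B) q≤Q)
  where open ≤-Reasoning

-- Ratios of degrees as inequalities of natural numbers.

D*ratio≡D′ : ∀ D′ D → .{{ℕ.NonZero D}} → fromℕ D * ratio D′ D ≡ fromℕ D′
D*ratio≡D′ D′ D@(suc _) = m*[p/m]≡p (+ D′) D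

module _ {D D′ a : ℕ} .{{_ : ℕ.NonZero D}} {s : ℚ} (↥s≡a : ↥ s ≡ + a) where
  private
    e : ℕ
    e = ↧ₙ s
    swap : ∀ a b c → a * b * c ≡ b * (a * c)
    swap = solve-∀ ℚ-ring
    lhs : fromℕ e * fromℕ D * ratio D′ D ≡ fromℕ (e ℕ.* D′)
    lhs = trans (*-assoc (fromℕ e) (fromℕ D) (ratio D′ D))
      (trans (cong (fromℕ e *_) (D*ratio≡D′ D′ D)) (sym (fromℕ-* e D′)))
    rhs : fromℕ e * fromℕ D * s ≡ fromℕ (a ℕ.* D)
    rhs = trans (swap (fromℕ e) (fromℕ D) s) (trans (cong (fromℕ D *_)
      (trans (*-comm (fromℕ e) s) (trans (sym (↥p≡p*↧p s)) (cong fromℤ ↥s≡a))))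
      (trans (sym (fromℕ-* D a)) (cong fromℕ (ℕₚ.*-comm D a))))

  ratio≤⇒ : ratio D′ D ≤ s → e ℕ.* D′ ℕ.≤ a ℕ.* D
  ratio≤⇒ le = fromℕ-cancel-≤ (subst₂ _≤_ lhs rhs
    (*-monoʳ-≤ (*-nonNeg (0≤fromℕ e) (0≤fromℕ D)) le))

  <ratio⇒ : s < ratio D′ D → a ℕ.* D ℕ.< e ℕ.* D′
  <ratio⇒ lt = fromℕ-cancel-< (subst₂ _<_ rhs lhs
    (*-monoʳ-< (*-pos {fromℕ e} {fromℕ D} (0<fromℕ e) (0<fromℕ D)) lt))

1<ratio : ∀ {D D′} → .{{ℕ.NonZero D}} → D ℕ.< D′ → 1ℚ < ratio D′ D
1<ratio {D} {D′} D<D′ = ≰⇒> λ le → ℕₚ.<⇒≱ D<D′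
  (subst₂ ℕ._≤_ (ℕₚ.*-identityˡ D′) (ℕₚ.*-identityˡ D) (ratio≤⇒ {D} {D′} {1} {1ℚ} refl le))

x-1<y⇒x<y+1 : ∀ {x y} → x - 1ℚ < y → x < y + 1ℚ
x-1<y⇒x<y+1 {x} {y} lt = subst (_< y + 1ℚ) (cancel x) (+-monoˡ-< 1ℚ lt)
  where
  cancel : ∀ x → x - 1ℚ + 1ℚ ≡ x
  cancel = solve-∀ ℚ-ring

x<y-1⇒x+1<y : ∀ {x y} → x < y - 1ℚ → x + 1ℚ < y
x<y-1⇒x+1<y {x} {y} lt = subst (x + 1ℚ <_) (cancel y) (+-monoˡ-< 1ℚ lt)
  where
  cancel : ∀ y → y - 1ℚ + 1ℚ ≡ y
  cancel = solve-∀ ℚ-ring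

⊔-lub-< : ∀ {x y z} → x < z → y < z → x ⊔ y < z
⊔-lub-< {x} {y} {z} x<z y<z with ≤-total x y
... | inj₁ x≤y = subst (_< z) (sym (p≤q⇒p⊔q≡q x≤y)) y<z
... | inj₂ y≤x = subst (_< z) (sym (p≥q⇒p⊔q≡p y≤x)) x<z

-- The counterpart of `degree-bound` for the lower bound, for an exponent `(m + j)/m`: the gap of 1
-- between `j * e` and `a * m` gains one `D`, which pays for the terms with `M` once `D` is large.
lower-degrees : ∀ {D D′ M a e j m} → .{{ℕ.NonZero e}} → a ℕ.* D ℕ.< e ℕ.* D′ → j ℕ.* e ℕ.< a ℕ.* m →
  e ℕ.* (suc M ℕ.* m ℕ.+ M ℕ.* j) ℕ.≤ D →
  suc M ℕ.* m ℕ.+ (D ℕ.+ M) ℕ.* j ℕ.≤ D′ ℕ.* m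
lower-degrees {D} {D′} {M} {a} {e} {j} {m} aD<eD′ je<am le = ℕₚ.*-cancelˡ-≤ e (begin
  e ℕ.* (suc M ℕ.* m ℕ.+ (D ℕ.+ M) ℕ.* j)            ≡⟨ eq D M e j m ⟩
  e ℕ.* (suc M ℕ.* m ℕ.+ M ℕ.* j) ℕ.+ D ℕ.* (j ℕ.* e)  ≤⟨ ℕₚ.+-monoˡ-≤ _ le ⟩
  D ℕ.+ D ℕ.* (j ℕ.* e)                              ≡⟨ ℕₚ.*-suc D (j ℕ.* e) ⟨
  D ℕ.* suc (j ℕ.* e)                                ≤⟨ ℕₚ.*-monoʳ-≤ D je<am ⟩
  D ℕ.* (a ℕ.* m)                                    ≡⟨ eq′ D a m ⟩
  a ℕ.* D ℕ.* m                                      ≤⟨ ℕₚ.*-monoˡ-≤ m (ℕₚ.<⇒≤ aD<eD′) ⟩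
  e ℕ.* D′ ℕ.* m                                     ≡⟨ ℕₚ.*-assoc e D′ m ⟩
  e ℕ.* (D′ ℕ.* m)                                   ∎)
  where
  open ℕₚ.≤-Reasoning
  eq : ∀ D M e j m → e ℕ.* (suc M ℕ.* m ℕ.+ (D ℕ.+ M) ℕ.* j) ≡
                     e ℕ.* (suc M ℕ.* m ℕ.+ M ℕ.* j) ℕ.+ D ℕ.* (j ℕ.* e)
  eq = ℕ-Solver.solve-∀
  eq′ : ∀ D a m → D ℕ.* (a ℕ.* m) ≡ a ℕ.* D ℕ.* m
  eq′ = ℕ-Solver.solve-∀

-- In `b ^ m * Q ^ (m + j) ≤ 1`, the factor `Q` in the denominator of `b` cancels `m` of the factors
-- `Q`. Only `Q ^ j` is left, and `Q-upper` bounds it by a power of `X`.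
goodApproximation⇒< : ∀ {F X M D D′} (G : GoodApproximation (seq F) X M D D′) → 1ℚ < X →
  ∀ {w r m j} → .{{_ : ℕ.NonZero (GoodApproximation.Q G)}} → w < r → ↧ₙ r ≡ m → ↥ r ≡ + (m ℕ.+ j) →
  suc M ℕ.* m ℕ.+ (D ℕ.+ M) ℕ.* j ℕ.≤ D′ ℕ.* m →
  dist F (GoodApproximation.P G / GoodApproximation.Q G) < GoodApproximation.Q G ^- constant w
goodApproximation⇒< {F} {X} {M} {D} {D′} G 1<X {w} {r} {m} {j} w<r refl ↥r≡ degrees =
  -- `b` has one factor `X` more than the bound given by `err-upper`, because `_<ᴿ_` asks for a
  -- strictly larger rational.
  b , (X ^ M * V , c<b , Eventually-map ≤c err-upper)
    , r , (w , w<r , 0 , λ _ _ → ≤-refl) , ^-ℚ⇐ {b} {Q} {r} (m ℕ.+ j) ↥r≡ 0≤b b^m*Q^n≤1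
  where
  open GoodApproximation G
  open ≤-Reasoning
  1≤X : 1ℚ ≤ X
  1≤X = <⇒≤ 1<X
  0<X : 0ℚ < X
  0<X = <-trans 0<1 1<X
  0≤X : 0ℚ ≤ X
  0≤X = <⇒≤ 0<X
  Q′ W V b : ℚ
  Q′ = fromℕ Q
  W = X ^ D′ * Q′
  V = inv W
  b = X ^ suc M * V
  0<W : 0ℚ < W
  0<W = *-pos {X ^ D′} {Q′} (^-pos 0<X D′) (0<fromℕ Q)
  WV≡1 : W * V ≡ 1ℚ
  WV≡1 = x*inv-x≡1 W (≢-sym (<⇒≢ 0<W))
  0<V : 0ℚ < V
  0<V = inv-pos 0<W
  0≤b : 0ℚ ≤ b
  0≤b = *-nonNeg (^-nonNeg 0≤X (suc M)) (<⇒≤ 0<V)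
  c<b : X ^ M * V < b
  c<b = subst₂ _<_ (*-identityʳ (X ^ M * V)) (swap (X ^ M) V X) (*-monoʳ-< {X ^ M * V} (*-pos (^-pos 0<X M) 0<V)
      1<X)
    where
    swap : ∀ a b c → a * b * c ≡ c * a * b
    swap = solve-∀ ℚ-ring
  ≤c : ∀ {i} → X ^ D′ * ∣ Q′ * seq F i - fromℤ P ∣ ≤ X ^ M → ∣ seq F i - P / Q ∣ ≤ X ^ M * V
  ≤c {i} le = begin
    δ                                        ≡⟨ *-identityˡ δ ⟨
    1ℚ * δ                                   ≡⟨ cong (_* δ) WV≡1 ⟨
    X ^ D′ * Q′ * V * δ                      ≡⟨ regroup (X ^ D′) Q′ V δ ⟩
    X ^ D′ * (Q′ * δ) * V                    ≡⟨ cong (λ y → X ^ D′ * y * V) (∣mx-p∣ (seq F i) P Q) ⟨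
    X ^ D′ * ∣ Q′ * seq F i - fromℤ P ∣ * V  ≤⟨ *-monoˡ-≤ (<⇒≤ 0<V) le ⟩
    X ^ M * V                                ∎
    where
    δ : ℚ
    δ = ∣ seq F i - P / Q ∣
    regroup : ∀ a b c e → a * b * c * e ≡ a * (b * e) * c
    regroup = solve-∀ ℚ-ring
  b^m*Q^n≤1 : b ^ m * Q′ ^ (m ℕ.+ j) ≤ 1ℚ
  b^m*Q^n≤1 = *-cancelˡ-≤ {X ^ (D′ ℕ.* m)} (^-pos 0<X (D′ ℕ.* m)) (begin
    X ^ (D′ ℕ.* m) * (b ^ m * Q′ ^ (m ℕ.+ j))          ≡⟨ cong₂ (λ x y → x * (b ^ m * y))
        (sym (^-assocʳ X D′ m)) (^-homo-* Q′ m j) ⟩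
    (X ^ D′) ^ m * (b ^ m * (Q′ ^ m * Q′ ^ j))         ≡⟨ regroup ((X ^ D′) ^ m) (b ^ m) (Q′ ^ m) (Q′ ^ j) ⟩
    (X ^ D′) ^ m * Q′ ^ m * b ^ m * Q′ ^ j             ≡⟨ cong (λ y → y * b ^ m * Q′ ^ j)
        (^-distrib-* (X ^ D′) Q′ m) ⟨
    W ^ m * b ^ m * Q′ ^ j                             ≡⟨ cong (_* Q′ ^ j) (^-distrib-* W b m) ⟨
    (W * b) ^ m * Q′ ^ j                               ≡⟨ cong (λ y → y ^ m * Q′ ^ j) Wb≡ ⟩
    (X ^ suc M) ^ m * Q′ ^ j                           ≤⟨ *-monoʳ-≤ (^-nonNeg (^-nonNeg 0≤X (suc M)) m)
        (^-monoˡ-≤ (0≤fromℕ Q) Q-upper j) ⟩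
    (X ^ suc M) ^ m * (X ^ (D ℕ.+ M)) ^ j              ≡⟨ cong₂ _*_ (^-assocʳ X (suc M) m)
        (^-assocʳ X (D ℕ.+ M) j) ⟩
    X ^ (suc M ℕ.* m) * X ^ ((D ℕ.+ M) ℕ.* j)          ≡⟨ ^-homo-* X (suc M ℕ.* m) ((D ℕ.+ M) ℕ.* j) ⟨
    X ^ (suc M ℕ.* m ℕ.+ (D ℕ.+ M) ℕ.* j)              ≤⟨ ^-monoʳ-≤ 1≤X degrees ⟩
    X ^ (D′ ℕ.* m)                                     ≡⟨ *-identityʳ _ ⟨
    X ^ (D′ ℕ.* m) * 1ℚ                                ∎)
    where
    regroup : ∀ a b c e → a * (b * (c * e)) ≡ a * c * b * e
    regroup = solve-∀ ℚ-ring
    swap : ∀ a b c → a * (b * c) ≡ b * (a * c)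
    swap = solve-∀ ℚ-ring
    Wb≡ : W * b ≡ X ^ suc M
    Wb≡ = trans (swap W (X ^ suc M) V) (trans (cong (X ^ suc M *_) WV≡1) (*-identityʳ (X ^ suc M)))

-- The irrationality exponent determined by a family of good approximations.

approximates : ∀ {α μ} p q → .{{_ : ℕ.NonZero q}} → dist α (p / q) < q ^- μ → Approximates α μ (p , q)
approximates p (suc q) close = close

module Exponent (F : ℝ) (β d : ℕ) (2≤β : 2 ℕ.≤ β) (2≤d : 2 ℕ.≤ d)
  (D : ℕ → ℕ) (D-increasing : ∀ k → D k ℕ.< D (suc k)) (M : ℕ)
  (approximations : ∀ k → ∃[ t₀ ] (∀ t → t₀ ℕ.≤ t →
    GoodApproximation (seq F) (fromℕ (β ℕ.^ (d ℕ.^ t))) M (D k) (D (suc k)))) where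

  u : ℕ → ℚ
  u k = ratio (D (suc k)) (D k)

  X : ℕ → ℚ
  X t = fromℕ (β ℕ.^ (d ℕ.^ t))

  private
    t<β^d^t : ∀ t → t ℕ.< β ℕ.^ (d ℕ.^ t)
    t<β^d^t t = ℕₚ.<-trans (n<m^n 2≤d t) (n<m^n 2≤β (d ℕ.^ t))

    2≤X : ∀ t → 2ℚ ≤ X t
    2≤X t = fromℕ-mono-≤ (ℕₚ.≤-trans 2≤β (subst (ℕ._≤ β ℕ.^ (d ℕ.^ t)) (ℕₚ.^-identityʳ β)
      (ℕₚ.^-monoʳ-≤ β {{ℕ.>-nonZero (ℕₚ.≤-trans (ℕ.s≤s ℕ.z≤n) 2≤β)}} (ℕₚ.≤-trans (ℕ.s≤s ℕ.z≤n) (n<m^n 2≤d t)))))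

    1≤X : ∀ t → 1ℚ ≤ X t
    1≤X t = ≤-trans 1≤2 (2≤X t)

    1<X : ∀ t → 1ℚ < X t
    1<X t = <-≤-trans (fromℕ-mono-< {1} {2} (ℕ.s≤s (ℕ.s≤s ℕ.z≤n))) (2≤X t)

    0≤X : ∀ t → 0ℚ ≤ X t
    0≤X t = ≤-trans 0≤1 (1≤X t)

    X-suc : ∀ t → X (suc t) ≡ X t ^ d
    X-suc t = trans (cong fromℕ (trans (cong (β ℕ.^_) (ℕₚ.*-comm d (d ℕ.^ t)))
      (sym (ℕₚ.^-*-assoc β (d ℕ.^ t) d)))) (fromℕ-^ (β ℕ.^ (d ℕ.^ t)) d)

    k≤Dk : ∀ k → k ℕ.≤ D k
    k≤Dk zero    = ℕ.z≤n
    k≤Dk (suc k) = ℕₚ.≤-trans (ℕ.s≤s (k≤Dk k)) (D-increasing k)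

    1<u : ∀ k → .{{ℕ.NonZero k}} → 1ℚ < u k
    1<u k = 1<ratio {{ℕ.>-nonZero (ℕₚ.<-≤-trans (ℕ.>-nonZero⁻¹ k) (k≤Dk k))}} (D-increasing k)

    often-1< : ∀ N → ∃[ k ] N ℕ.≤ k × 1ℚ < u k
    often-1< N = suc N , ℕₚ.n≤1+n N , 1<u (suc N)

    module Search (s s₀ : ℚ) (1<s : 1ℚ < s) (s+1<s₀ : s + 1ℚ < s₀) (μ : ℝ)
      (s₀≤μ : Eventually (λ i → s₀ ≤ seq μ i))
      (infinite : Infinite (Approximates F μ)) (N₀ : ℕ) where

      a e n m : ℕ
      a = ℤ.∣ ↥ s ∣
      e = ↧ₙ s
      n = ℤ.∣ ↥ s₀ ∣
      m = ↧ₙ s₀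

      0≤s : 0ℚ ≤ s
      0≤s = ≤-trans 0≤1 (<⇒≤ 1<s)
      0≤s₀ : 0ℚ ≤ s₀
      0≤s₀ = ≤-trans (+-nonNeg 0≤s 0≤1) (<⇒≤ s+1<s₀)
      ↥s≡a : ↥ s ≡ + a
      ↥s≡a = ↥-nonNeg 0≤s
      ↥s₀≡n : ↥ s₀ ≡ + n
      ↥s₀≡n = ↥-nonNeg 0≤s₀

      ae<n : (a ℕ.+ e) ℕ.* m ℕ.< n ℕ.* e
      ae<n = ℤₚ.drop‿+<+ (subst₂ ℤ._<_
        (trans (cong (λ i → (i ℤ.+ + e) ℤ.* + m) ↥s≡a) (sym (ℤₚ.pos-* (a ℕ.+ e) m)))
        (trans (cong (ℤ._* + e) ↥s₀≡n) (sym (ℤₚ.pos-* n e)))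
        (CrossMultiplication.y+1<x⇒ s₀ s s+1<s₀))

      threshold N K e₀ : ℕ
      -- The bound from `degree-bound`. Since `k ≤ D k`, every `D k` with `N ≤ k` exceeds it.
      threshold = suc (M ℕ.+ M) ℕ.* e ℕ.* m ℕ.+ suc M ℕ.* n ℕ.* e
      N = N₀ ℕ.⊔ suc threshold
      e₀ = D N
      -- At the level `t` of `q`, with `Y = X t`, one has `Q * Y ^ suc M ≤ Y ^ K`, while
      -- `K < N + K ≤ D (N + K)`; so the crossing in `k` takes place before `N + K`.
      K = d ℕ.* e₀ ℕ.+ suc M

      instance
        e₀-nonZero : ℕ.NonZero e₀
        e₀-nonZero = ℕ.>-nonZero (ℕₚ.≤-trans (ℕ.s≤s ℕ.z≤n) (ℕₚ.≤-trans (ℕₚ.m≤n⊔m N₀ (suc threshold)) (k≤Dk N)))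

      start : ℕ → ℕ
      start k = proj₁ (approximations k)

      T q₀ B : ℕ
      -- From level `T` on the approximations for all `k < N + K` are available, and `q₀ = X T ^ e₀`
      -- is the size of `q` that guarantees a level of at least `T`.
      T = proj₁ (upperBound start (N ℕ.+ K))
      q₀ = (β ℕ.^ (d ℕ.^ T)) ℕ.^ e₀
      B = proj₁ (cauchy⇒bounded F)

      candidate : ∃[ x ] x ∉ box (q₀ ℕ.* suc B) × Approximates F μ x
      candidate = infinite (box (q₀ ℕ.* suc B))

      module _ (p : ℤ) (q : ℕ) .{{_ : ℕ.NonZero q}} (outside : (p , q) ∉ box (q₀ ℕ.* suc B))
        (close : Eventually (λ i → ∣ seq F i - p / q ∣ ^ m * fromℕ q ^ n ≤ 1ℚ)) where

        Q : ℚ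
        Q = fromℕ q

        1≤Q : 1ℚ ≤ Q
        1≤Q = fromℕ-mono-≤ {1} {q} (ℕ.>-nonZero⁻¹ q)

        q₀≤q : q₀ ℕ.≤ q
        q₀≤q = ℕₚ.≮⇒≥ λ q<q₀ →
          let i , x≤B , le = Eventually-witness (Eventually-∧ (proj₂ (cauchy⇒bounded F)) close)
              δ = ∣ seq F i - p / q ∣
              δ^m≤1 = ≤-trans (subst (_≤ δ ^ m * Q ^ n) (*-identityʳ (δ ^ m))
                        (*-monoʳ-≤ (^-nonNeg (0≤∣p∣ (seq F i - p / q)) m) (1≤^ 1≤Q n))) le
              δ≤1 = ^-cancel-≤1 (0≤∣p∣ (seq F i - p / q)) m δ^m≤1
          in  outside (∈-box (numerator-bound p q x≤B δ≤1 (ℕₚ.<⇒≤ q<q₀))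
                (ℕₚ.≤-trans (ℕₚ.<⇒≤ q<q₀) (ℕₚ.m≤m*n q₀ (suc B))))

        -- As `e₀ = D N`, the lower bound on `Q` puts `N` below the crossing in `k`; the upper bound
        -- keeps that crossing within reach, because `X (suc t)` is only the `d`-th power of `X t`.
        -- The search for `t` may stop at `T + q`, since `q < X (T + q)`.
        level : ∃[ t ] T ℕ.≤ t × X t ^ e₀ ≤ Q × Q < X (suc t) ^ e₀
        level =
          let t , T≤t , _ , X≤Q , X≰Q = crossing (λ t → X t ^ e₀ ≤? Q) T q start≤ ¬end≤
          in  t , T≤t , X≤Q , ≰⇒> X≰Q
          where
          start≤ : X T ^ e₀ ≤ Q
          start≤ = subst (_≤ Q) (fromℕ-^ (β ℕ.^ (d ℕ.^ T)) e₀) (fromℕ-mono-≤ q₀≤q)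
          ¬end≤ : ¬ X (T ℕ.+ q) ^ e₀ ≤ Q
          ¬end≤ le = <-irrefl refl (<-≤-trans (fromℕ-mono-< (ℕₚ.≤-<-trans (ℕₚ.m≤n+m q T) (t<β^d^t (T ℕ.+ q))))
            (≤-trans (≤-trans (≤-reflexive (sym (*-identityʳ (X (T ℕ.+ q)))))
              (^-monoʳ-≤ (1≤X (T ℕ.+ q)) {1} {e₀} (ℕ.>-nonZero⁻¹ e₀))) le))

        impossible : (∀ k → N ℕ.≤ k → k ℕ.< N ℕ.+ K → u k ≤ s) → ⊥
        impossible u≤s =
          let t , T≤t , X≤Q , Q<X = level
              Y = X t
              q≤QY = ≤-trans X≤Q (subst (_≤ Q * Y ^ suc M) (*-identityʳ Q)
                  (*-monoʳ-≤ (0≤fromℕ q) (1≤^ (1≤X t) (suc M))))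
              end = ≤-trans (*-monoˡ-≤ (^-nonNeg (0≤X t) (suc M)) (<⇒≤ Q<X)) (≤-reflexive (trans
                      (cong (_* Y ^ suc M) (trans (cong (_^ e₀) (X-suc t)) (^-assocʳ Y d e₀)))
                      (sym (^-homo-* Y (d ℕ.* e₀) (suc M)))))
              ¬end = λ le → ℕₚ.<-irrefl refl (ℕₚ.≤-<-trans (^-cancelʳ-≤ (1<X t) (≤-trans le end))
                       (ℕₚ.<-≤-trans (ℕₚ.m<n+m K (ℕₚ.≤-trans (ℕ.s≤s ℕ.z≤n) (ℕₚ.m≤n⊔m N₀ (suc threshold))))
                           (k≤Dk (N ℕ.+ K))))
              k , N≤k , k<N+K , D≤ , ≰D′ = crossing (λ k → Y ^ D k ≤? Q * Y ^ suc M) N K q≤QY ¬end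
              G = proj₂ (approximations k) t (ℕₚ.≤-trans (proj₂ (upperBound start (N ℕ.+ K)) k k<N+K) T≤t)
              open GoodApproximation G using (err-lower; err-upper; Q-upper)
              i , le , lower , upper = Eventually-witness
                  (Eventually-∧ close (Eventually-∧ err-lower err-upper))
              1≤ = separation {Y} {M} {D k} {D (suc k)} {seq F i} {GoodApproximation.P G}
                  {GoodApproximation.Q G} p q (2≤X t) Q-upper lower upper (<⇒≤ (≰⇒> ≰D′))
              threshold<D = ℕₚ.≤-trans (ℕₚ.m≤n⊔m N₀ (suc threshold)) (ℕₚ.≤-trans N≤k (k≤Dk k))
              eD′≤aD = ratio≤⇒ {{ℕ.>-nonZero (ℕₚ.≤-trans (ℕ.s≤s ℕ.z≤n) threshold<D)}} ↥s≡a (u≤s k N≤k k<N+K)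
          -- If all ratios in the range were at most `s`, `D k` would be at most `threshold`,
          -- against `N ≤ k`.
          in  ℕₚ.<⇒≱ threshold<D (degree-bound {D k} {D (suc k)} {M} {a} {e} {m} {n} eD′≤aD ae<n
                (exponents-≤ {Y} {∣ seq F i - p / q ∣} {Q} {D k} {suc M} (D (suc k) ℕ.+ M ℕ.+ suc (D k ℕ.+ M)) m
                    n (1<X t) (0≤∣p∣ (seq F i - p / q)) (0≤fromℕ q) 1≤ le D≤))

      -- The bounded search runs first and asks only decidable questions; an approximation to `F` is
      -- requested merely to refute its failure.
      found : ∃[ k ] N₀ ℕ.≤ k × s < u k
      found with ℕₚ.anyUpTo? (λ k → N ℕₚ.≤? k ×-dec s <? u k) (N ℕ.+ K)
      ... | yes (k , _ , N≤k , s<u) = k , ℕₚ.≤-trans (ℕₚ.m≤m⊔n N₀ (suc threshold)) N≤k , s<u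
      ... | no none with candidate
      ...   | (p , suc q) , outside , close = ⊥-elim (impossible p (suc q) outside
                (approximation-bound {F} {μ} {p} {suc q} s₀ n ↥s₀≡n 0≤s₀ s₀≤μ close)
                (λ k N≤k k<N+K → ≮⇒≥ (λ s<u → none (k , k<N+K , N≤k , s<u))))

  exponent≤ : ∀ r → cut (irrationalityExponent F) r → cut (1+ limsup u) r
  exponent≤ r (μ , infinite , s₀ , r<s₀ , s₀≤μ) with s₀ ≤? 2ℚ
  -- Below 2 no search is required: `1 < u k` for all `k ≥ 1`, because `D` is strictly increasing.
  ... | yes s₀≤2 = 1ℚ , +-monoˡ-< (- 1ℚ) (<-≤-trans r<s₀ s₀≤2) , often-1<
  ... | no  s₀≰2 =
    let s , max<s , s<s₀-1 = <-dense (⊔-lub-< (+-monoˡ-< (- 1ℚ) r<s₀) (+-monoˡ-< (- 1ℚ) (≰⇒> s₀≰2)))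
    in  s , ≤-<-trans (p≤p⊔q (r - 1ℚ) 1ℚ) max<s
          , Search.found s s₀ (≤-<-trans (p≤q⊔p (r - 1ℚ) 1ℚ) max<s) (x<y-1⇒x+1<y s<s₀-1) μ s₀≤μ infinite

  ≤exponent : ∀ r → cut (1+ limsup u) r → cut (irrationalityExponent F) r
  ≤exponent r (s₁ , r-1<s₁ , often) =
    -- Two rationals are interposed: `w` is the member of the set whose supremum is taken, and
    -- `r′ > w` is the rational exponent that the definition of `q ^- w` asks for.
    let w , max<w , w<s+1 = <-dense {r ⊔ 1ℚ} {s + 1ℚ} (⊔-lub-< r<s+1 1<s+1)
        r′ , w<r′ , r′<s+1 = <-dense w<s+1
    in  constant w , infinite w r′ w<r′ (≤-<-trans (p≤q⊔p r 1ℚ) (<-trans max<w w<r′)) r′<s+1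
                   , w , ≤-<-trans (p≤p⊔q r 1ℚ) max<w , 0 , λ _ _ → ≤-refl
    where
    -- Raising `s₁` to at least 1 is free, as `1 < u k` for `k ≥ 1`. It makes room for `r′ > 1`, so
    -- that `j = n ∸ m` is a true difference.
    s : ℚ
    s = s₁ ⊔ 1ℚ
    r<s+1 : r < s + 1ℚ
    r<s+1 = x-1<y⇒x<y+1 (<-≤-trans r-1<s₁ (p≤p⊔q s₁ 1ℚ))
    1<s+1 : 1ℚ < s + 1ℚ
    1<s+1 = <-≤-trans (subst (_< 2ℚ) (+-identityˡ 1ℚ) (+-monoˡ-< 1ℚ 0<1)) (+-monoˡ-≤ 1ℚ (p≤q⊔p s₁ 1ℚ))
    0≤s : 0ℚ ≤ s
    0≤s = ≤-trans 0≤1 (p≤q⊔p s₁ 1ℚ)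
    infinite : ∀ w r′ → w < r′ → 1ℚ < r′ → r′ < s + 1ℚ → Infinite (Approximates F (constant w))
    infinite w r′ w<r′ 1<r′ r′<s+1 xs =
      let k , N≤k , s₁<uk = often N
          1≤k = ℕₚ.≤-trans (ℕ.s≤s ℕ.z≤n) N≤k
          s<uk = ⊔-lub-< s₁<uk (1<u k {{ℕ.>-nonZero 1≤k}})
          t₀ , good = approximations k
          t = t₀ ℕ.⊔ largest xs
          G = good t (ℕₚ.m≤m⊔n t₀ (largest xs))
          open GoodApproximation G
          aD<eD′ = <ratio⇒ {D k} {D (suc k)} {a} {{ℕ.>-nonZero (ℕₚ.≤-trans 1≤k (k≤Dk k))}} ↥s≡a s<uk
          threshold+M<D = ℕₚ.≤-trans N≤k (k≤Dk k)
          -- `Q-lower` and `M < D k` give `X t ≤ Q`. Since `t` is at least every denominator in `xs`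
          -- and `t < X t`, the fraction `P/Q` lies outside `xs`.
          X≤Q = *-cancelˡ-≤ {X t ^ M} (<-≤-trans 0<1 (1≤^ (1≤X t) M))
              (≤-trans (≤-reflexive (*-comm (X t ^ M) (X t)))
                  (≤-trans (^-monoʳ-≤ (1≤X t) (ℕₚ.≤-trans (ℕ.s≤s (ℕₚ.m≤n+m M threshold)) threshold+M<D))
                      Q-lower))
          largest<Q = ℕₚ.<-≤-trans (ℕₚ.≤-<-trans (ℕₚ.m≤n⊔m t₀ (largest xs)) (t<β^d^t t)) (fromℕ-cancel-≤ X≤Q)
      in  (P , Q) , (λ PQ∈xs → ℕₚ.<⇒≱ largest<Q (≤largest PQ∈xs))
          , approximates {F} {constant w} P Q {{ℕ.>-nonZero 1≤Q}} (goodApproximation⇒< {F} G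
              (1<X t) {w} {r′} {m} {j} {{ℕ.>-nonZero 1≤Q}} w<r′ refl ↥r′≡
              (lower-degrees {D k} {D (suc k)} {M} {a} {e} {j} {m} aD<eD′ je<am
                (ℕₚ.≤-trans (ℕₚ.m≤m+n threshold M) (ℕₚ.<⇒≤ threshold+M<D))))
      where
      a e m n j threshold N : ℕ
      a = ℤ.∣ ↥ s ∣
      e = ↧ₙ s
      m = ↧ₙ r′
      n = ℤ.∣ ↥ r′ ∣
      j = n ℕ.∸ m
      threshold = e ℕ.* (suc M ℕ.* m ℕ.+ M ℕ.* j)
      -- `threshold` serves `lower-degrees`, and the summand `M` serves `X≤Q`.
      N = suc (threshold ℕ.+ M)
      ↥s≡a : ↥ s ≡ + a
      ↥s≡a = ↥-nonNeg 0≤s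
      ↥r′≡n : ↥ r′ ≡ + n
      ↥r′≡n = ↥-nonNeg (≤-trans 0≤1 (<⇒≤ 1<r′))
      m≤n : m ℕ.≤ n
      m≤n = ℤₚ.drop‿+≤+ (subst₂ ℤ._≤_ (ℤₚ.*-identityˡ (+ m)) (trans (ℤₚ.*-identityʳ (↥ r′)) ↥r′≡n)
        (ℤₚ.<⇒≤ (drop-*<* 1<r′)))
      m+j≡n : m ℕ.+ j ≡ n
      m+j≡n = ℕₚ.m+[n∸m]≡n m≤n
      ↥r′≡ : ↥ r′ ≡ + (m ℕ.+ j)
      ↥r′≡ = trans ↥r′≡n (cong +_ (sym m+j≡n))
      ne< : n ℕ.* e ℕ.< (a ℕ.+ e) ℕ.* m
      ne< = ℤₚ.drop‿+<+ (subst₂ ℤ._<_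
        (trans (cong (ℤ._* + e) ↥r′≡n) (sym (ℤₚ.pos-* n e)))
        (trans (cong (λ i → (i ℤ.+ + e) ℤ.* + m) ↥s≡a) (sym (ℤₚ.pos-* (a ℕ.+ e) m)))
        (CrossMultiplication.x<y+1⇒ r′ s r′<s+1))
      je<am : j ℕ.* e ℕ.< a ℕ.* m
      je<am = ℕₚ.+-cancelˡ-< (m ℕ.* e) (j ℕ.* e) (a ℕ.* m) (subst₂ ℕ._<_
        (trans (cong (ℕ._* e) (sym m+j≡n)) (ℕₚ.*-distribʳ-+ e m j)) (eq a e m) ne<)
        where
        eq : ∀ a e m → (a ℕ.+ e) ℕ.* m ≡ m ℕ.* e ℕ.+ a ℕ.* m
        eq = ℕ-Solver.solve-∀
      largest : List (ℤ × ℕ) → ℕ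
      largest []             = 0
      largest ((_ , q) ∷ xs) = q ℕ.⊔ largest xs
      ≤largest : ∀ {x xs} → x ∈ xs → proj₂ x ℕ.≤ largest xs
      ≤largest {xs = (_ , q) ∷ xs} (here refl) = ℕₚ.m≤m⊔n q (largest xs)
      ≤largest {xs = (_ , q) ∷ xs} (there x∈xs) = ℕₚ.≤-trans (≤largest x∈xs) (ℕₚ.m≤n⊔m q (largest xs))

  exponent≡ : irrationalityExponent F ≡∞ 1+ limsup u
  exponent≡ r = mk⇔ (exponent≤ r) (≤exponent r)

-- Cauchy products

-- Definitionally the coefficients of `_*ᴸ_`. Moreover `conv a b (suc n)` reduces to
-- `a 0 * b (suc n) + conv (a ∘ suc) b n`, and all inductions below follow this recursion.
conv : (ℕ → ℚ) → (ℕ → ℚ) → ℕ → ℚ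
conv a b n = Σᶠ {suc n} (λ i → a (toℕ i) * b (n ℕ.∸ toℕ i))

conv-zero : ∀ a b → conv a b 0 ≡ a 0 * b 0
conv-zero a b = +-identityʳ (a 0 * b 0)

conv-cong : ∀ {a a′ b b′} → a ≗ a′ → b ≗ b′ → conv a b ≗ conv a′ b′
conv-cong a≗ b≗ zero    = cong (_+ 0ℚ) (cong₂ _*_ (a≗ 0) (b≗ 0))
conv-cong a≗ b≗ (suc n) = cong₂ _+_ (cong₂ _*_ (a≗ 0) (b≗ (suc n))) (conv-cong (a≗ ∘ suc) b≗ n)

conv-distribʳ-+ : ∀ a a′ b n → conv (λ i → a i + a′ i) b n ≡ conv a b n + conv a′ b n
conv-distribʳ-+ a a′ b zero = lemma (a 0) (a′ 0) (b 0)
  where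
  lemma : ∀ x y z → (x + y) * z + 0ℚ ≡ (x * z + 0ℚ) + (y * z + 0ℚ)
  lemma = solve-∀ ℚ-ring
conv-distribʳ-+ a a′ b (suc n) = trans
  (cong (λ y → (a 0 + a′ 0) * b (suc n) + y) (conv-distribʳ-+ (a ∘ suc) (a′ ∘ suc) b n))
  (lemma (a 0) (a′ 0) (b (suc n)) (conv (a ∘ suc) b n) (conv (a′ ∘ suc) b n))
  where
  lemma : ∀ x y z u v → (x + y) * z + (u + v) ≡ (x * z + u) + (y * z + v)
  lemma = solve-∀ ℚ-ring

conv-scaleˡ : ∀ x a b n → conv (λ i → x * a i) b n ≡ x * conv a b n
conv-scaleˡ x a b zero = lemma x (a 0) (b 0)
  where
  lemma : ∀ x y z → x * y * z + 0ℚ ≡ x * (y * z + 0ℚ)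
  lemma = solve-∀ ℚ-ring
conv-scaleˡ x a b (suc n) = trans
  (cong (λ y → x * a 0 * b (suc n) + y) (conv-scaleˡ x (a ∘ suc) b n))
  (lemma x (a 0) (b (suc n)) (conv (a ∘ suc) b n))
  where
  lemma : ∀ x y z u → x * y * z + x * u ≡ x * (y * z + u)
  lemma = solve-∀ ℚ-ring

conv-negʳ : ∀ a b n → conv a (λ i → - b i) n ≡ - conv a b n
conv-negʳ a b zero = lemma (a 0) (b 0)
  where
  lemma : ∀ x y → x * - y + 0ℚ ≡ - (x * y + 0ℚ)
  lemma = solve-∀ ℚ-ring
conv-negʳ a b (suc n) = trans
  (cong (λ y → a 0 * - b (suc n) + y) (conv-negʳ (a ∘ suc) b n))
  (lemma (a 0) (b (suc n)) (conv (a ∘ suc) b n))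
  where
  lemma : ∀ x y u → x * - y + - u ≡ - (x * y + u)
  lemma = solve-∀ ℚ-ring

conv-assoc : ∀ a b e → conv (conv a b) e ≗ conv a (conv b e)
conv-assoc a b e zero = lemma (a 0) (b 0) (e 0)
  where
  lemma : ∀ x y z → (x * y + 0ℚ) * z + 0ℚ ≡ x * (y * z + 0ℚ) + 0ℚ
  lemma = solve-∀ ℚ-ring
conv-assoc a b e (suc n) = begin
  conv a b 0 * e (suc n) + conv (λ i → a 0 * b (suc i) + conv (a ∘ suc) b i) e n
    ≡⟨ cong₂ _+_ (cong (_* e (suc n)) (conv-zero a b)) (trans
         (conv-distribʳ-+ (λ i → a 0 * b (suc i)) (conv (a ∘ suc) b) e n)
         (cong₂ _+_ (conv-scaleˡ (a 0) (b ∘ suc) e n) (conv-assoc (a ∘ suc) b e n))) ⟩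
  a 0 * b 0 * e (suc n) + (a 0 * conv (b ∘ suc) e n + conv (a ∘ suc) (conv b e) n)
    ≡⟨ lemma (a 0) (b 0) (e (suc n)) (conv (b ∘ suc) e n) (conv (a ∘ suc) (conv b e) n) ⟩
  a 0 * (b 0 * e (suc n) + conv (b ∘ suc) e n) + conv (a ∘ suc) (conv b e) n ∎
  where
  open ≡-Reasoning
  lemma : ∀ x y z u v → x * y * z + (x * u + v) ≡ x * (y * z + u) + v
  lemma = solve-∀ ℚ-ring

-- The effect on a coefficient sequence of counting from an exponent that is higher by one.
0∷_ : (ℕ → ℚ) → ℕ → ℚ
(0∷ a) zero    = 0ℚ
(0∷ a) (suc i) = a i

conv-0∷ˡ : ∀ a b → conv (0∷ a) b ≗ 0∷ conv a b
conv-0∷ˡ a b zero    = trans (+-identityʳ _) (*-zeroˡ (b 0))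
conv-0∷ˡ a b (suc n) = trans (cong (_+ conv a b n) (*-zeroˡ (b (suc n)))) (+-identityˡ _)

conv-0∷ʳ : ∀ a b → conv a (0∷ b) ≗ 0∷ conv a b
conv-0∷ʳ a b zero          = trans (+-identityʳ _) (*-zeroʳ (a 0))
conv-0∷ʳ a b (suc zero)    = cong (λ y → a 0 * b 0 + y) (conv-0∷ʳ (a ∘ suc) b zero)
conv-0∷ʳ a b (suc (suc n)) = cong (λ y → a 0 * b (suc n) + y) (conv-0∷ʳ (a ∘ suc) b (suc n))

-- Coefficients of Laurent series

-- `coeff` is defined by case distinction on a difference; `at` names the outcome, so that the
-- sequence and the index can be rewritten separately.
at : (ℕ → ℚ) → ℤ → ℚ
at a (+ i)    = a i
at a -[1+ _ ] = 0ℚ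

at-cong : ∀ {a b} → a ≗ b → at a ≗ at b
at-cong a≗b (+ i)    = a≗b i
at-cong a≗b -[1+ _ ] = refl

at-0∷ : ∀ a i → at (0∷ a) i ≡ at a (i ℤ.- + 1)
at-0∷ a (+ zero)  = refl
at-0∷ a (+ suc i) = refl
at-0∷ a -[1+ i ]  = refl

coeff≡at : ∀ f k → coeff f k ≡ at (c f) (top f ℤ.- k)
coeff≡at f k with top f ℤ.- k
... | + i      = refl
... | -[1+ _ ] = refl

Vanishes : (ℤ → ℚ) → ℤ → Set
Vanishes e U = ∀ k → U ℤ.< k → e k ≡ 0ℚ

from : ℤ → (ℤ → ℚ) → ℕ → ℚ
from U e i = e (U ℤ.- + i)

U-[U-i]≡i : ∀ U i → U ℤ.- (U ℤ.- i) ≡ i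
U-[U-i]≡i = ℤ-Solver.solve-∀

from-top : ∀ f → from (top f) (coeff f) ≗ c f
from-top f i = trans (coeff≡at f (top f ℤ.- + i)) (cong (at (c f)) (U-[U-i]≡i (top f) (+ i)))

difference : ∀ U k → (U ℤ.< k) ⊎ (∃[ i ] k ≡ U ℤ.- + i × U ℤ.- k ≡ + i)
difference U k with U ℤ.- k in eq
... | + i      = inj₂ (i , trans (sym (U-[U-i]≡i U k)) (cong (λ i → U ℤ.- i) eq) , refl)
... | -[1+ i ] = inj₁ (ℤₚ.≰⇒> λ k≤U → contradiction (subst (ℤ.0ℤ ℤ.≤_) eq (ℤₚ.i≤j⇒0≤j-i k≤U)) (λ ()))

at-negative : ∀ a {U k} → U ℤ.< k → at a (U ℤ.- k) ≡ 0ℚ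
at-negative a {U} {k} U<k with U ℤ.- k in eq
... | + i      = contradiction (ℤₚ.0≤i-j⇒j≤i (subst (ℤ.0ℤ ℤ.≤_) (sym eq) (ℤ.+≤+ ℕ.z≤n))) (ℤₚ.<⇒≱ U<k)
... | -[1+ i ] = refl

vanishes-top : ∀ f → Vanishes (coeff f) (top f)
vanishes-top f k top<k = trans (coeff≡at f k) (at-negative (c f) top<k)

vanishes-mono : ∀ {e U V} → U ℤ.≤ V → Vanishes e U → Vanishes e V
vanishes-mono U≤V v k V<k = v k (ℤₚ.≤-<-trans U≤V V<k)

-- A product coefficient computed relative to arbitrary upper bounds `U` and `V` on the exponents,
-- since series that are equal under `_≈_` may record different tops.
convAt : ℤ → ℤ → (ℤ → ℚ) → (ℤ → ℚ) → ℤ → ℚ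
convAt U V e h k = at (conv (from U e) (from V h)) (U ℤ.+ V ℤ.- k)

from-suc : ∀ {e U} → Vanishes e U → from (U ℤ.+ + 1) e ≗ 0∷ from U e
from-suc {e} {U} v zero    = v (U ℤ.+ + 1 ℤ.- + 0) (subst₂ ℤ._<_ (ℤₚ.+-identityʳ U) (sym (ℤₚ.+-identityʳ _))
    (ℤₚ.+-monoʳ-< U (ℤ.+<+ (ℕ.s≤s ℕ.z≤n))))
from-suc {e} {U} v (suc i) = cong e (trans (cong (λ j → U ℤ.+ + 1 ℤ.- j) (ℤₚ.pos-+ 1 i)) (lemma U (+ i)))
  where
  lemma : ∀ U i → U ℤ.+ + 1 ℤ.- (+ 1 ℤ.+ i) ≡ U ℤ.- i
  lemma = ℤ-Solver.solve-∀

convAt-sucˡ : ∀ {U V e h} → Vanishes e U → convAt (U ℤ.+ + 1) V e h ≗ convAt U V e h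
convAt-sucˡ {U} {V} {e} {h} v k = begin
  at (conv (from (U ℤ.+ + 1) e) (from V h)) (U ℤ.+ + 1 ℤ.+ V ℤ.- k)
    ≡⟨ at-cong (λ n → trans (conv-cong {b = from V h} (from-suc v) (λ _ → refl) n)
        (conv-0∷ˡ (from U e) (from V h) n)) (U ℤ.+ + 1 ℤ.+ V ℤ.- k) ⟩
  at (0∷ conv (from U e) (from V h)) (U ℤ.+ + 1 ℤ.+ V ℤ.- k)
    ≡⟨ at-0∷ (conv (from U e) (from V h)) (U ℤ.+ + 1 ℤ.+ V ℤ.- k) ⟩
  at (conv (from U e) (from V h)) (U ℤ.+ + 1 ℤ.+ V ℤ.- k ℤ.- + 1)
    ≡⟨ cong (at (conv (from U e) (from V h))) (lemma U V k) ⟩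
  at (conv (from U e) (from V h)) (U ℤ.+ V ℤ.- k) ∎
  where
  open ≡-Reasoning
  lemma : ∀ U V k → U ℤ.+ + 1 ℤ.+ V ℤ.- k ℤ.- + 1 ≡ U ℤ.+ V ℤ.- k
  lemma = ℤ-Solver.solve-∀

convAt-sucʳ : ∀ {U V e h} → Vanishes h V → convAt U (V ℤ.+ + 1) e h ≗ convAt U V e h
convAt-sucʳ {U} {V} {e} {h} v k = begin
  at (conv (from U e) (from (V ℤ.+ + 1) h)) (U ℤ.+ (V ℤ.+ + 1) ℤ.- k)
    ≡⟨ at-cong (λ n → trans (conv-cong {from U e} (λ _ → refl) (from-suc v) n)
        (conv-0∷ʳ (from U e) (from V h) n)) (U ℤ.+ (V ℤ.+ + 1) ℤ.- k) ⟩
  at (0∷ conv (from U e) (from V h)) (U ℤ.+ (V ℤ.+ + 1) ℤ.- k)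
    ≡⟨ at-0∷ (conv (from U e) (from V h)) (U ℤ.+ (V ℤ.+ + 1) ℤ.- k) ⟩
  at (conv (from U e) (from V h)) (U ℤ.+ (V ℤ.+ + 1) ℤ.- k ℤ.- + 1)
    ≡⟨ cong (at (conv (from U e) (from V h))) (lemma U V k) ⟩
  at (conv (from U e) (from V h)) (U ℤ.+ V ℤ.- k) ∎
  where
  open ≡-Reasoning
  lemma : ∀ U V k → U ℤ.+ (V ℤ.+ + 1) ℤ.- k ℤ.- + 1 ≡ U ℤ.+ V ℤ.- k
  lemma = ℤ-Solver.solve-∀

j≡i+∣j-i∣ : ∀ {i j} → i ℤ.≤ j → j ≡ i ℤ.+ + ℤ.∣ j ℤ.- i ∣
j≡i+∣j-i∣ {i} {j} i≤j = trans (lemma i j) (cong (λ k → i ℤ.+ k) (sym (ℤₚ.0≤i⇒+∣i∣≡i (ℤₚ.i≤j⇒0≤j-i i≤j))))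
  where
  lemma : ∀ i j → j ≡ i ℤ.+ (j ℤ.- i)
  lemma = ℤ-Solver.solve-∀

module Raise {e : ℤ → ℚ} (φ : ℤ → ℚ) (step : ∀ {U} → Vanishes e U → φ (U ℤ.+ + 1) ≡ φ U) where
  climb : ∀ {U} → Vanishes e U → ∀ n → φ (U ℤ.+ + n) ≡ φ U
  climb {U} v zero    = cong φ (ℤₚ.+-identityʳ U)
  climb {U} v (suc n) = trans
      (cong φ (trans (cong (λ i → U ℤ.+ i) (trans (ℤₚ.pos-+ 1 n) (ℤₚ.+-comm (+ 1) (+ n))))
          (sym (ℤₚ.+-assoc U (+ n) (+ 1)))))
    (trans (step (vanishes-mono (ℤₚ.i≤i+j U (+ n)) v)) (climb v n))
  raise : ∀ {U U′} → Vanishes e U → U ℤ.≤ U′ → φ U′ ≡ φ U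
  raise {U} {U′} v U≤U′ = trans (cong φ (j≡i+∣j-i∣ U≤U′)) (climb v ℤ.∣ U′ ℤ.- U ∣)

bound-independent : ∀ {e : ℤ → ℚ} (φ : ℤ → ℚ) → (∀ {U} → Vanishes e U → φ (U ℤ.+ + 1) ≡ φ U) →
  ∀ {U U′} → Vanishes e U → Vanishes e U′ → φ U ≡ φ U′
bound-independent {e} φ step {U} {U′} v v′ with ℤₚ.≤-total U U′
... | inj₁ U≤U′ = sym (raise v U≤U′)
  where
  open Raise φ step
... | inj₂ U′≤U = raise v′ U′≤U
  where
  open Raise φ step

-- Raising a bound by one prepends a zero to a factor, hence to the Cauchy product, and moves the
-- index by one as well. So the choice of bounds is immaterial, which gives the congruence for `_≈_`
-- and the leading term of a product.
coeff-*ᴸ : ∀ f g {U V} → Vanishes (coeff f) U → Vanishes (coeff g) V →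
           ∀ k → coeff (f *ᴸ g) k ≡ convAt U V (coeff f) (coeff g) k
coeff-*ᴸ f g {U} {V} vf vg k = begin
  coeff (f *ᴸ g) k                             ≡⟨ coeff≡at (f *ᴸ g) k ⟩
  at (conv (c f) (c g)) (top f ℤ.+ top g ℤ.- k)
    ≡⟨ at-cong (conv-cong (from-top f) (from-top g)) (top f ℤ.+ top g ℤ.- k) ⟨
  convAt (top f) (top g) (coeff f) (coeff g) k
    ≡⟨ bound-independent (λ T → convAt T (top g) (coeff f) (coeff g) k)
        (λ v → convAt-sucˡ {V = top g} {h = coeff g} v k) (vanishes-top f) vf ⟩
  convAt U (top g) (coeff f) (coeff g) k
    ≡⟨ bound-independent (λ T → convAt U T (coeff f) (coeff g) k) (λ v → convAt-sucʳ {U = U} {e = coeff f} v k)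
        (vanishes-top g) vg ⟩
  convAt U V (coeff f) (coeff g) k             ∎
  where open ≡-Reasoning

vanishes-*ᴸ : ∀ f g {U V} → Vanishes (coeff f) U → Vanishes (coeff g) V → Vanishes (coeff (f *ᴸ g)) (U ℤ.+ V)
vanishes-*ᴸ f g {U} {V} vf vg k U+V<k = trans (coeff-*ᴸ f g vf vg k)
    (at-negative (conv (from U (coeff f)) (from V (coeff g))) U+V<k)

vanishes-cong : ∀ {e h U} → e ≗ h → Vanishes e U → Vanishes h U
vanishes-cong e≗h v k U<k = trans (sym (e≗h k)) (v k U<k)

*ᴸ-cong : ∀ f f′ g g′ → f ≈ f′ → g ≈ g′ → f *ᴸ g ≈ f′ *ᴸ g′
*ᴸ-cong f f′ g g′ f≈f′ g≈g′ k = begin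
  coeff (f *ᴸ g) k                               ≡⟨ coeff-*ᴸ f g (vanishes-top f) (vanishes-top g) k ⟩
  convAt (top f) (top g) (coeff f) (coeff g) k
    ≡⟨ at-cong (conv-cong (λ i → f≈f′ (top f ℤ.- + i)) (λ i → g≈g′ (top g ℤ.- + i))) (top f ℤ.+ top g ℤ.- k) ⟩
  convAt (top f) (top g) (coeff f′) (coeff g′) k
    ≡⟨ coeff-*ᴸ f′ g′ (vanishes-cong f≈f′ (vanishes-top f)) (vanishes-cong g≈g′ (vanishes-top g)) k ⟨
  coeff (f′ *ᴸ g′) k                             ∎
  where open ≡-Reasoning

*ᴸ-assoc : ∀ f g h → (f *ᴸ g) *ᴸ h ≈ f *ᴸ (g *ᴸ h)
*ᴸ-assoc f g h k = begin
  coeff ((f *ᴸ g) *ᴸ h) k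
    ≡⟨ coeff≡at ((f *ᴸ g) *ᴸ h) k ⟩
  at (conv (conv (c f) (c g)) (c h)) (top f ℤ.+ top g ℤ.+ top h ℤ.- k)
    ≡⟨ at-cong (conv-assoc (c f) (c g) (c h)) (top f ℤ.+ top g ℤ.+ top h ℤ.- k) ⟩
  at (conv (c f) (conv (c g) (c h))) (top f ℤ.+ top g ℤ.+ top h ℤ.- k)
    ≡⟨ cong (λ T → at (conv (c f) (conv (c g) (c h))) (T ℤ.- k)) (ℤₚ.+-assoc (top f) (top g) (top h)) ⟩
  at (conv (c f) (conv (c g) (c h))) (top f ℤ.+ (top g ℤ.+ top h) ℤ.- k)
    ≡⟨ coeff≡at (f *ᴸ (g *ᴸ h)) k ⟨
  coeff (f *ᴸ (g *ᴸ h)) k ∎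
  where open ≡-Reasoning

coeff-+ᴸ : ∀ f g k → coeff (f +ᴸ g) k ≡ coeff f k + coeff g k
coeff-+ᴸ f g k with difference (top f ℤ.⊔ top g) k
... | inj₁ T<k = trans (trans (coeff≡at (f +ᴸ g) k) (at-negative (c (f +ᴸ g)) T<k))
  (sym (cong₂ _+_ (vanishes-mono (ℤₚ.i≤i⊔j (top f) (top g)) (vanishes-top f) k T<k)
                  (vanishes-mono (ℤₚ.i≤j⊔i (top f) (top g)) (vanishes-top g) k T<k)))
... | inj₂ (i , k≡ , eq) = trans (coeff≡at (f +ᴸ g) k) (trans (cong (at (c (f +ᴸ g))) eq)
  (cong (λ j → coeff f j + coeff g j) (sym k≡)))

coeff--ᴸ : ∀ f k → coeff (-ᴸ f) k ≡ - coeff f k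
coeff--ᴸ f k = trans (coeff≡at (-ᴸ f) k) (trans (at-neg (c f) (top f ℤ.- k)) (cong -_ (sym (coeff≡at f k))))
  where
  at-neg : ∀ a i → at (λ j → - a j) i ≡ - at a i
  at-neg a (+ i)    = refl
  at-neg a -[1+ i ] = refl

coeff-∸ᴸ : ∀ f g k → coeff (f -ᴸ g) k ≡ coeff f k - coeff g k
coeff-∸ᴸ f g k = trans (coeff-+ᴸ f (-ᴸ g) k) (cong (λ y → coeff f k + y) (coeff--ᴸ g k))

*ᴸ-distribʳ : ∀ f g h k → coeff ((f +ᴸ g) *ᴸ h) k ≡ coeff (f *ᴸ h) k + coeff (g *ᴸ h) k
*ᴸ-distribʳ f g h k = begin
  coeff ((f +ᴸ g) *ᴸ h) k
    ≡⟨ coeff-*ᴸ (f +ᴸ g) h (vanishes-top (f +ᴸ g)) (vanishes-top h) k ⟩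
  convAt T V (coeff (f +ᴸ g)) (coeff h) k
    ≡⟨ at-cong (λ n → trans (conv-cong {b = from V (coeff h)} (λ i → coeff-+ᴸ f g (T ℤ.- + i)) (λ _ → refl) n)
         (conv-distribʳ-+ (from T (coeff f)) (from T (coeff g)) (from V (coeff h)) n)) (T ℤ.+ V ℤ.- k) ⟩
  at (λ n → conv (from T (coeff f)) (from V (coeff h)) n + conv (from T (coeff g)) (from V (coeff h)) n)
      (T ℤ.+ V ℤ.- k)
    ≡⟨ at-+ (conv (from T (coeff f)) (from V (coeff h))) (conv (from T (coeff g)) (from V (coeff h)))
        (T ℤ.+ V ℤ.- k) ⟩
  convAt T V (coeff f) (coeff h) k + convAt T V (coeff g) (coeff h) k
    ≡⟨ cong₂ _+_ (coeff-*ᴸ f h (vanishes-mono (ℤₚ.i≤i⊔j (top f) (top g)) (vanishes-top f)) (vanishes-top h) k)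
                 (coeff-*ᴸ g h (vanishes-mono (ℤₚ.i≤j⊔i (top f) (top g)) (vanishes-top g)) (vanishes-top h) k) ⟨
  coeff (f *ᴸ h) k + coeff (g *ᴸ h) k ∎
  where
  open ≡-Reasoning
  T V : ℤ
  T = top f ℤ.⊔ top g
  V = top h
  at-+ : ∀ a b i → at (λ j → a j + b j) i ≡ at a i + at b i
  at-+ a b (+ i)    = refl
  at-+ a b -[1+ i ] = refl

*ᴸ-negʳ : ∀ f g k → coeff (f *ᴸ (-ᴸ g)) k ≡ - coeff (f *ᴸ g) k
*ᴸ-negʳ f g k = trans (coeff≡at (f *ᴸ (-ᴸ g)) k)
    (trans (at-cong (conv-negʳ (c f) (c g)) (top f ℤ.+ top g ℤ.- k))
  (trans (sym (coeff≡at (-ᴸ (f *ᴸ g)) k)) (coeff--ᴸ (f *ᴸ g) k)))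

conv-negˡ : ∀ a b n → conv (λ i → - a i) b n ≡ - conv a b n
conv-negˡ a b zero = lemma (a 0) (b 0)
  where
  lemma : ∀ x y → - x * y + 0ℚ ≡ - (x * y + 0ℚ)
  lemma = solve-∀ ℚ-ring
conv-negˡ a b (suc n) = trans
  (cong (λ y → - a 0 * b (suc n) + y) (conv-negˡ (a ∘ suc) b n))
  (lemma (a 0) (b (suc n)) (conv (a ∘ suc) b n))
  where
  lemma : ∀ x y u → - x * y + - u ≡ - (x * y + u)
  lemma = solve-∀ ℚ-ring

*ᴸ-negˡ : ∀ f g k → coeff ((-ᴸ f) *ᴸ g) k ≡ - coeff (f *ᴸ g) k
*ᴸ-negˡ f g k = trans (coeff≡at ((-ᴸ f) *ᴸ g) k)
    (trans (at-cong (conv-negˡ (c f) (c g)) (top f ℤ.+ top g ℤ.- k))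
  (trans (sym (coeff≡at (-ᴸ (f *ᴸ g)) k)) (coeff--ᴸ (f *ᴸ g) k)))

-- Polynomials acting on coefficient functions

δ : ℤ → ℚ
δ (+ zero)  = 1ℚ
δ (+ suc _) = 0ℚ
δ -[1+ _ ]  = 0ℚ

-- Multiplication by a polynomial in Horner form, carried out on coefficient functions so that no
-- tops have to be tracked. On `δ`, the coefficient function of 1, it gives the coefficients of the
-- polynomial itself.
act : Poly → (ℤ → ℚ) → ℤ → ℚ
act []      e k = 0ℚ
act (a ∷ p) e k = a * e k + act p e (k ℤ.- + 1)

act-cong : ∀ p {e h} → e ≗ h → act p e ≗ act p h
act-cong []      e≗h k = refl
act-cong (a ∷ p) e≗h k = cong₂ _+_ (cong (a *_) (e≗h k)) (act-cong p e≗h (k ℤ.- + 1))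

act-+ᴾ : ∀ p q e k → act (p +ᴾ q) e k ≡ act p e k + act q e k
act-+ᴾ []      q       e k = sym (+-identityˡ (act q e k))
act-+ᴾ (a ∷ p) []      e k = sym (+-identityʳ (act (a ∷ p) e k))
act-+ᴾ (a ∷ p) (b ∷ q) e k = trans (cong (λ y → (a + b) * e k + y) (act-+ᴾ p q e (k ℤ.- + 1)))
  (lemma a b (e k) (act p e (k ℤ.- + 1)) (act q e (k ℤ.- + 1)))
  where
  lemma : ∀ x y z u v → (x + y) * z + (u + v) ≡ (x * z + u) + (y * z + v)
  lemma = solve-∀ ℚ-ring

act-map : ∀ x q e k → act (map (x *_) q) e k ≡ x * act q e k
act-map x []      e k = sym (*-zeroʳ x)
act-map x (b ∷ q) e k = trans (cong (λ y → x * b * e k + y) (act-map x q e (k ℤ.- + 1)))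
  (lemma x b (e k) (act q e (k ℤ.- + 1)))
  where
  lemma : ∀ x y z u → x * y * z + x * u ≡ x * (y * z + u)
  lemma = solve-∀ ℚ-ring

act-*ᴾ : ∀ p q e k → act (p *ᴾ q) e k ≡ act p (act q e) k
act-*ᴾ []      q e k = refl
act-*ᴾ (a ∷ p) q e k = trans (act-+ᴾ (map (a *_) q) (0ℚ ∷ (p *ᴾ q)) e k) (cong₂ _+_ (act-map a q e k)
  (trans (cong (_+ act (p *ᴾ q) e (k ℤ.- + 1)) (*-zeroˡ (e k)))
    (trans (+-identityˡ _) (act-*ᴾ p q e (k ℤ.- + 1)))))

vanishes-act : ∀ p {e U} → Vanishes e U → Vanishes (act p e) (U ℤ.+ + length p)
vanishes-act []      v k U<k = refl
vanishes-act (a ∷ p) {e} {U} v k U<k = trans (cong₂ (λ x y → a * x + y)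
    (v k (ℤₚ.≤-<-trans (ℤₚ.i≤i+j U (+ suc (length p))) U<k))
    (vanishes-act p v (k ℤ.- + 1) (subst (ℤ._< k ℤ.- + 1) eq (ℤₚ.+-monoˡ-< (ℤ.- + 1) U<k))))
  (trans (+-identityʳ _) (*-zeroʳ a))
  where
  lemma : ∀ U n → U ℤ.+ (+ 1 ℤ.+ n) ℤ.- + 1 ≡ U ℤ.+ n
  lemma = ℤ-Solver.solve-∀
  eq : U ℤ.+ + suc (length p) ℤ.- + 1 ≡ U ℤ.+ + length p
  eq = trans (cong (λ i → U ℤ.+ i ℤ.- + 1) (ℤₚ.pos-+ 1 (length p))) (lemma U (+ length p))

nth-++ : ∀ l x i → nth (l ++ x ∷ []) i ≡ nth l i + x * δ (+ length l ℤ.- + i)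
nth-++ []      x zero    = trans (sym (*-identityʳ x)) (sym (+-identityˡ (x * 1ℚ)))
nth-++ []      x (suc i) = sym (trans (+-identityˡ _) (*-zeroʳ x))
nth-++ (y ∷ l) x zero    = sym (trans (cong (λ z → y + z) (*-zeroʳ x)) (+-identityʳ y))
nth-++ (y ∷ l) x (suc i) = trans (nth-++ l x i) (cong (λ j → nth l i + x * δ j)
  (trans (ℤₚ.m-n≡m⊖n (length l) i) (trans (sym (ℤₚ.[1+m]⊖[1+n]≡m⊖n (length l) i))
      (sym (ℤₚ.m-n≡m⊖n (suc (length l)) (suc i))))))

coeff-⟦⟧ : ∀ p k → coeff ⟦ p ⟧ k ≡ act p δ k
coeff-⟦⟧ []      k = trans (coeff≡at ⟦ [] ⟧ k) (at-0 (-[1+ 0 ] ℤ.- k))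
  where
  at-0 : ∀ i → at (nth []) i ≡ 0ℚ
  at-0 (+ i)    = refl
  at-0 -[1+ i ] = refl
coeff-⟦⟧ (a ∷ p) k = begin
  coeff ⟦ a ∷ p ⟧ k
    ≡⟨ coeff≡at ⟦ a ∷ p ⟧ k ⟩
  at (nth (reverse (a ∷ p))) (+ suc L ℤ.- + 1 ℤ.- k)
    ≡⟨ cong₂ (λ l i → at (nth l) (i ℤ.- k)) (Listₚ.unfold-reverse a p) (lemma (+ L)) ⟩
  at (nth (reverse p ++ a ∷ [])) (+ L ℤ.- k)
    ≡⟨ at-++ (difference (+ L) k) ⟩
  a * δ k + at (nth (reverse p)) (+ L ℤ.- k)
    ≡⟨ cong (λ y → a * δ k + y) (trans (cong (at (nth (reverse p))) (lemma′ (+ L) k))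
        (sym (coeff≡at ⟦ p ⟧ (k ℤ.- + 1)))) ⟩
  a * δ k + coeff ⟦ p ⟧ (k ℤ.- + 1)
    ≡⟨ cong (λ y → a * δ k + y) (coeff-⟦⟧ p (k ℤ.- + 1)) ⟩
  a * δ k + act p δ (k ℤ.- + 1) ∎
  where
  open ≡-Reasoning
  L : ℕ
  L = length p
  lemma : ∀ L → (+ 1 ℤ.+ L) ℤ.- + 1 ≡ L
  lemma = ℤ-Solver.solve-∀
  lemma′ : ∀ L k → L ℤ.- k ≡ L ℤ.- + 1 ℤ.- (k ℤ.- + 1)
  lemma′ = ℤ-Solver.solve-∀
  δ-above : ∀ {k} → + L ℤ.< k → δ k ≡ 0ℚ
  δ-above {+ suc _} _ = refl
  δ-above {+ zero} (ℤ.+<+ ())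
  at-++ : (+ L ℤ.< k) ⊎ (∃[ i ] k ≡ + L ℤ.- + i × + L ℤ.- k ≡ + i) →
    at (nth (reverse p ++ a ∷ [])) (+ L ℤ.- k) ≡ a * δ k + at (nth (reverse p)) (+ L ℤ.- k)
  at-++ (inj₁ L<k) = trans (at-negative (nth (reverse p ++ a ∷ [])) L<k)
    (sym (trans (cong₂ _+_ (trans (cong (a *_) (δ-above L<k)) (*-zeroʳ a)) (at-negative (nth (reverse p)) L<k))
        (+-identityˡ 0ℚ)))
  at-++ (inj₂ (i , k≡ , eq)) = begin
    at (nth (reverse p ++ a ∷ [])) (+ L ℤ.- k) ≡⟨ cong (at (nth (reverse p ++ a ∷ []))) eq ⟩
    nth (reverse p ++ a ∷ []) i                ≡⟨ nth-++ (reverse p) a i ⟩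
    nth (reverse p) i + a * δ (+ length (reverse p) ℤ.- + i)
      ≡⟨ cong (λ n → nth (reverse p) i + a * δ (+ n ℤ.- + i)) (Listₚ.length-reverse p) ⟩
    nth (reverse p) i + a * δ (+ L ℤ.- + i)    ≡⟨ cong (λ j → nth (reverse p) i + a * δ j) k≡ ⟨
    nth (reverse p) i + a * δ k                ≡⟨ +-comm (nth (reverse p) i) (a * δ k) ⟩
    a * δ k + nth (reverse p) i                ≡⟨ cong (λ j → a * δ k + at (nth (reverse p)) j) eq ⟨
    a * δ k + at (nth (reverse p)) (+ L ℤ.- k) ∎

private
  monomial : ℚ → Laurent
  monomial a = series (+ 0) (λ { zero → a ; (suc _) → 0ℚ })

  shift : Laurent → Laurent
  shift f = series (top f ℤ.+ + 1) (c f)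

  coeff-monomial : ∀ a k → coeff (monomial a) k ≡ a * δ k
  coeff-monomial a (+ zero)  = sym (*-identityʳ a)
  coeff-monomial a (+ suc k) = sym (*-zeroʳ a)
  coeff-monomial a -[1+ k ]  = sym (*-zeroʳ a)

  coeff-shift : ∀ f k → coeff (shift f) k ≡ coeff f (k ℤ.- + 1)
  coeff-shift f k = trans (coeff≡at (shift f) k) (trans (cong (at (c f)) (lemma (top f) k))
      (sym (coeff≡at f (k ℤ.- + 1))))
    where
    lemma : ∀ T k → T ℤ.+ + 1 ℤ.- k ≡ T ℤ.- (k ℤ.- + 1)
    lemma = ℤ-Solver.solve-∀

  shift-*ᴸ : ∀ f g k → coeff (shift f *ᴸ g) k ≡ coeff (f *ᴸ g) (k ℤ.- + 1)
  shift-*ᴸ f g k = trans (coeff≡at (shift f *ᴸ g) k)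
      (trans (cong (at (conv (c f) (c g))) (lemma (top f) (top g) k))
    (sym (coeff≡at (f *ᴸ g) (k ℤ.- + 1))))
    where
    lemma : ∀ T U k → T ℤ.+ + 1 ℤ.+ U ℤ.- k ≡ T ℤ.+ U ℤ.- (k ℤ.- + 1)
    lemma = ℤ-Solver.solve-∀

  conv-0 : ∀ b n → conv (λ _ → 0ℚ) b n ≡ 0ℚ
  conv-0 b zero    = trans (conv-zero (λ _ → 0ℚ) b) (*-zeroˡ (b 0))
  conv-0 b (suc n) = trans (cong₂ _+_ (*-zeroˡ (b (suc n))) (conv-0 b n)) (+-identityˡ 0ℚ)

  at-* : ∀ x a i → at (λ j → x * a j) i ≡ x * at a i
  at-* x a (+ i)    = refl
  at-* x a -[1+ i ] = sym (*-zeroʳ x)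

  monomial-*ᴸ : ∀ a g k → coeff (monomial a *ᴸ g) k ≡ a * coeff g k
  monomial-*ᴸ a g k = begin
    coeff (monomial a *ᴸ g) k                                       ≡⟨ coeff≡at (monomial a *ᴸ g) k ⟩
    at (conv (c (monomial a)) (c g)) (+ 0 ℤ.+ top g ℤ.- k)          ≡⟨ at-cong conv-monomial
        (+ 0 ℤ.+ top g ℤ.- k) ⟩
    at (λ i → a * c g i) (+ 0 ℤ.+ top g ℤ.- k)                      ≡⟨ at-* a (c g) (+ 0 ℤ.+ top g ℤ.- k) ⟩
    a * at (c g) (+ 0 ℤ.+ top g ℤ.- k)                              ≡⟨ cong (λ T → a * at (c g) (T ℤ.- k))
        (ℤₚ.+-identityˡ (top g)) ⟩
    a * at (c g) (top g ℤ.- k)                                      ≡⟨ cong (a *_) (coeff≡at g k) ⟨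
    a * coeff g k                                                   ∎
    where
    open ≡-Reasoning
    conv-monomial : conv (c (monomial a)) (c g) ≗ λ i → a * c g i
    conv-monomial zero    = conv-zero (c (monomial a)) (c g)
    conv-monomial (suc n) = trans (cong (λ y → a * c g (suc n) + y) (conv-0 (c g) n)) (+-identityʳ _)

-- Induction along `a + z p`: a monomial scales, `shift` multiplies by `z`, and distributivity adds
-- the two parts.
coeff-⟦⟧*ᴸ : ∀ p g k → coeff (⟦ p ⟧ *ᴸ g) k ≡ act p (coeff g) k
coeff-⟦⟧*ᴸ [] g k = trans (coeff≡at (⟦ [] ⟧ *ᴸ g) k) (trans (at-cong (conv-0 (c g)) (-[1+ 0 ] ℤ.+ top g ℤ.- k))
    (at-0 (-[1+ 0 ] ℤ.+ top g ℤ.- k)))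
  where
  at-0 : ∀ i → at (λ _ → 0ℚ) i ≡ 0ℚ
  at-0 (+ i)    = refl
  at-0 -[1+ i ] = refl
coeff-⟦⟧*ᴸ (a ∷ p) g k = begin
  coeff (⟦ a ∷ p ⟧ *ᴸ g) k                                   ≡⟨ *ᴸ-cong ⟦ a ∷ p ⟧ (monomial a +ᴸ shift ⟦ p ⟧) g
      g split (λ _ → refl) k ⟩
  coeff ((monomial a +ᴸ shift ⟦ p ⟧) *ᴸ g) k                 ≡⟨ *ᴸ-distribʳ (monomial a) (shift ⟦ p ⟧) g k ⟩
  coeff (monomial a *ᴸ g) k + coeff (shift ⟦ p ⟧ *ᴸ g) k     ≡⟨ cong₂ _+_ (monomial-*ᴸ a g k)
      (trans (shift-*ᴸ ⟦ p ⟧ g k) (coeff-⟦⟧*ᴸ p g (k ℤ.- + 1))) ⟩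
  a * coeff g k + act p (coeff g) (k ℤ.- + 1)                ∎
  where
  open ≡-Reasoning
  split : ⟦ a ∷ p ⟧ ≈ monomial a +ᴸ shift ⟦ p ⟧
  split k = trans (coeff-⟦⟧ (a ∷ p) k) (sym (trans (coeff-+ᴸ (monomial a) (shift ⟦ p ⟧) k)
    (cong₂ _+_ (coeff-monomial a k) (trans (coeff-shift ⟦ p ⟧ k) (coeff-⟦⟧ p (k ℤ.- + 1))))))

coeff-1ᴸ : ∀ k → coeff 1ᴸ k ≡ δ k
coeff-1ᴸ k = trans (coeff-⟦⟧ 1ᴾ k) (trans (+-identityʳ _) (*-identityˡ (δ k)))

1ᴸ-*ᴸ : ∀ g k → coeff (1ᴸ *ᴸ g) k ≡ coeff g k
1ᴸ-*ᴸ g k = trans (coeff-⟦⟧*ᴸ 1ᴾ g k) (trans (+-identityʳ _) (*-identityˡ (coeff g k)))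

-- Leading terms of series.

Leading : (ℤ → ℚ) → ℤ → Set
Leading e n = e n ≢ 0ℚ × Vanishes e n

leading-cong : ∀ {e h n} → e ≗ h → Leading e n → Leading h n
leading-cong {n = n} e≗h (e≢0 , v) = (λ h≡0 → e≢0 (trans (e≗h n) h≡0)) , vanishes-cong e≗h v

leading-unique : ∀ {e m n} → Leading e m → Leading e n → m ≡ n
leading-unique {e} {m} {n} (em≢0 , vm) (en≢0 , vn) with ℤₚ.<-cmp m n
... | tri< m<n _ _ = contradiction (vm n m<n) en≢0
... | tri≈ _ m≡n _ = m≡n
... | tri> _ _ n<m = contradiction (vn m n<m) em≢0

p*q≡0⇒ : ∀ {p q} → p * q ≡ 0ℚ → p ≡ 0ℚ ⊎ q ≡ 0ℚ
p*q≡0⇒ {p} {q} pq≡0 with p ≟ 0ℚ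
... | yes p≡0 = inj₁ p≡0
... | no  p≢0 = inj₂ (begin
  q                    ≡⟨ *-identityʳ q ⟨
  q * 1ℚ               ≡⟨ cong (q *_) (x*inv-x≡1 p p≢0) ⟨
  q * (p * inv p)      ≡⟨ lemma q p (inv p) ⟩
  p * q * inv p        ≡⟨ cong (_* inv p) pq≡0 ⟩
  0ℚ * inv p           ≡⟨ *-zeroˡ (inv p) ⟩
  0ℚ                   ∎)
  where
  open ≡-Reasoning
  lemma : ∀ x y z → x * (y * z) ≡ y * x * z
  lemma = solve-∀ ℚ-ring

leading-*ᴸ : ∀ f g {m n} → Leading (coeff f) m → Leading (coeff g) n → Leading (coeff (f *ᴸ g)) (m ℤ.+ n)
leading-*ᴸ f g {m} {n} (fm≢0 , vf) (gn≢0 , vg) = product≢0 , vanishes-*ᴸ f g vf vg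
  where
  product : coeff (f *ᴸ g) (m ℤ.+ n) ≡ coeff f m * coeff g n
  product = trans (coeff-*ᴸ f g vf vg (m ℤ.+ n)) (trans (cong (at (conv (from m (coeff f)) (from n (coeff g))))
      (ℤₚ.+-inverseʳ (m ℤ.+ n)))
    (trans (conv-zero (from m (coeff f)) (from n (coeff g))) (cong₂ (λ i j → coeff f i * coeff g j)
        (ℤₚ.+-identityʳ m) (ℤₚ.+-identityʳ n))))
  product≢0 : coeff (f *ᴸ g) (m ℤ.+ n) ≢ 0ℚ
  product≢0 eq with p*q≡0⇒ (trans (sym product) eq)
  ... | inj₁ fm≡0 = fm≢0 fm≡0
  ... | inj₂ gn≡0 = gn≢0 gn≡0

-- This makes degrees effective: a series that is merely not zero need not reveal a nonzero
-- coefficient, but a nonzero coefficient of a product reveals one in each factor.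
conv≢0 : ∀ a b n → conv a b n ≢ 0ℚ → (∃[ i ] a i ≢ 0ℚ) × (∃[ j ] b j ≢ 0ℚ)
conv≢0 a b zero ≢0 =
  (0 , λ a≡0 → ≢0 (trans (conv-zero a b) (trans (cong (_* b 0) a≡0) (*-zeroˡ (b 0))))) ,
  (0 , λ b≡0 → ≢0 (trans (conv-zero a b) (trans (cong (a 0 *_) b≡0) (*-zeroʳ (a 0)))))
conv≢0 a b (suc n) ≢0 with a 0 * b (suc n) ≟ 0ℚ
... | yes ab≡0 = let (i , ai≢0) , bj = conv≢0 (a ∘ suc) b n
                       (λ eq → ≢0 (trans (cong₂ _+_ ab≡0 eq) (+-identityˡ 0ℚ)))
                 in  (suc i , ai≢0) , bj
... | no  ab≢0 = (0 , λ a≡0 → ab≢0 (trans (cong (_* b (suc n)) a≡0) (*-zeroˡ (b (suc n))))) ,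
                 (suc n , λ b≡0 → ab≢0 (trans (cong (a 0 *_) b≡0) (*-zeroʳ (a 0))))

firstNonzero : ∀ (a : ℕ → ℚ) n → a n ≢ 0ℚ → ∃[ i ] a i ≢ 0ℚ × (∀ j → j ℕ.< i → a j ≡ 0ℚ)
firstNonzero a n an≢0 with a 0 ≟ 0ℚ
... | no  a0≢0 = 0 , a0≢0 , λ _ ()
... | yes a0≡0 with n
...   | zero   = contradiction a0≡0 an≢0
...   | suc n′ =
  let i , ai≢0 , before = firstNonzero (a ∘ suc) n′ an≢0
  in  suc i , ai≢0 , λ { zero _ → a0≡0 ; (suc j) (ℕ.s≤s j<i) → before j j<i }

leading-exists : ∀ f n → c f n ≢ 0ℚ → ∃[ m ] Leading (coeff f) m
leading-exists f n ≢0 =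
  let i , ci≢0 , before = firstNonzero (c f) n ≢0
      m = top f ℤ.- + i
  in  m , (λ eq → ci≢0 (trans (sym (from-top f i)) eq)) , λ k m<k → vanishes before m<k (difference (top f) k)
  where
  vanishes : ∀ {i k} → (∀ j → j ℕ.< i → c f j ≡ 0ℚ) → top f ℤ.- + i ℤ.< k →
    (top f ℤ.< k) ⊎ (∃[ j ] k ≡ top f ℤ.- + j × top f ℤ.- k ≡ + j) → coeff f k ≡ 0ℚ
  vanishes before m<k (inj₁ T<k) = vanishes-top f _ T<k
  vanishes {i} before m<k (inj₂ (j , refl , _)) = trans (from-top f j) (before j (ℕₚ.≰⇒> λ i≤j →
    ℤₚ.<⇒≱ m<k (ℤₚ.+-monoʳ-≤ (top f) (ℤₚ.neg-mono-≤ (ℤ.+≤+ i≤j)))))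

δ0≢0 : δ (+ 0) ≢ 0ℚ
δ0≢0 ()

vanishes-δ : Vanishes δ (+ 0)
vanishes-δ (+ suc k) _ = refl
vanishes-δ (+ zero) (ℤ.+<+ ())

leading-δ : Leading δ (+ 0)
leading-δ = δ0≢0 , vanishes-δ

-- The constant coefficient 1 of the product yields nonzero coefficients of `f` and `g`; bounded
-- searches then find the leading ones, whose exponents add up to the degree 0 of the product.
leading-inverse : ∀ f g → f *ᴸ g ≈ 1ᴸ → ∃[ n ] Leading (coeff f) n × Leading (coeff g) (ℤ.- n)
leading-inverse f g fg≈1 =
  let i , j = nonzero (difference (top f ℤ.+ top g) (+ 0))
      m , lf = leading-exists f (proj₁ i) (proj₂ i)
      n , lg = leading-exists g (proj₁ j) (proj₂ j)
      m+n≡0 = leading-unique (leading-*ᴸ f g lf lg) (leading-cong (λ k → sym (trans (fg≈1 k) (coeff-1ᴸ k)))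
          leading-δ)
  in  m , lf , subst (Leading (coeff g)) (lemma m n m+n≡0) lg
  where
  lemma : ∀ m n → m ℤ.+ n ≡ + 0 → n ≡ ℤ.- m
  lemma m n eq = trans (identity m n) (trans (cong (λ i → i ℤ.- m) eq) (ℤₚ.+-identityˡ (ℤ.- m)))
    where
    identity : ∀ m n → n ≡ m ℤ.+ n ℤ.- m
    identity = ℤ-Solver.solve-∀
  coeff0≢0 : coeff (f *ᴸ g) (+ 0) ≢ 0ℚ
  coeff0≢0 eq = δ0≢0 (trans (sym (trans (fg≈1 (+ 0)) (coeff-1ᴸ (+ 0)))) eq)
  nonzero : (top f ℤ.+ top g ℤ.< + 0) ⊎ (∃[ i ] + 0 ≡ top f ℤ.+ top g ℤ.- + i × top f ℤ.+ top g ℤ.- + 0 ≡ + i) →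
    (∃[ i ] c f i ≢ 0ℚ) × (∃[ j ] c g j ≢ 0ℚ)
  nonzero (inj₁ T<0) = contradiction (vanishes-top (f *ᴸ g) (+ 0) T<0) coeff0≢0
  nonzero (inj₂ (i , _ , eq)) = conv≢0 (c f) (c g) i λ eq′ → coeff0≢0
    (trans (coeff≡at (f *ᴸ g) (+ 0)) (trans (cong (at (conv (c f) (c g))) eq) eq′))

-- Degrees of polynomials

deg-nth : ∀ p {n} → nth p n ≢ 0ℚ → (∀ j → n ℕ.< j → nth p j ≡ 0ℚ) → deg p ≡ n
deg-nth []      ≢0 _ = contradiction refl ≢0
deg-nth (a ∷ p) {n} ≢0 above with all? (_≟ 0ℚ) p
deg-nth (a ∷ p) {zero}  ≢0 above | yes _    = refl
deg-nth (a ∷ p) {suc n} ≢0 above | yes z    = contradiction (all-nth z n) ≢0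
  where
  all-nth : ∀ {p} → IsZeroᴾ p → ∀ n → nth p n ≡ 0ℚ
  all-nth []       n       = refl
  all-nth (eq ∷ _) zero    = eq
  all-nth (_ ∷ z)  (suc n) = all-nth z n
deg-nth (a ∷ p) {zero}  ≢0 above | no ¬zero = contradiction (nth-all p (λ j → above (suc j) (ℕ.s≤s ℕ.z≤n)))
    ¬zero
  where
  nth-all : ∀ p → (∀ j → nth p j ≡ 0ℚ) → IsZeroᴾ p
  nth-all []      _ = []
  nth-all (x ∷ p) z = z 0 ∷ nth-all p (z ∘ suc)
deg-nth (a ∷ p) {suc n} ≢0 above | no _ = cong suc (deg-nth p ≢0 (λ j n<j → above (suc j) (ℕ.s≤s n<j)))

actδ-negative : ∀ p k → k ℤ.< + 0 → act p δ k ≡ 0ℚ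
actδ-negative []      k k<0 = refl
actδ-negative (a ∷ p) -[1+ k ] _ = trans (cong₂ _+_ (*-zeroʳ a) (actδ-negative p (-[1+ k ] ℤ.- + 1) ℤ.-<+))
    (+-identityˡ 0ℚ)
actδ-negative (a ∷ p) (+ k) (ℤ.+<+ ())

actδ-nth : ∀ p j → act p δ (+ j) ≡ nth p j
actδ-nth []      j       = refl
actδ-nth (a ∷ p) zero    = trans (cong₂ _+_ (*-identityʳ a) (actδ-negative p -[1+ 0 ] ℤ.-<+)) (+-identityʳ a)
actδ-nth (a ∷ p) (suc j) = trans (cong₂ _+_ (*-zeroʳ a) (actδ-nth p j)) (+-identityˡ (nth p j))

leading⇒deg : ∀ p {n} → Leading (act p δ) (+ n) → deg p ≡ n
leading⇒deg p {n} (≢0 , v) = deg-nth p (λ eq → ≢0 (trans (actδ-nth p n) eq))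
  (λ j n<j → trans (sym (actδ-nth p j)) (v (+ j) (ℤ.+<+ n<j)))

nth-applyUpTo : ∀ (u : ℕ → ℚ) n j → j ℕ.< n → nth (applyUpTo u n) j ≡ u j
nth-applyUpTo u (suc n) zero    _           = refl
nth-applyUpTo u (suc n) (suc j) (ℕ.s≤s j<n) = nth-applyUpTo (u ∘ suc) n j j<n

nth-applyUpTo-≥ : ∀ (u : ℕ → ℚ) n j → n ℕ.≤ j → nth (applyUpTo u n) j ≡ 0ℚ
nth-applyUpTo-≥ u zero    j       _           = refl
nth-applyUpTo-≥ u (suc n) (suc j) (ℕ.s≤s n≤j) = nth-applyUpTo-≥ (u ∘ suc) n j n≤j

coeff-⌊⌋ : ∀ f j → act ⌊ f ⌋ δ (+ j) ≡ coeff f (+ j)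
coeff-⌊⌋ f j = trans (actδ-nth ⌊ f ⌋ j) (lemma (j ℕₚ.<? suc ℤ.∣ top f ∣))
  where
  lemma : Dec (j ℕ.< suc ℤ.∣ top f ∣) → nth ⌊ f ⌋ j ≡ coeff f (+ j)
  lemma (yes j<) = nth-applyUpTo (λ i → coeff f (+ i)) (suc ℤ.∣ top f ∣) j j<
  lemma (no  j≮) = trans (nth-applyUpTo-≥ (λ i → coeff f (+ i)) (suc ℤ.∣ top f ∣) j (ℕₚ.≮⇒≥ j≮))
    (sym (vanishes-top f (+ j) (ℤₚ.≤-<-trans (i≤+∣i∣ (top f)) (ℤ.+<+ (ℕₚ.≮⇒≥ j≮)))))
    where
    i≤+∣i∣ : ∀ i → i ℤ.≤ + ℤ.∣ i ∣
    i≤+∣i∣ (+ n)    = ℤₚ.≤-refl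
    i≤+∣i∣ -[1+ n ] = ℤ.-≤+

leading-⌊⌋ : ∀ f {n} → Leading (coeff f) (+ n) → Leading (act ⌊ f ⌋ δ) (+ n)
leading-⌊⌋ f {n} (≢0 , v) = (λ eq → ≢0 (trans (sym (coeff-⌊⌋ f n)) eq)) ,
  λ { (+ j) n<j → trans (coeff-⌊⌋ f j) (v (+ j) n<j) ; -[1+ j ] () }

act-- : ∀ p e h k → act p (λ j → e j - h j) k ≡ act p e k - act p h k
act-- []      e h k = refl
act-- (a ∷ p) e h k = trans (cong (λ y → a * (e k - h k) + y) (act-- p e h (k ℤ.- + 1)))
  (lemma a (e k) (h k) (act p e (k ℤ.- + 1)) (act p h (k ℤ.- + 1)))
  where
  lemma : ∀ x y z u v → x * (y - z) + (u - v) ≡ (x * y + u) - (x * z + v)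
  lemma = solve-∀ ℚ-ring

act-1ᴾ : ∀ e k → act 1ᴾ e k ≡ e k
act-1ᴾ e k = trans (+-identityʳ _) (*-identityˡ (e k))

-- Continued fractions

module Convergents {f : Laurent} (cf : ContinuedFraction f) where
  open ContinuedFraction cf

  fractional : ℕ → Laurent
  fractional n = complete n -ᴸ ⟦ a n ⟧

  -- The classical `q_k f - p_k = (-1)^k ∏_{i≤k} (f_i - a_i)`. As a product it shows its degree;
  -- `error≡remainder` identifies it with the linear form.
  error : ℕ → Laurent
  error zero    = fractional 0
  error (suc k) = -ᴸ (fractional (suc k) *ᴸ error k)

  error-suc : ∀ k j → coeff (error (suc k)) j ≡ act (a (suc k)) (coeff (error k)) j - coeff
      (complete (suc k) *ᴸ error k) j
  error-suc k j = begin
    coeff (-ᴸ (fractional (suc k) *ᴸ error k)) j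
      ≡⟨ coeff--ᴸ (fractional (suc k) *ᴸ error k) j ⟩
    - coeff (fractional (suc k) *ᴸ error k) j
      ≡⟨ cong -_ (*ᴸ-distribʳ (complete (suc k)) (-ᴸ ⟦ a (suc k) ⟧) (error k) j) ⟩
    - (coeff (complete (suc k) *ᴸ error k) j + coeff ((-ᴸ ⟦ a (suc k) ⟧) *ᴸ error k) j)
      ≡⟨ cong (λ y → - (coeff (complete (suc k) *ᴸ error k) j + y)) (trans (*ᴸ-negˡ ⟦ a (suc k) ⟧ (error k) j)
           (cong -_ (coeff-⟦⟧*ᴸ (a (suc k)) (error k) j))) ⟩
    - (coeff (complete (suc k) *ᴸ error k) j + - act (a (suc k)) (coeff (error k)) j)
      ≡⟨ lemma (coeff (complete (suc k) *ᴸ error k) j) (act (a (suc k)) (coeff (error k)) j) ⟩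
    act (a (suc k)) (coeff (error k)) j - coeff (complete (suc k) *ᴸ error k) j ∎
    where
    open ≡-Reasoning
    lemma : ∀ x y → - (x + - y) ≡ y - x
    lemma = solve-∀ ℚ-ring

  -- The complete quotient cancels against the fractional part that it inverts. In `error-suc` this
  -- produces the recurrence of the convergents.
  complete*error : ∀ k j → coeff (complete (suc (suc k)) *ᴸ error (suc k)) j ≡ - coeff (error k) j
  complete*error k j = begin
    coeff (complete (suc (suc k)) *ᴸ (-ᴸ (fractional (suc k) *ᴸ error k))) j
      ≡⟨ *ᴸ-negʳ (complete (suc (suc k))) (fractional (suc k) *ᴸ error k) j ⟩
    - coeff (complete (suc (suc k)) *ᴸ (fractional (suc k) *ᴸ error k)) j
      ≡⟨ cong -_ (*ᴸ-assoc (complete (suc (suc k))) (fractional (suc k)) (error k) j) ⟨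
    - coeff ((complete (suc (suc k)) *ᴸ fractional (suc k)) *ᴸ error k) j
      ≡⟨ cong -_ (*ᴸ-cong (complete (suc (suc k)) *ᴸ fractional (suc k)) 1ᴸ (error k) (error k) (step (suc k))
          (λ _ → refl) j) ⟩
    - coeff (1ᴸ *ᴸ error k) j
      ≡⟨ cong -_ (1ᴸ-*ᴸ (error k) j) ⟩
    - coeff (error k) j ∎
    where open ≡-Reasoning

  remainder : ℕ → ℤ → ℚ
  remainder k j = act (denom k) (coeff f) j - act (numer k) δ j

  fractional-coeff : ∀ k j → coeff (fractional k) j ≡ coeff (complete k) j - act (a k) δ j
  fractional-coeff k j = trans (coeff-∸ᴸ (complete k) ⟦ a k ⟧ j) (cong (λ y → coeff (complete k) j - y)
      (coeff-⟦⟧ (a k) j))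

  -- Both sides satisfy `y_{k+2} = a_{k+2} y_{k+1} + y_k` and agree for the first two indices.
  error≡remainder : ∀ k → coeff (error k) ≗ remainder k
  error≡remainder 0 j = trans (fractional-coeff 0 j)
      (cong (_- act (a 0) δ j) (trans (start j) (sym (act-1ᴾ (coeff f) j))))
  error≡remainder 1 j = begin
    coeff (error 1) j
      ≡⟨ error-suc 0 j ⟩
    act (a 1) (coeff (error 0)) j - coeff (complete 1 *ᴸ error 0) j
      ≡⟨ cong₂ _-_ (trans (act-cong (a 1) (λ i → trans (error≡remainder 0 i)
          (cong (_- act (a 0) δ i) (act-1ᴾ (coeff f) i))) j)
           (act-- (a 1) (coeff f) (act (a 0) δ) j)) (trans (step 0 j) (coeff-1ᴸ j)) ⟩
    act (a 1) (coeff f) j - act (a 1) (act (a 0) δ) j - δ j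
      ≡⟨ lemma (act (a 1) (coeff f) j) (act (a 1) (act (a 0) δ) j) (δ j) ⟩
    act (a 1) (coeff f) j - (act (a 1) (act (a 0) δ) j + δ j)
      ≡⟨ cong (λ y → act (a 1) (coeff f) j - y) (trans (act-+ᴾ (a 1 *ᴾ a 0) 1ᴾ δ j)
           (cong₂ _+_ (act-*ᴾ (a 1) (a 0) δ j) (act-1ᴾ δ j))) ⟨
    remainder 1 j ∎
    where
    open ≡-Reasoning
    lemma : ∀ x y z → x - y - z ≡ x - (y + z)
    lemma = solve-∀ ℚ-ring
  error≡remainder (suc (suc k)) j = begin
    coeff (error (suc (suc k))) j
      ≡⟨ error-suc (suc k) j ⟩
    act α (coeff (error (suc k))) j - coeff (complete (suc (suc k)) *ᴸ error (suc k)) j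
      ≡⟨ cong₂ _-_ (trans (act-cong α (error≡remainder (suc k)) j) (act-- α (act (denom (suc k)) (coeff f))
          (act (numer (suc k)) δ) j))
           (trans (complete*error k j) (cong -_ (error≡remainder k j))) ⟩
    act α (act (denom (suc k)) (coeff f)) j - act α (act (numer (suc k)) δ) j - -
        (act (denom k) (coeff f) j - act (numer k) δ j)
      ≡⟨ lemma (act α (act (denom (suc k)) (coeff f)) j) (act α (act (numer (suc k)) δ) j)
          (act (denom k) (coeff f) j) (act (numer k) δ j) ⟩
    (act α (act (denom (suc k)) (coeff f)) j + act (denom k) (coeff f) j) -
        (act α (act (numer (suc k)) δ) j + act (numer k) δ j)
      ≡⟨ cong₂ _-_ (expand (denom (suc k)) (denom k) (coeff f)) (expand (numer (suc k)) (numer k) δ) ⟨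
    remainder (suc (suc k)) j ∎
    where
    open ≡-Reasoning
    α : Poly
    α = a (suc (suc k))
    lemma : ∀ x y z u → x - y - - (z - u) ≡ (x + z) - (y + u)
    lemma = solve-∀ ℚ-ring
    expand : ∀ p q e → act (α *ᴾ p +ᴾ q) e j ≡ act α (act p e) j + act q e j
    expand p q e = trans (act-+ᴾ (α *ᴾ p) q e j) (cong (_+ act q e j) (act-*ᴾ α p e j))

  fractional-vanishes : ∀ k j → coeff (fractional k) (+ j) ≡ 0ℚ
  fractional-vanishes k j = trans (fractional-coeff k (+ j))
    (trans (cong (λ y → coeff (complete k) (+ j) - y) (coeff-⌊⌋ (complete k) j))
        (+-inverseʳ (coeff (complete k) (+ j))))

  -- A fractional part has no exponents `≥ 0`, so its leading exponent is negative and that of its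
  -- inverse is positive.
  leading-step : ∀ k → ∃[ n ] Leading (coeff (complete (suc k))) (+ suc n) × Leading (coeff (fractional k)) -[1+
      n ]
  leading-step k = positive-degree (leading-inverse (complete (suc k)) (fractional k) (step k))
    where
    positive-degree : (∃[ n ] Leading (coeff (complete (suc k))) n × Leading (coeff (fractional k)) (ℤ.- n)) →
      ∃[ n ] Leading (coeff (complete (suc k))) (+ suc n) × Leading (coeff (fractional k)) -[1+ n ]
    positive-degree (+ suc n  , l , l′)       = n , l , l′
    positive-degree (+ zero   , _ , ≢0 , _)  = contradiction (fractional-vanishes k 0) ≢0
    positive-degree (-[1+ n ] , _ , ≢0 , _)  = contradiction (fractional-vanishes k (suc n)) ≢0

  -- The sum of the degrees of the complete quotients with indices from 1 to `k`. Strict growth is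
  -- immediate in this form; `deg-denom` connects it with `deg`.
  D : ℕ → ℕ
  D zero    = 0
  D (suc k) = suc (proj₁ (leading-step k)) ℕ.+ D k

  D-increasing : ∀ k → D k ℕ.< D (suc k)
  D-increasing k = ℕ.s≤s (ℕₚ.m≤n+m (D k) (proj₁ (leading-step k)))

  -- Degrees add along the product: the fractional parts with indices `0` to `k` have the opposite
  -- degrees of the complete quotients with indices `1` to `suc k`.
  leading-error : ∀ k → Leading (coeff (error k)) (ℤ.- + D (suc k))
  leading-error zero    = subst (λ n → Leading (coeff (error 0)) -[1+ n ])
      (sym (ℕₚ.+-identityʳ (proj₁ (leading-step 0)))) (proj₂ (proj₂ (leading-step 0)))
  leading-error (suc k) = subst (Leading (coeff (error (suc k))))
    (trans (sym (ℤₚ.neg-distrib-+ (+ suc (proj₁ (leading-step (suc k)))) (+ D (suc k))))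
        (cong ℤ.-_ (sym (ℤₚ.pos-+ (suc (proj₁ (leading-step (suc k)))) (D (suc k))))))
    (leading-neg (fractional (suc k) *ᴸ error k) (leading-*ᴸ (fractional (suc k)) (error k)
        (proj₂ (proj₂ (leading-step (suc k)))) (leading-error k)))
    where
    leading-neg : ∀ f {n} → Leading (coeff f) n → Leading (coeff (-ᴸ f)) n
    leading-neg f {n} (≢0 , v) =
      (λ eq → ≢0 (trans (sym (neg-involutive (coeff f n))) (cong -_ (trans (sym (coeff--ᴸ f n)) eq)))) ,
      λ k n<k → trans (coeff--ᴸ f k) (cong -_ (v k n<k))
      where
      neg-involutive : ∀ x → - - x ≡ x
      neg-involutive = solve-∀ ℚ-ring

  leading-remainder : ∀ k → Leading (remainder k) (ℤ.- + D (suc k))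
  leading-remainder k = leading-cong (error≡remainder k) (leading-error k)

  -- In the recurrence the product has degree `D (suc (suc k))`, and adding `denom k`, of smaller
  -- degree, leaves its leading term untouched.
  leading-denom : ∀ k → Leading (act (denom k) δ) (+ D k)
  leading-denom zero = leading-cong (λ k → sym (act-1ᴾ δ k)) leading-δ
  leading-denom (suc zero) = subst (λ n → Leading (act (denom 1) δ) (+ suc n))
      (sym (ℕₚ.+-identityʳ (proj₁ (leading-step 0))))
    (leading-⌊⌋ (complete 1) (proj₁ (proj₂ (leading-step 0))))
  leading-denom (suc (suc k)) =
    leading-cong (λ j → sym (trans (act-+ᴾ (α *ᴾ denom (suc k)) (denom k) δ j)
        (cong (_+ act (denom k) δ j) (act-*ᴾ α (denom (suc k)) δ j))))
      (leading-+ (leading-cong product (leading-*ᴸ ⟦ α ⟧ ⟦ denom (suc k) ⟧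
          (leading-cong (λ j → sym (coeff-⟦⟧ α j)) (leading-⌊⌋ (complete (suc (suc k)))
              (proj₁ (proj₂ (leading-step (suc k))))))
          (leading-cong (λ j → sym (coeff-⟦⟧ (denom (suc k)) j)) (leading-denom (suc k)))))
        (λ j D<j → proj₂ (leading-denom k) j
            (ℤₚ.≤-<-trans (ℤ.+≤+ (ℕₚ.≤-trans (ℕₚ.<⇒≤ (D-increasing k)) (ℕₚ.<⇒≤ (D-increasing (suc k))))) D<j))
        (proj₂ (leading-denom k) (+ D (suc (suc k)))
            (ℤ.+<+ (ℕₚ.<-trans (D-increasing k) (D-increasing (suc k))))))
    where
    α : Poly
    α = a (suc (suc k))
    product : coeff (⟦ α ⟧ *ᴸ ⟦ denom (suc k) ⟧) ≗ act α (act (denom (suc k)) δ)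
    product j = trans (coeff-⟦⟧*ᴸ α ⟦ denom (suc k) ⟧ j) (act-cong α (coeff-⟦⟧ (denom (suc k))) j)
    leading-+ : ∀ {e h n} → Leading e n → Vanishes h n → h n ≡ 0ℚ → Leading (λ j → e j + h j) n
    leading-+ {e} {h} {n} (≢0 , v) v′ hn≡0 =
      (λ eq → ≢0 (trans (sym (+-identityʳ (e n))) (trans (cong (λ y → e n + y) (sym hn≡0)) eq))) ,
      λ j n<j → trans (cong₂ _+_ (v j n<j) (v′ j n<j)) (+-identityˡ 0ℚ)

  deg-denom : ∀ k → deg (denom k) ≡ D k
  deg-denom k = leading⇒deg (denom k) (leading-denom k)

-- Sequences modulo null sequences

infix 4 _∼_
-- Equality of limits, expressed on the sequences themselves: the values of `f` at different points
-- are related through their partial sums. Being a record, it allows `u` and `v` to be inferred.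
record _∼_ (u v : ℕ → ℚ) : Set where
  constructor null
  field
    close : ∀ ε → 0ℚ < ε → Eventually (λ n → ∣ u n - v n ∣ < ε)

open _∼_

-- Weaker than the Cauchy property, but enough for delaying a sequence by a bounded number of terms,
-- which is what changing the first exponent of a truncation does.
Stable : (ℕ → ℚ) → Set
Stable u = (λ n → u (suc n)) ∼ u

½ε+½ε≡ε : ∀ ε → ½ * ε + ½ * ε ≡ ε
½ε+½ε≡ε = solve-∀ ℚ-ring

½-pos : ∀ {ε} → 0ℚ < ε → 0ℚ < ½ * ε
½-pos = *-pos {½} (positive⁻¹ ½)

∼-reflexive : ∀ {u v} → u ≗ v → u ∼ v
∼-reflexive {u} {v} u≗v = null λ ε 0<ε → 0 , λ n _ → subst (λ y → ∣ y ∣ < ε)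
    (sym (trans (cong (_- v n) (u≗v n)) (+-inverseʳ (v n)))) 0<ε

∼-sym : ∀ {u v} → u ∼ v → v ∼ u
∼-sym {u} {v} u∼v = null λ ε 0<ε → let N , h = close u∼v ε 0<ε in
  N , λ n N≤n → subst (_< ε) (∣x-y∣≡∣y-x∣ (u n) (v n)) (h n N≤n)

∼-+ : ∀ {u v u′ v′} → u ∼ v → u′ ∼ v′ → (λ n → u n + u′ n) ∼ (λ n → v n + v′ n)
∼-+ {u} {v} {u′} {v′} u∼v u′∼v′ = null λ ε 0<ε →
  let N , close₁ = close u∼v (½ * ε) (½-pos 0<ε)
      N′ , close₂ = close u′∼v′ (½ * ε) (½-pos 0<ε)
  in  N ℕ.⊔ N′ , λ n h → begin-strict
        ∣ u n + u′ n - (v n + v′ n) ∣      ≡⟨ cong ∣_∣ (lemma (u n) (u′ n) (v n) (v′ n)) ⟩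
        ∣ (u n - v n) + (u′ n - v′ n) ∣    ≤⟨ ∣p+q∣≤∣p∣+∣q∣ (u n - v n) (u′ n - v′ n) ⟩
        ∣ u n - v n ∣ + ∣ u′ n - v′ n ∣    <⟨ +-mono-< (close₁ n (ℕₚ.≤-trans (ℕₚ.m≤m⊔n N N′) h))
            (close₂ n (ℕₚ.≤-trans (ℕₚ.m≤n⊔m N N′) h)) ⟩
        ½ * ε + ½ * ε                      ≡⟨ ½ε+½ε≡ε ε ⟩
        ε                                  ∎
  where
  open ≤-Reasoning
  lemma : ∀ a b x y → a + b - (x + y) ≡ (a - x) + (b - y)
  lemma = solve-∀ ℚ-ring

∼-trans : ∀ {u v w} → u ∼ v → v ∼ w → u ∼ w
∼-trans {u} {v} {w} u∼v v∼w = null λ ε 0<ε →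
  let N , close₁ = close (∼-+ u∼v v∼w) ε 0<ε
  in  N , λ n h → subst (λ y → ∣ y ∣ < ε) (lemma (u n) (v n) (w n)) (close₁ n h)
  where
  lemma : ∀ x y z → x + y - (y + z) ≡ x - z
  lemma = solve-∀ ℚ-ring

∼-* : ∀ x {u v} → u ∼ v → (λ n → x * u n) ∼ (λ n → x * v n)
∼-* x {u} {v} u∼v = null λ ε 0<ε →
  let K = ∣ x ∣ + 1ℚ
      0<K = <-≤-trans 0<1 (subst (_≤ K) (+-identityˡ 1ℚ) (+-monoˡ-≤ 1ℚ (0≤∣p∣ x)))
      N , close₁ = close u∼v (inv K * ε) (*-pos (inv-pos 0<K) 0<ε)
  in  N , λ n h → begin-strict
        ∣ x * u n - x * v n ∣       ≡⟨ cong ∣_∣ (lemma x (u n) (v n)) ⟩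
        ∣ x * (u n - v n) ∣         ≡⟨ ∣p*q∣≡∣p∣*∣q∣ x (u n - v n) ⟩
        ∣ x ∣ * ∣ u n - v n ∣       ≤⟨ *-monoˡ-≤ (0≤∣p∣ (u n - v n)) (subst (_≤ K) (+-identityʳ ∣ x ∣)
            (+-monoʳ-≤ ∣ x ∣ 0≤1)) ⟩
        K * ∣ u n - v n ∣           <⟨ *-monoʳ-< 0<K (close₁ n h) ⟩
        K * (inv K * ε)             ≡⟨ *-assoc K (inv K) ε ⟨
        K * inv K * ε               ≡⟨ cong (_* ε) (x*inv-x≡1 K (≢-sym (<⇒≢ 0<K))) ⟩
        1ℚ * ε                      ≡⟨ *-identityˡ ε ⟩
        ε                           ∎
  where
  open ≤-Reasoning
  lemma : ∀ x y z → x * y - x * z ≡ x * (y - z)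
  lemma = solve-∀ ℚ-ring

∼-suc : ∀ {u v} → u ∼ v → (λ n → u (suc n)) ∼ (λ n → v (suc n))
∼-suc u∼v = null λ ε 0<ε → let N , h = close u∼v ε 0<ε in N , λ n N≤n → h (suc n) (ℕₚ.m≤n⇒m≤1+n N≤n)

∼-pred : ∀ {u v} → (λ n → u (suc n)) ∼ (λ n → v (suc n)) → u ∼ v
∼-pred u∼v = null λ ε 0<ε → let N , h = close u∼v ε 0<ε in
  suc N , λ { (suc n) (ℕ.s≤s N≤n) → h n N≤n }

stable-cong : ∀ {u v} → u ∼ v → Stable u → Stable v
stable-cong u∼v st = ∼-trans (∼-sym (∼-suc u∼v)) (∼-trans st u∼v)

cauchy⇒stable : ∀ {u} → IsCauchy u → Stable u
cauchy⇒stable cau = null λ ε 0<ε → let N , h = cau ε 0<ε in N , λ n N≤n → h (suc n) n (ℕₚ.m≤n⇒m≤1+n N≤n) N≤n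

-- Integer powers

x^ℤ[k+1] : ∀ {x} → x ≢ 0ℚ → ∀ k → x ^ℤ (k ℤ.+ + 1) ≡ x * x ^ℤ k
x^ℤ[k+1] {x} x≢0 (+ n)        = cong (x ^_) (ℕₚ.+-comm n 1)
x^ℤ[k+1] {x} x≢0 -[1+ zero ]  = sym (trans (cong (x *_) (*-identityʳ (inv x))) (x*inv-x≡1 x x≢0))
x^ℤ[k+1] {x} x≢0 -[1+ suc n ] = sym (trans (sym (*-assoc x (inv x) (inv x ^ suc n)))
  (trans (cong (_* inv x ^ suc n) (x*inv-x≡1 x x≢0)) (*-identityˡ (inv x ^ suc n))))

x^ℤk≡x*x^ℤ[k-1] : ∀ {x} → x ≢ 0ℚ → ∀ k → x ^ℤ k ≡ x * x ^ℤ (k ℤ.- + 1)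
x^ℤk≡x*x^ℤ[k-1] {x} x≢0 k = trans (cong (x ^ℤ_) (lemma k)) (x^ℤ[k+1] x≢0 (k ℤ.- + 1))
  where
  lemma : ∀ k → k ≡ k ℤ.- + 1 ℤ.+ + 1
  lemma = ℤ-Solver.solve-∀

x^ℤ[k-1] : ∀ {x} → x ≢ 0ℚ → ∀ k → x ^ℤ (k ℤ.- + 1) ≡ inv x * x ^ℤ k
x^ℤ[k-1] {x} x≢0 k = begin
  x ^ℤ (k ℤ.- + 1)               ≡⟨ *-identityˡ _ ⟨
  1ℚ * x ^ℤ (k ℤ.- + 1)          ≡⟨ cong (_* x ^ℤ (k ℤ.- + 1)) (trans (*-comm (inv x) x) (x*inv-x≡1 x x≢0)) ⟨
  inv x * x * x ^ℤ (k ℤ.- + 1)   ≡⟨ *-assoc (inv x) x (x ^ℤ (k ℤ.- + 1)) ⟩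
  inv x * (x * x ^ℤ (k ℤ.- + 1)) ≡⟨ cong (inv x *_) (x^ℤk≡x*x^ℤ[k-1] x≢0 k) ⟨
  inv x * x ^ℤ k                 ∎
  where open ≡-Reasoning

-- Truncated evaluation

-- `n` terms downwards from exponent `U`, whatever the degree. With a common `U` the truncations of
-- several series can be added term by term.
truncated : ℤ → (ℤ → ℚ) → ℚ → ℕ → ℚ
truncated U e x zero    = 0ℚ
truncated U e x (suc n) = e U * x ^ℤ U + truncated (U ℤ.- + 1) e x n

truncated-cong : ∀ U {e h} x → e ≗ h → truncated U e x ≗ truncated U h x
truncated-cong U x e≗h zero    = refl
truncated-cong U x e≗h (suc n) = cong₂ _+_ (cong (_* x ^ℤ U) (e≗h U)) (truncated-cong (U ℤ.- + 1) x e≗h n)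

truncated-+ : ∀ U e h x n → truncated U (λ j → e j + h j) x n ≡ truncated U e x n + truncated U h x n
truncated-+ U e h x zero    = refl
truncated-+ U e h x (suc n) = trans (cong (λ y → (e U + h U) * x ^ℤ U + y) (truncated-+ (U ℤ.- + 1) e h x n))
  (lemma (e U) (h U) (x ^ℤ U) (truncated (U ℤ.- + 1) e x n) (truncated (U ℤ.- + 1) h x n))
  where
  lemma : ∀ x y z u v → (x + y) * z + (u + v) ≡ (x * z + u) + (y * z + v)
  lemma = solve-∀ ℚ-ring

truncated-- : ∀ U e h x n → truncated U (λ j → e j - h j) x n ≡ truncated U e x n - truncated U h x n
truncated-- U e h x zero    = refl
truncated-- U e h x (suc n) = trans (cong (λ y → (e U - h U) * x ^ℤ U + y) (truncated-- (U ℤ.- + 1) e h x n))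
  (lemma (e U) (h U) (x ^ℤ U) (truncated (U ℤ.- + 1) e x n) (truncated (U ℤ.- + 1) h x n))
  where
  lemma : ∀ x y z u v → (x - y) * z + (u - v) ≡ (x * z + u) - (y * z + v)
  lemma = solve-∀ ℚ-ring

truncated-* : ∀ U a e x n → truncated U (λ j → a * e j) x n ≡ a * truncated U e x n
truncated-* U a e x zero    = sym (*-zeroʳ a)
truncated-* U a e x (suc n) = trans (cong (λ y → a * e U * x ^ℤ U + y) (truncated-* (U ℤ.- + 1) a e x n))
  (lemma a (e U) (x ^ℤ U) (truncated (U ℤ.- + 1) e x n))
  where
  lemma : ∀ a x z u → a * x * z + a * u ≡ a * (x * z + u)
  lemma = solve-∀ ℚ-ring

truncated-shift : ∀ U e {x} → x ≢ 0ℚ → ∀ n → truncated U (λ j → e (j ℤ.- + 1)) x n ≡ x * truncated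
    (U ℤ.- + 1) e x n
truncated-shift U e {x} x≢0 zero    = sym (*-zeroʳ x)
truncated-shift U e {x} x≢0 (suc n) = trans
  (cong₂ (λ y z → e (U ℤ.- + 1) * y + z) (x^ℤk≡x*x^ℤ[k-1] x≢0 U) (truncated-shift (U ℤ.- + 1) e x≢0 n))
  (lemma x (e (U ℤ.- + 1)) (x ^ℤ (U ℤ.- + 1)) (truncated (U ℤ.- + 1 ℤ.- + 1) e x n))
  where
  lemma : ∀ x y z u → y * (x * z) + x * u ≡ x * (y * z + u)
  lemma = solve-∀ ℚ-ring

truncated-drop : ∀ U e x n → e U ≡ 0ℚ → truncated U e x (suc n) ≡ truncated (U ℤ.- + 1) e x n
truncated-drop U e x n eU≡0 = trans (cong (λ y → y * x ^ℤ U + truncated (U ℤ.- + 1) e x n) eU≡0)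
  (trans (cong (_+ truncated (U ℤ.- + 1) e x n) (*-zeroˡ (x ^ℤ U))) (+-identityˡ _))

U-1-i≡U-[1+i] : ∀ U i → U ℤ.- + 1 ℤ.- + i ≡ U ℤ.- + suc i
U-1-i≡U-[1+i] U i = trans (lemma U (+ i)) (cong (λ j → U ℤ.- j) (sym (ℤₚ.pos-+ 1 i)))
  where
  lemma : ∀ U i → U ℤ.- + 1 ℤ.- i ≡ U ℤ.- (+ 1 ℤ.+ i)
  lemma = ℤ-Solver.solve-∀

truncated-suc : ∀ {e U} x → Vanishes e U → ∀ m n →
  truncated (U ℤ.+ + suc m) e x (suc n) ≡ truncated (U ℤ.+ + m) e x n
truncated-suc {e} {U} x v m n = trans (truncated-drop V e x n eV≡0) (cong (λ T → truncated T e x n) V-1≡U+m)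
  where
  V : ℤ
  V = U ℤ.+ + suc m
  V-1≡U+m : V ℤ.- + 1 ≡ U ℤ.+ + m
  V-1≡U+m = trans (cong (λ i → U ℤ.+ i ℤ.- + 1) (ℤₚ.pos-+ 1 m)) (lemma U (+ m))
    where
    lemma : ∀ U m → U ℤ.+ (+ 1 ℤ.+ m) ℤ.- + 1 ≡ U ℤ.+ m
    lemma = ℤ-Solver.solve-∀
  eV≡0 : e V ≡ 0ℚ
  eV≡0 = v V (subst (ℤ._< V) (ℤₚ.+-identityʳ U) (ℤₚ.+-monoʳ-< U (ℤ.+<+ (ℕ.s≤s ℕ.z≤n))))

-- Each raise of the first exponent inserts a zero term in front, so the sequence is delayed by one
-- index.
truncated-raise : ∀ {e U} x → Vanishes e U → Stable (truncated U e x) → ∀ m →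
  truncated (U ℤ.+ + m) e x ∼ truncated U e x
truncated-raise {e} {U} x v st zero    = ∼-reflexive (λ n → cong (λ T → truncated T e x n) (ℤₚ.+-identityʳ U))
truncated-raise {e} {U} x v st (suc m) = ∼-trans
  (∼-pred (∼-trans (∼-reflexive (truncated-suc x v m))
      (∼-sym (stable-cong (∼-sym (truncated-raise x v st m)) st))))
  (truncated-raise x v st m)

truncated-lower : ∀ {e U} x → Vanishes e U → ∀ m → Stable (truncated (U ℤ.+ + m) e x) →
  truncated U e x ∼ truncated (U ℤ.+ + m) e x
truncated-lower {e} {U} x v zero    st = ∼-reflexive (λ n → cong (λ T → truncated T e x n)
    (sym (ℤₚ.+-identityʳ U)))
truncated-lower {e} {U} x v (suc m) st = ∼-trans (truncated-lower x v m (stable-cong (∼-sym later) st)) later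
  where
  later : truncated (U ℤ.+ + m) e x ∼ truncated (U ℤ.+ + suc m) e x
  later = ∼-trans (∼-reflexive (λ n → sym (truncated-suc x v m n))) st

truncated-raise-≤ : ∀ {e U V} x → Vanishes e U → Stable (truncated U e x) → U ℤ.≤ V → truncated V e x ∼
    truncated U e x
truncated-raise-≤ {e} {U} {V} x v st U≤V = subst (λ T → truncated T e x ∼ truncated U e x) (sym (j≡i+∣j-i∣ U≤V))
  (truncated-raise x v st ℤ.∣ V ℤ.- U ∣)

truncated-lower-≤ : ∀ {e U V} x → Vanishes e U → U ℤ.≤ V → Stable (truncated V e x) → truncated U e x ∼
    truncated V e x
truncated-lower-≤ {e} {U} {V} x v U≤V st = subst (λ T → truncated U e x ∼ truncated T e x) (sym (j≡i+∣j-i∣ U≤V))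
  (truncated-lower x v ℤ.∣ V ℤ.- U ∣ (subst (λ T → Stable (truncated T e x)) (j≡i+∣j-i∣ U≤V) st))

-- Multiplication by `z` turns a truncation from `U` into `x` times one from `U - 1`. The latter is
-- the truncation from `U` with one more term, as the room above `V` makes the coefficient at `U`
-- vanish; stability removes the extra term.
truncated-act : ∀ p {e U V} x → x ≢ 0ℚ → Vanishes e V → Stable (truncated U e x) → V ℤ.+ + length p ℤ.≤ U →
  truncated U (act p e) x ∼ λ n → evalᴾ p x * truncated U e x n
truncated-act [] {e} {U} x x≢0 v st le = ∼-reflexive λ n → trans (truncated-0 U n)
    (sym (*-zeroˡ (truncated U e x n)))
  where
  truncated-0 : ∀ U n → truncated U (λ _ → 0ℚ) x n ≡ 0ℚ
  truncated-0 U zero    = refl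
  truncated-0 U (suc n) = trans (cong₂ _+_ (*-zeroˡ (x ^ℤ U)) (truncated-0 (U ℤ.- + 1) n)) (+-identityˡ 0ℚ)
truncated-act (a ∷ p) {e} {U} {V} x x≢0 v st le =
  ∼-trans (∼-reflexive expand) (∼-trans (∼-+ {λ n → a * T n} (∼-reflexive (λ n → refl)) (∼-* x later))
      (∼-reflexive collect))
  where
  T : ℕ → ℚ
  T = truncated U e x
  V+L<U : V ℤ.+ + length p ℤ.< U
  V+L<U = ℤₚ.<-≤-trans (ℤₚ.+-monoʳ-< V (ℤ.+<+ ℕₚ.≤-refl)) le
  expand : ∀ n → truncated U (act (a ∷ p) e) x n ≡ a * T n + x * truncated U (act p e) x (suc n)
  expand n = trans (truncated-+ U (λ k → a * e k) (λ k → act p e (k ℤ.- + 1)) x n)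
      (cong₂ _+_ (truncated-* U a e x n)
    (trans (truncated-shift U (act p e) x≢0 n) (cong (x *_) (sym (truncated-drop U (act p e) x n
      (vanishes-act p v U V+L<U))))))
  later : (λ n → truncated U (act p e) x (suc n)) ∼ λ n → evalᴾ p x * T n
  later = ∼-trans (∼-suc (truncated-act p x x≢0 v st (ℤₚ.<⇒≤ V+L<U))) (∼-* (evalᴾ p x) st)
  collect : ∀ n → a * T n + x * (evalᴾ p x * T n) ≡ (a + x * evalᴾ p x) * T n
  collect n = lemma a x (evalᴾ p x) (T n)
    where
    lemma : ∀ a x e t → a * t + x * (e * t) ≡ (a + x * e) * t
    lemma = solve-∀ ℚ-ring

partialSum≡truncated : ∀ f x n → partialSum f x n ≡ truncated (top f) (coeff f) x n
partialSum≡truncated f x n = general n (top f) (c f) (λ i → sym (from-top f i))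
  where
  general : ∀ n T a → (∀ i → a i ≡ coeff f (T ℤ.- + i)) →
    Σᶠ {n} (λ i → a (toℕ i) * x ^ℤ (T ℤ.- + toℕ i)) ≡ truncated T (coeff f) x n
  general zero    T a a≡ = refl
  general (suc n) T a a≡ = cong₂ _+_
    (cong₂ _*_ (trans (a≡ 0) (cong (coeff f) (ℤₚ.+-identityʳ T))) (cong (x ^ℤ_) (ℤₚ.+-identityʳ T)))
    (trans (sum-cong-≗ {n} (λ i → cong (λ j → a (suc (toℕ i)) * x ^ℤ j) (sym (U-1-i≡U-[1+i] T (toℕ i)))))
      (general n (T ℤ.- + 1) (a ∘ suc) (λ i → trans (a≡ (suc i)) (cong (coeff f) (sym (U-1-i≡U-[1+i] T i))))))

truncated-snoc : ∀ U e x n → truncated U e x (suc n) ≡ truncated U e x n + e (U ℤ.- + n) * x ^ℤ (U ℤ.- + n)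
truncated-snoc U e x zero    = trans (cong (λ T → e T * x ^ℤ T + 0ℚ) (sym (ℤₚ.+-identityʳ U)))
    (+-comm (e (U ℤ.- + 0) * x ^ℤ (U ℤ.- + 0)) 0ℚ)
truncated-snoc U e x (suc n) = trans (cong (λ y → e U * x ^ℤ U + y) (trans (truncated-snoc (U ℤ.- + 1) e x n)
    (cong (λ T → truncated (U ℤ.- + 1) e x n + e T * x ^ℤ T) (U-1-i≡U-[1+i] U n))))
  (sym (+-assoc (e U * x ^ℤ U) (truncated (U ℤ.- + 1) e x n) _))

truncated-δ : ∀ U x → + 0 ℤ.≤ U → truncated U δ x ∼ λ _ → 1ℚ
truncated-δ U x 0≤U = ∼-trans (truncated-raise-≤ x vanishes-δ (stable-cong (∼-sym constant₁)
    (∼-reflexive (λ _ → refl))) 0≤U) constant₁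
  where
  below : ∀ m n → truncated -[1+ m ] δ x n ≡ 0ℚ
  below m zero    = refl
  below m (suc n) = trans (cong₂ _+_ (*-zeroˡ (inv x ^ suc m)) (below (suc (m ℕ.+ 0)) n)) (+-identityˡ 0ℚ)
  constant₁ : truncated (+ 0) δ x ∼ λ _ → 1ℚ
  constant₁ = ∼-pred (∼-reflexive (λ n → trans (cong (λ y → 1ℚ * 1ℚ + y) (below 0 n)) (+-identityʳ 1ℚ)))

δ-stable : ∀ {U} x → + 0 ℤ.≤ U → Stable (truncated U δ x)
δ-stable {U} x 0≤U = stable-cong (∼-sym (truncated-δ U x 0≤U)) (∼-reflexive (λ _ → refl))

evaluate-polynomial : ∀ p {x U} → x ≢ 0ℚ → + 0 ℤ.+ + length p ℤ.≤ U → truncated U (act p δ) x ∼ λ _ → evalᴾ p x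
evaluate-polynomial p {x} {U} x≢0 le = ∼-trans (truncated-act p x x≢0 vanishes-δ (δ-stable x 0≤U) le)
  (∼-trans (∼-* (evalᴾ p x) (truncated-δ U x 0≤U)) (∼-reflexive (λ _ → *-identityʳ (evalᴾ p x))))
  where
  0≤U : + 0 ℤ.≤ U
  0≤U = ℤₚ.≤-trans (ℤₚ.i≤i+j (+ 0) (+ length p)) le

-- Substitution of z^d

partialSum-snoc : ∀ f x n → partialSum f x (suc n) ≡ partialSum f x n + c f n * x ^ℤ (top f ℤ.- + n)
partialSum-snoc f x n = trans (partialSum≡truncated f x (suc n)) (trans (truncated-snoc (top f) (coeff f) x n)
  (cong₂ _+_ (sym (partialSum≡truncated f x n)) (cong (_* x ^ℤ (top f ℤ.- + n)) (from-top f n))))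

c-∘z^-∣ : ∀ f d m → .{{_ : ℕ.NonZero d}} → c (f ∘z^ d) (m ℕ.* d) ≡ c f m
c-∘z^-∣ f d m with d ∣? (m ℕ.* d)
... | yes (divides q eq) = cong (c f) (sym (ℕₚ.*-cancelʳ-≡ m q d eq))
... | no  ∤              = contradiction (divides m refl) ∤

c-∘z^-∤ : ∀ f d n → ¬ d ∣ n → c (f ∘z^ d) n ≡ 0ℚ
c-∘z^-∤ f d n ∤ with d ∣? n
... | yes d∣n = contradiction d∣n ∤
... | no  _   = refl

inv-unique : ∀ {x y} → x * y ≡ 1ℚ → inv x ≡ y
inv-unique {x} {y} xy≡1 = begin
  inv x            ≡⟨ *-identityʳ (inv x) ⟨
  inv x * 1ℚ       ≡⟨ cong (inv x *_) xy≡1 ⟨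
  inv x * (x * y)  ≡⟨ lemma (inv x) x y ⟩
  x * inv x * y    ≡⟨ cong (_* y) (x*inv-x≡1 x x≢0) ⟩
  1ℚ * y           ≡⟨ *-identityˡ y ⟩
  y                ∎
  where
  open ≡-Reasoning
  lemma : ∀ x y z → x * (y * z) ≡ y * x * z
  lemma = solve-∀ ℚ-ring
  x≢0 : x ≢ 0ℚ
  x≢0 x≡0 = 1≢0 (trans (sym xy≡1) (trans (cong (_* y) x≡0) (*-zeroˡ y)))

inv-^ : ∀ {x} → x ≢ 0ℚ → ∀ n → inv (x ^ n) ≡ inv x ^ n
inv-^ {x} x≢0 n = inv-unique {x ^ n} {inv x ^ n} (trans (sym (^-distrib-* x (inv x) n))
    (trans (cong (_^ n) (x*inv-x≡1 x x≢0)) (1^n≡1 n)))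

^ℤ-assoc : ∀ {x} → x ≢ 0ℚ → ∀ d k → (x ^ d) ^ℤ k ≡ x ^ℤ (+ d ℤ.* k)
^ℤ-assoc {x} x≢0 d (+ n)    = trans (^-assocʳ x d n) (cong (x ^ℤ_) (ℤₚ.pos-* d n))
^ℤ-assoc {x} x≢0 d -[1+ n ] = trans (cong (_^ suc n) (inv-^ x≢0 d)) (trans (^-assocʳ (inv x) d (suc n))
  (trans (sym (^ℤ-neg x (d ℕ.* suc n))) (cong (x ^ℤ_) (trans (cong ℤ.-_ (ℤₚ.pos-* d (suc n)))
      (ℤₚ.neg-distribʳ-* (+ d) (+ suc n))))))

-- Here m = ⌈n/d⌉.
partialSum-∘z^ : ∀ f d {x} → .{{_ : ℕ.NonZero d}} → x ≢ 0ℚ → ∀ n →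
  ∃[ m ] partialSum (f ∘z^ d) x n ≡ partialSum f (x ^ d) m × n ℕ.≤ m ℕ.* d
partialSum-∘z^ f d@(suc d-1) {x} x≢0 n =
  let m , r , eq , n+r≡md , _ = invariant n in m , eq , subst (n ℕ.≤_) n+r≡md (ℕₚ.m≤m+n n r)
  where
  invariant : ∀ n → ∃[ m ] ∃[ r ] partialSum (f ∘z^ d) x n ≡ partialSum f (x ^ d) m × n ℕ.+ r ≡ m ℕ.* d × r ℕ.<
      d
  invariant zero = 0 , 0 , refl , refl , ℕ.s≤s ℕ.z≤n
  invariant (suc n) with invariant n
  ... | m , suc r , eq , n+r≡md , r<d = m , r
    , trans (partialSum-snoc (f ∘z^ d) x n) (trans (cong₂ (λ y z → y + z * x ^ℤ (+ d ℤ.* top f ℤ.- + n)) eq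
        (c-∘z^-∤ f d n d∤n))
        (trans (cong (λ y → partialSum f (x ^ d) m + y) (*-zeroˡ (x ^ℤ (+ d ℤ.* top f ℤ.- + n))))
            (+-identityʳ _)))
    , trans (sym (ℕₚ.+-suc n r)) n+r≡md , ℕₚ.<-trans ℕₚ.≤-refl r<d
    where
    d∤n : ¬ d ∣ n
    d∤n d∣n = >⇒∤ r<d (∣m+n∣m⇒∣n (divides m n+r≡md) d∣n)
  ... | m , zero , eq , n+0≡md , _ = suc m , d-1
    , trans (partialSum-snoc (f ∘z^ d) x n) (trans (cong₂ _+_ eq term) (sym (partialSum-snoc f (x ^ d) m)))
    , trans (cong suc (trans (cong (ℕ._+ d-1) n≡md) (ℕₚ.+-comm (m ℕ.* d) d-1))) refl , ℕₚ.≤-refl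
    where
    n≡md : n ≡ m ℕ.* d
    n≡md = trans (sym (ℕₚ.+-identityʳ n)) n+0≡md
    exponent : + d ℤ.* top f ℤ.- + n ≡ + d ℤ.* (top f ℤ.- + m)
    exponent = trans (cong (λ i → + d ℤ.* top f ℤ.- i) (trans (cong +_ n≡md) (ℤₚ.pos-* m d)))
        (lemma (+ d) (top f) (+ m))
      where
      lemma : ∀ d T m → d ℤ.* T ℤ.- m ℤ.* d ≡ d ℤ.* (T ℤ.- m)
      lemma = ℤ-Solver.solve-∀
    term : c (f ∘z^ d) n * x ^ℤ (+ d ℤ.* top f ℤ.- + n) ≡ c f m * (x ^ d) ^ℤ (top f ℤ.- + m)
    term = cong₂ _*_ (trans (cong (c (f ∘z^ d)) n≡md) (c-∘z^-∣ f d m))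
      (trans (cong (x ^ℤ_) exponent) (sym (^ℤ-assoc x≢0 d (top f ℤ.- + m))))

-- The left-hand side runs through the partial sums of `f` at `x ^ d` more slowly, and the Cauchy
-- property makes the index immaterial.
∘z^∼ : ∀ f d {x} → .{{_ : ℕ.NonZero d}} → x ≢ 0ℚ → Converges f (x ^ d) → partialSum (f ∘z^ d) x ∼ partialSum f
    (x ^ d)
∘z^∼ f d {x} x≢0 conv-xᵈ = null λ ε 0<ε →
  let N , h = conv-xᵈ ε 0<ε
  in  N ℕ.* d ℕ.⊔ N , λ n le →
        let m , eq , n≤md = partialSum-∘z^ f d x≢0 n
        in  subst (λ y → ∣ y - partialSum f (x ^ d) n ∣ < ε) (sym eq)
              (h m n (ℕₚ.*-cancelʳ-≤ N m d (ℕₚ.≤-trans (ℕₚ.≤-trans (ℕₚ.m≤m⊔n (N ℕ.* d) N) le) n≤md))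
                     (ℕₚ.≤-trans (ℕₚ.m≤n⊔m (N ℕ.* d) N) le))

evaluate-equation : ∀ d A B C f {x} → .{{_ : ℕ.NonZero d}} → x ≢ 0ℚ →
  ⟦ B ⟧ *ᴸ f ≈ ⟦ A ⟧ *ᴸ (f ∘z^ d) +ᴸ ⟦ C ⟧ → Converges f x → Converges f (x ^ d) →
  (λ n → evalᴾ B x * partialSum f x n) ∼ λ n → evalᴾ A x * partialSum f (x ^ d) n + evalᴾ C x
evaluate-equation d A B C f {x} x≢0 equation conv-x conv-xᵈ =
  ∼-trans (∼-* (evalᴾ B x) (∼-sym fU∼))
      (∼-trans (∼-sym (truncated-act B {coeff f} {U} {top f} x x≢0 (vanishes-top f) stU B≤U))
    (∼-trans (∼-reflexive split)
        (∼-+ (∼-trans (truncated-act A {coeff g} {U} {top g} x x≢0 (vanishes-top g) gstU A≤U)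
            (∼-* (evalᴾ A x) gU∼))
      (evaluate-polynomial C x≢0 C≤U))))
  where
  g : Laurent
  g = f ∘z^ d
  bB bA bC U : ℤ
  bB = top f ℤ.+ + length B
  bA = top g ℤ.+ + length A
  bC = + 0 ℤ.+ + length C
  -- A first exponent above all terms of `B f`, `A g` and `C`, so that the equation can be truncated
  -- as a whole.
  U = bB ℤ.⊔ (bA ℤ.⊔ bC)
  B≤U : bB ℤ.≤ U
  B≤U = ℤₚ.i≤i⊔j bB (bA ℤ.⊔ bC)
  A≤U : bA ℤ.≤ U
  A≤U = ℤₚ.≤-trans (ℤₚ.i≤i⊔j bA bC) (ℤₚ.i≤j⊔i bB (bA ℤ.⊔ bC))
  C≤U : bC ℤ.≤ U
  C≤U = ℤₚ.≤-trans (ℤₚ.i≤j⊔i bA bC) (ℤₚ.i≤j⊔i bB (bA ℤ.⊔ bC))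
  lift : ∀ h {V} → Stable (partialSum h x) → top h ℤ.≤ V → truncated V (coeff h) x ∼ partialSum h x
  lift h {V} st le = ∼-trans (truncated-raise-≤ x (vanishes-top h) (stable-cong same st) le) (∼-sym same)
    where
    same : partialSum h x ∼ truncated (top h) (coeff h) x
    same = ∼-reflexive (partialSum≡truncated h x)
  f-stable : Stable (partialSum f x)
  f-stable = cauchy⇒stable conv-x
  g∼ : partialSum g x ∼ partialSum f (x ^ d)
  g∼ = ∘z^∼ f d x≢0 conv-xᵈ
  g-stable : Stable (partialSum g x)
  g-stable = stable-cong (∼-sym g∼) (cauchy⇒stable conv-xᵈ)
  fU∼ : truncated U (coeff f) x ∼ partialSum f x
  fU∼ = lift f f-stable (ℤₚ.≤-trans (ℤₚ.i≤i+j (top f) (+ length B)) B≤U)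
  gU∼ : truncated U (coeff g) x ∼ partialSum f (x ^ d)
  gU∼ = ∼-trans (lift g g-stable (ℤₚ.≤-trans (ℤₚ.i≤i+j (top g) (+ length A)) A≤U)) g∼
  stU : Stable (truncated U (coeff f) x)
  stU = stable-cong (∼-sym fU∼) f-stable
  gstU : Stable (truncated U (coeff g) x)
  gstU = stable-cong (∼-sym gU∼) (cauchy⇒stable conv-xᵈ)
  split : ∀ n → truncated U (act B (coeff f)) x n ≡ truncated U (act A (coeff g)) x n + truncated U
      (act C δ) x n
  split n = trans (truncated-cong U x (λ k → trans (sym (coeff-⟦⟧*ᴸ B f k)) (trans (equation k)
      (trans (coeff-+ᴸ (⟦ A ⟧ *ᴸ g) ⟦ C ⟧ k) (cong₂ _+_ (coeff-⟦⟧*ᴸ A g k) (coeff-⟦⟧ C k))))) n)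
    (truncated-+ U (act A (coeff g)) (act C δ) x n)

evaluate-leading-polynomial : ∀ p {x D} → x ≢ 0ℚ → Leading (act p δ) D → truncated D (act p δ) x ∼ λ _ →
    evalᴾ p x
evaluate-leading-polynomial p {x} {D} x≢0 (_ , v) = ∼-trans (truncated-lower-≤ x v (ℤₚ.i≤j⊔i (+ length p) D)
    (stable-cong (∼-sym polynomial) (∼-reflexive (λ _ → refl)))) polynomial
  where
  polynomial : truncated (+ length p ℤ.⊔ D) (act p δ) x ∼ λ _ → evalᴾ p x
  polynomial = evaluate-polynomial p x≢0 (ℤₚ.≤-trans (ℤₚ.≤-reflexive (ℤₚ.+-identityˡ (+ length p)))
      (ℤₚ.i≤i⊔j (+ length p) D))

-- The terms of `q f` and of `p` may reach above `N` and cancel there. So both are evaluated from a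
-- higher exponent `U`, and only their difference is lowered to `N`, where size estimates by the
-- leading term apply.
evaluate-form : ∀ f q p {x N} → x ≢ 0ℚ → Converges f x → Vanishes (λ j → act q (coeff f) j - act p δ j) N →
  truncated N (λ j → act q (coeff f) j - act p δ j) x ∼ λ n → evalᴾ q x * partialSum f x n - evalᴾ p x
evaluate-form f q p {x} {N} x≢0 conv v = ∼-trans (truncated-lower-≤ x v N≤U
    (stable-cong (∼-sym value-at-U) (stable-cong form (∼-trans (∼-suc (∼-sym form)) (∼-trans st form)))))
        value-at-U
  where
  bq bp U : ℤ
  bq = top f ℤ.+ + length q
  bp = + 0 ℤ.+ + length p
  U = N ℤ.⊔ (bq ℤ.⊔ bp)
  N≤U : N ℤ.≤ U
  N≤U = ℤₚ.i≤i⊔j N (bq ℤ.⊔ bp)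
  q≤U : bq ℤ.≤ U
  q≤U = ℤₚ.≤-trans (ℤₚ.i≤i⊔j bq bp) (ℤₚ.i≤j⊔i N (bq ℤ.⊔ bp))
  p≤U : bp ℤ.≤ U
  p≤U = ℤₚ.≤-trans (ℤₚ.i≤j⊔i bq bp) (ℤₚ.i≤j⊔i N (bq ℤ.⊔ bp))
  F∼ : truncated U (coeff f) x ∼ partialSum f x
  F∼ = ∼-trans (truncated-raise-≤ x (vanishes-top f) (stable-cong same (cauchy⇒stable conv))
      (ℤₚ.≤-trans (ℤₚ.i≤i+j (top f) (+ length q)) q≤U)) (∼-sym same)
    where
    same : partialSum f x ∼ truncated (top f) (coeff f) x
    same = ∼-reflexive (partialSum≡truncated f x)
  form : (λ n → evalᴾ q x * partialSum f x n + - evalᴾ p x) ∼ λ n → evalᴾ q x * partialSum f x n - evalᴾ p x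
  form = ∼-reflexive (λ _ → refl)
  st : Stable (λ n → evalᴾ q x * partialSum f x n + - evalᴾ p x)
  st = ∼-+ (∼-* (evalᴾ q x) (cauchy⇒stable conv)) (∼-reflexive {λ _ → - evalᴾ p x} (λ _ → refl))
  value-at-U : truncated U (λ j → act q (coeff f) j - act p δ j) x ∼ λ n → evalᴾ q x * partialSum f x n - evalᴾ
      p x
  value-at-U = ∼-trans (∼-reflexive (truncated-- U (act q (coeff f)) (act p δ) x))
    (∼-+ (∼-trans (truncated-act q {coeff f} {U} {top f} x x≢0 (vanishes-top f)
        (stable-cong (∼-sym F∼) (cauchy⇒stable conv)) q≤U)
            (∼-* (evalᴾ q x) F∼))
         (∼-neg (evaluate-polynomial p x≢0 p≤U)))
    where
    ∼-neg : ∀ {u v} → u ∼ v → (λ n → - u n) ∼ λ n → - v n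
    ∼-neg {u} {v} u∼v = ∼-trans (∼-reflexive (λ n → lemma (u n)))
        (∼-trans (∼-* (- 1ℚ) u∼v) (∼-reflexive (λ n → sym (lemma (v n)))))
      where
      lemma : ∀ x → - x ≡ - 1ℚ * x
      lemma = solve-∀ ℚ-ring

-- Growth of coefficients

-- Domination by a geometric sequence, a form of convergence for `∣ x ∣ > r` that is preserved by
-- `act` and by differences.
Growth : ℚ → (ℤ → ℚ) → Set
Growth r e = ∃[ K ] 0ℚ ≤ K × (∀ j → ∣ e j ∣ ≤ K * r ^ℤ (ℤ.- j))

^ℤ-pos : ∀ {x} → 0ℚ < x → ∀ k → 0ℚ < x ^ℤ k
^ℤ-pos 0<x (+ n)    = ^-pos 0<x n
^ℤ-pos 0<x -[1+ n ] = ^-pos (inv-pos 0<x) (suc n)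

^ℤ-inverse : ∀ {x} → x ≢ 0ℚ → ∀ k → x ^ℤ k * x ^ℤ (ℤ.- k) ≡ 1ℚ
^ℤ-inverse {x} x≢0 (+ n)    = trans (cong (x ^ n *_) (^ℤ-neg x n)) (trans (*-comm (x ^ n) (inv x ^ n))
    (inv^*^ x≢0 n))
^ℤ-inverse {x} x≢0 -[1+ n ] = inv^*^ x≢0 (suc n)

∣inv∣ : ∀ {x} → x ≢ 0ℚ → ∣ inv x ∣ ≡ inv ∣ x ∣
∣inv∣ {x} x≢0 = sym (inv-unique {∣ x ∣} {∣ inv x ∣} (trans (sym (∣p*q∣≡∣p∣*∣q∣ x (inv x)))
    (cong ∣_∣ (x*inv-x≡1 x x≢0))))

∣^ℤ∣ : ∀ {x} → x ≢ 0ℚ → ∀ k → ∣ x ^ℤ k ∣ ≡ ∣ x ∣ ^ℤ k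
∣^ℤ∣ {x} x≢0 (+ n)    = ∣x^n∣≡∣x∣^n x n
∣^ℤ∣ {x} x≢0 -[1+ n ] = trans (∣x^n∣≡∣x∣^n (inv x) (suc n)) (cong (_^ suc n) (∣inv∣ x≢0))

growth-δ : ∀ {r} → 0ℚ < r → Growth r δ
growth-δ {r} 0<r = 1ℚ , 0≤1 , bound
  where
  0≤ : ∀ k → 0ℚ ≤ 1ℚ * r ^ℤ k
  0≤ k = *-nonNeg 0≤1 (<⇒≤ (^ℤ-pos 0<r k))
  bound : ∀ j → ∣ δ j ∣ ≤ 1ℚ * r ^ℤ (ℤ.- j)
  bound (+ zero)  = ≤-refl
  bound (+ suc j) = 0≤ (ℤ.- + suc j)
  bound -[1+ j ]  = 0≤ (ℤ.- -[1+ j ])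

growth-act : ∀ p {r e} → 0ℚ < r → Growth r e → Growth r (act p e)
growth-act []      {r} 0<r (K , 0≤K , e≤) = 0ℚ , ≤-refl , λ j → ≤-reflexive (sym (*-zeroˡ (r ^ℤ (ℤ.- j))))
growth-act (a ∷ p) {r} {e} 0<r g@(K , 0≤K , e≤) =
  let K′ , 0≤K′ , act≤ = growth-act p 0<r g
  in  ∣ a ∣ * K + K′ * r , +-nonNeg (*-nonNeg (0≤∣p∣ a) 0≤K) (*-nonNeg 0≤K′ (<⇒≤ 0<r)) , λ j → begin
        ∣ a * e j + act p e (j ℤ.- + 1) ∣
          ≤⟨ ∣p+q∣≤∣p∣+∣q∣ (a * e j) (act p e (j ℤ.- + 1)) ⟩
        ∣ a * e j ∣ + ∣ act p e (j ℤ.- + 1) ∣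
          ≤⟨ +-mono-≤ (≤-trans (≤-reflexive (∣p*q∣≡∣p∣*∣q∣ a (e j))) (*-monoʳ-≤ (0≤∣p∣ a) (e≤ j)))
              (act≤ (j ℤ.- + 1)) ⟩
        ∣ a ∣ * (K * r ^ℤ (ℤ.- j)) + K′ * r ^ℤ (ℤ.- (j ℤ.- + 1))
          ≡⟨ cong (λ y → ∣ a ∣ * (K * r ^ℤ (ℤ.- j)) + K′ * y) (trans (cong (r ^ℤ_) (lemma j))
              (x^ℤ[k+1] (≢-sym (<⇒≢ 0<r)) (ℤ.- j))) ⟩
        ∣ a ∣ * (K * r ^ℤ (ℤ.- j)) + K′ * (r * r ^ℤ (ℤ.- j))
          ≡⟨ regroup ∣ a ∣ K K′ r (r ^ℤ (ℤ.- j)) ⟩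
        (∣ a ∣ * K + K′ * r) * r ^ℤ (ℤ.- j) ∎
  where
  open ≤-Reasoning
  lemma : ∀ j → ℤ.- (j ℤ.- + 1) ≡ ℤ.- j ℤ.+ + 1
  lemma = ℤ-Solver.solve-∀
  regroup : ∀ a K K′ r z → a * (K * z) + K′ * (r * z) ≡ (a * K + K′ * r) * z
  regroup = solve-∀ ℚ-ring

growth-- : ∀ {r e h} → Growth r e → Growth r h → Growth r (λ j → e j - h j)
growth-- {r} {e} {h} (K , 0≤K , e≤) (K′ , 0≤K′ , h≤) = K + K′ , +-nonNeg 0≤K 0≤K′ , λ j →
  ≤-trans (∣p-q∣≤∣p∣+∣q∣ (e j) (h j)) (≤-trans (+-mono-≤ (e≤ j) (h≤ j))
      (≤-reflexive (sym (*-distribʳ-+ (r ^ℤ (ℤ.- j)) K K′))))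

eventually-bounded⇒bounded : ∀ (u : ℕ → ℚ) {B} → Eventually (λ n → ∣ u n ∣ ≤ fromℕ B) → ∃[ K ]
    (∀ n → ∣ u n ∣ ≤ fromℕ K)
eventually-bounded⇒bounded u {B} (N , u≤B) = B ℕ.⊔ B′ , bound
  where
  B′ : ℕ
  B′ = proj₁ (upperBound (λ n → proj₁ (archimedean ∣ u n ∣)) N)
  bound : ∀ n → ∣ u n ∣ ≤ fromℕ (B ℕ.⊔ B′)
  bound n with n ℕₚ.<? N
  ... | yes n<N = ≤-trans (proj₂ (archimedean ∣ u n ∣)) (fromℕ-mono-≤
    (ℕₚ.≤-trans (proj₂ (upperBound (λ n → proj₁ (archimedean ∣ u n ∣)) N) n n<N) (ℕₚ.m≤n⊔m B B′)))
  ... | no  n≮N = ≤-trans (u≤B n (ℕₚ.≮⇒≥ n≮N)) (fromℕ-mono-≤ (ℕₚ.m≤m⊔n B B′))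

-- Because the terms of a convergent series are bounded.
growth-coeff : ∀ f {x} → x ≢ 0ℚ → Converges f x → Growth ∣ x ∣ (coeff f)
growth-coeff f {x} x≢0 conv = fromℕ B + fromℕ B , +-nonNeg (0≤fromℕ B) (0≤fromℕ B) , λ j → bound j
    (difference (top f) j)
  where
  bounded : ∃[ K ] (∀ n → ∣ partialSum f x n ∣ ≤ fromℕ K)
  bounded = eventually-bounded⇒bounded (partialSum f x) (proj₂ (cauchy⇒bounded (value f x conv)))
  B : ℕ
  B = proj₁ bounded
  0<∣x∣ : 0ℚ < ∣ x ∣
  0<∣x∣ = x≢0⇒0<∣x∣ x≢0
  open ≤-Reasoning
  term : ∀ i → ∣ c f i * x ^ℤ (top f ℤ.- + i) ∣ ≤ fromℕ B + fromℕ B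
  term i = begin
    ∣ c f i * x ^ℤ (top f ℤ.- + i) ∣              ≡⟨ cong ∣_∣
        (trans (lemma (partialSum f x i) (c f i * x ^ℤ (top f ℤ.- + i)))
                                                       (cong (_- partialSum f x i)
                                                           (sym (partialSum-snoc f x i)))) ⟩
    ∣ partialSum f x (suc i) - partialSum f x i ∣ ≤⟨ ∣p-q∣≤∣p∣+∣q∣ (partialSum f x (suc i)) (partialSum f x i) ⟩
    ∣ partialSum f x (suc i) ∣ + ∣ partialSum f x i ∣ ≤⟨ +-mono-≤ (proj₂ bounded (suc i)) (proj₂ bounded i) ⟩
    fromℕ B + fromℕ B                             ∎
    where
    lemma : ∀ s t → t ≡ s + t - s
    lemma = solve-∀ ℚ-ring
  bound : ∀ j → (top f ℤ.< j) ⊎ (∃[ i ] j ≡ top f ℤ.- + i × top f ℤ.- j ≡ + i) →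
    ∣ coeff f j ∣ ≤ (fromℕ B + fromℕ B) * ∣ x ∣ ^ℤ (ℤ.- j)
  bound j (inj₁ T<j) = subst (λ y → ∣ y ∣ ≤ (fromℕ B + fromℕ B) * ∣ x ∣ ^ℤ (ℤ.- j)) (sym (vanishes-top f j T<j))
    (*-nonNeg (+-nonNeg (0≤fromℕ B) (0≤fromℕ B)) (<⇒≤ (^ℤ-pos 0<∣x∣ (ℤ.- j))))
  bound j (inj₂ (i , refl , _)) = begin
    ∣ coeff f j ∣                                          ≡⟨ cong ∣_∣ (from-top f i) ⟩
    ∣ c f i ∣                                              ≡⟨ *-identityʳ ∣ c f i ∣ ⟨
    ∣ c f i ∣ * 1ℚ                                         ≡⟨ cong (∣ c f i ∣ *_)
        (^ℤ-inverse (≢-sym (<⇒≢ 0<∣x∣)) j) ⟨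
    ∣ c f i ∣ * (∣ x ∣ ^ℤ j * ∣ x ∣ ^ℤ (ℤ.- j))            ≡⟨ *-assoc ∣ c f i ∣ (∣ x ∣ ^ℤ j) (∣ x ∣ ^ℤ (ℤ.- j))
        ⟨
    ∣ c f i ∣ * ∣ x ∣ ^ℤ j * ∣ x ∣ ^ℤ (ℤ.- j)              ≡⟨ cong (λ y → ∣ c f i ∣ * y * ∣ x ∣ ^ℤ (ℤ.- j))
        (∣^ℤ∣ x≢0 j) ⟨
    ∣ c f i ∣ * ∣ x ^ℤ j ∣ * ∣ x ∣ ^ℤ (ℤ.- j)              ≡⟨ cong (_* ∣ x ∣ ^ℤ (ℤ.- j))
        (∣p*q∣≡∣p∣*∣q∣ (c f i) (x ^ℤ j)) ⟨
    ∣ c f i * x ^ℤ j ∣ * ∣ x ∣ ^ℤ (ℤ.- j)                  ≤⟨ *-monoˡ-≤ (<⇒≤ (^ℤ-pos 0<∣x∣ (ℤ.- j))) (term i) ⟩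
    (fromℕ B + fromℕ B) * ∣ x ∣ ^ℤ (ℤ.- j)                 ∎

-- Series dominated by their leading term

horner : (ℕ → ℚ) → ℚ → ℕ → ℚ
horner a w zero    = 0ℚ
horner a w (suc n) = a 0 + w * horner (a ∘ suc) w n

horner-cong : ∀ {a b} w → a ≗ b → horner a w ≗ horner b w
horner-cong w a≗b zero    = refl
horner-cong w a≗b (suc n) = cong₂ (λ y z → y + w * z) (a≗b 0) (horner-cong w (a≗b ∘ suc) n)

truncated≡horner : ∀ U e {x} → x ≢ 0ℚ → ∀ n → truncated U e x n ≡ x ^ℤ U * horner (from U e) (inv x) n
truncated≡horner U e {x} x≢0 zero    = sym (*-zeroʳ (x ^ℤ U))
truncated≡horner U e {x} x≢0 (suc n) = begin
  e U * x ^ℤ U + truncated (U ℤ.- + 1) e x n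
    ≡⟨ cong₂ (λ y z → y * x ^ℤ U + z) (cong e (sym (ℤₚ.+-identityʳ U))) (truncated≡horner (U ℤ.- + 1) e x≢0 n) ⟩
  from U e 0 * x ^ℤ U + x ^ℤ (U ℤ.- + 1) * horner (from (U ℤ.- + 1) e) (inv x) n
    ≡⟨ cong₂ (λ y z → from U e 0 * x ^ℤ U + y * z) (x^ℤ[k-1] x≢0 U)
        (horner-cong (inv x) (λ i → cong e (U-1-i≡U-[1+i] U i)) n) ⟩
  from U e 0 * x ^ℤ U + inv x * x ^ℤ U * horner (from U e ∘ suc) (inv x) n
    ≡⟨ lemma (from U e 0) (x ^ℤ U) (inv x) (horner (from U e ∘ suc) (inv x) n) ⟩
  x ^ℤ U * (from U e 0 + inv x * horner (from U e ∘ suc) (inv x) n) ∎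
  where
  open ≡-Reasoning
  lemma : ∀ a z w h → a * z + w * z * h ≡ z * (a + w * h)
  lemma = solve-∀ ℚ-ring

-- A geometric series of ratio at most one half. The induction varies `K` along with `a`, as the
-- tail is dominated with the constant `K * r`.
horner-bound : ∀ {a K r w} → 0ℚ ≤ K → 0ℚ ≤ r → (∀ i → ∣ a i ∣ ≤ K * r ^ i) → 2ℚ * (r * ∣ w ∣) ≤ 1ℚ →
  ∀ n → ∣ horner a w n ∣ ≤ 2ℚ * K
horner-bound {K = K} 0≤K 0≤r a≤ small zero = *-nonNeg (≤-trans 0≤1 1≤2) 0≤K
horner-bound {a} {K} {r} {w} 0≤K 0≤r a≤ small (suc n) = begin
  ∣ a 0 + w * horner (a ∘ suc) w n ∣         ≤⟨ ∣p+q∣≤∣p∣+∣q∣ (a 0) (w * horner (a ∘ suc) w n) ⟩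
  ∣ a 0 ∣ + ∣ w * horner (a ∘ suc) w n ∣     ≡⟨ cong (λ y → ∣ a 0 ∣ + y)
      (∣p*q∣≡∣p∣*∣q∣ w (horner (a ∘ suc) w n)) ⟩
  ∣ a 0 ∣ + ∣ w ∣ * ∣ horner (a ∘ suc) w n ∣ ≤⟨ +-mono-≤ (≤-trans (a≤ 0) (≤-reflexive (*-identityʳ K)))
      (*-monoʳ-≤ (0≤∣p∣ w)
                                                 (horner-bound (*-nonNeg 0≤K 0≤r) 0≤r
                                                     (λ i → ≤-trans (a≤ (suc i))
                                                         (≤-reflexive (sym (*-assoc K r (r ^ i))))) small n)) ⟩
  K + ∣ w ∣ * (2ℚ * (K * r))                 ≡⟨ lemma K ∣ w ∣ r ⟩
  K + K * (2ℚ * (r * ∣ w ∣))                 ≤⟨ +-monoʳ-≤ K (*-monoʳ-≤ 0≤K small) ⟩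
  K + K * 1ℚ                                 ≡⟨ lemma′ K ⟩
  2ℚ * K                                     ∎
  where
  open ≤-Reasoning
  lemma : ∀ K w r → K + w * ((1ℚ + 1ℚ) * (K * r)) ≡ K + K * ((1ℚ + 1ℚ) * (r * w))
  lemma = solve-∀ ℚ-ring
  lemma′ : ∀ K → K + K * 1ℚ ≡ (1ℚ + 1ℚ) * K
  lemma′ = solve-∀ ℚ-ring

fromℕ-≤-+ : ∀ {m n x} → fromℕ (m ℕ.+ n) ≤ x → fromℕ m ≤ x × fromℕ n ≤ x
fromℕ-≤-+ {m} {n} h = ≤-trans (fromℕ-mono-≤ (ℕₚ.m≤m+n m n)) h , ≤-trans (fromℕ-mono-≤ (ℕₚ.m≤n+m n m)) h

-- For large `x` the first term dominates, uniformly in the number of terms. A factor `∣ x ∣` takes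
-- the place of constants in both bounds.
horner-size : ∀ a {K r} → 0ℚ ≤ K → 0ℚ ≤ r → a 0 ≢ 0ℚ → (∀ i → ∣ a i ∣ ≤ K * r ^ i) →
  ∃[ X ] (∀ x → x ≢ 0ℚ → fromℕ X ≤ ∣ x ∣ → ∀ n →
    ∣ horner a (inv x) (suc n) ∣ ≤ ∣ x ∣ × 1ℚ ≤ ∣ x ∣ * ∣ horner a (inv x) (suc n) ∣)
horner-size a {K} {r} 0≤K 0≤r a₀≢0 a≤ =
  -- `n₁` makes the geometric ratio at most one half and `n₂` makes the tail at most half of
  -- `∣ a 0 ∣`; `n₃` and `n₄` let `∣ x ∣` absorb the constants of the upper and the lower bound.
  let n₁ , ≤n₁ = archimedean (2ℚ * r)
      n₂ , ≤n₂ = archimedean (2ℚ * (2ℚ * (K * r)) * inv α)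
      n₃ , ≤n₃ = archimedean (2ℚ * α)
      n₄ , ≤n₄ = archimedean (2ℚ * inv α)
  in  n₁ ℕ.+ (n₂ ℕ.+ (n₃ ℕ.+ n₄)) , λ x x≢0 large n →
        let l₁ , h₁ = fromℕ-≤-+ {n₁} {n₂ ℕ.+ (n₃ ℕ.+ n₄)} large
            l₂ , h₂ = fromℕ-≤-+ {n₂} {n₃ ℕ.+ n₄} h₁
            l₃ , l₄ = fromℕ-≤-+ {n₃} {n₄} h₂
        in  size x x≢0 (≤-trans ≤n₁ l₁) (≤-trans ≤n₂ l₂) (≤-trans ≤n₃ l₃) (≤-trans ≤n₄ l₄) n
  where
  open ≤-Reasoning
  0≤2 : 0ℚ ≤ 2ℚ
  0≤2 = ≤-trans 0≤1 1≤2
  α : ℚ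
  α = ∣ a 0 ∣
  0<α : 0ℚ < α
  0<α = x≢0⇒0<∣x∣ a₀≢0
  αinvα≡1 : α * inv α ≡ 1ℚ
  αinvα≡1 = x*inv-x≡1 α (≢-sym (<⇒≢ 0<α))
  size : ∀ x → x ≢ 0ℚ → 2ℚ * r ≤ ∣ x ∣ → 2ℚ * (2ℚ * (K * r)) * inv α ≤ ∣ x ∣ → 2ℚ * α ≤ ∣ x ∣ → 2ℚ * inv α
      ≤ ∣ x ∣ → ∀ n →
    ∣ horner a (inv x) (suc n) ∣ ≤ ∣ x ∣ × 1ℚ ≤ ∣ x ∣ * ∣ horner a (inv x) (suc n) ∣
  size x x≢0 2r≤ξ 4Kr/α≤ξ 2α≤ξ 2/α≤ξ n = upper , lower
    where
    ξ ω h R : ℚ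
    ξ = ∣ x ∣
    ω = ∣ inv x ∣
    h = horner a (inv x) (suc n)
    R = ∣ inv x * horner (a ∘ suc) (inv x) n ∣
    0≤ω : 0ℚ ≤ ω
    0≤ω = 0≤∣p∣ (inv x)
    ξω≡1 : ξ * ω ≡ 1ℚ
    ξω≡1 = trans (sym (∣p*q∣≡∣p∣*∣q∣ x (inv x))) (cong ∣_∣ (x*inv-x≡1 x x≢0))
    small : 2ℚ * (r * ω) ≤ 1ℚ
    small = subst₂ _≤_ (*-assoc 2ℚ r ω) ξω≡1 (*-monoˡ-≤ 0≤ω 2r≤ξ)
    4Kr≤αξ : 2ℚ * (2ℚ * (K * r)) ≤ α * ξ
    4Kr≤αξ = subst (_≤ α * ξ) (cancel (2ℚ * (2ℚ * (K * r)))) (*-monoʳ-≤ (<⇒≤ 0<α) 4Kr/α≤ξ)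
      where
      cancel : ∀ y → α * (y * inv α) ≡ y
      cancel y = trans (lemma α y (inv α)) (trans (cong (_* y) αinvα≡1) (*-identityˡ y))
        where
        lemma : ∀ a y z → a * (y * z) ≡ a * z * y
        lemma = solve-∀ ℚ-ring
    2R≤α : 2ℚ * R ≤ α
    2R≤α = begin
      2ℚ * R                                        ≡⟨ cong (2ℚ *_)
          (∣p*q∣≡∣p∣*∣q∣ (inv x) (horner (a ∘ suc) (inv x) n)) ⟩
      2ℚ * (ω * ∣ horner (a ∘ suc) (inv x) n ∣)     ≤⟨ *-monoʳ-≤ 0≤2 (*-monoʳ-≤ 0≤ω
                                                         (horner-bound (*-nonNeg 0≤K 0≤r) 0≤r
                                                             (λ i → ≤-trans (a≤ (suc i))
                                                                 (≤-reflexive (sym (*-assoc K r (r ^ i)))))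
                                                                     small n)) ⟩
      2ℚ * (ω * (2ℚ * (K * r)))                     ≡⟨ lemma ω (2ℚ * (K * r)) ⟩
      2ℚ * (2ℚ * (K * r)) * ω                       ≤⟨ *-monoˡ-≤ 0≤ω 4Kr≤αξ ⟩
      α * ξ * ω                                     ≡⟨ trans (*-assoc α ξ ω)
          (trans (cong (α *_) ξω≡1) (*-identityʳ α)) ⟩
      α                                             ∎
      where
      lemma : ∀ w y → (1ℚ + 1ℚ) * (w * y) ≡ (1ℚ + 1ℚ) * y * w
      lemma = solve-∀ ℚ-ring
    0≤R : 0ℚ ≤ R
    0≤R = 0≤∣p∣ (inv x * horner (a ∘ suc) (inv x) n)
    R≤α : R ≤ α
    R≤α = ≤-trans (subst (_≤ 2ℚ * R) (*-identityˡ R) (*-monoˡ-≤ 0≤R 1≤2)) 2R≤α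
    double : ∀ y → y + y ≡ (1ℚ + 1ℚ) * y
    double = solve-∀ ℚ-ring
    upper : ∣ h ∣ ≤ ξ
    upper = begin
      ∣ h ∣        ≤⟨ ∣p+q∣≤∣p∣+∣q∣ (a 0) (inv x * horner (a ∘ suc) (inv x) n) ⟩
      α + R        ≤⟨ +-monoʳ-≤ α R≤α ⟩
      α + α        ≡⟨ double α ⟩
      2ℚ * α       ≤⟨ 2α≤ξ ⟩
      ξ            ∎
    α≤2h : α ≤ 2ℚ * ∣ h ∣
    α≤2h = 0≤y-x⇒x≤y (subst (0ℚ ≤_) (lemma α ∣ h ∣ R) (+-nonNeg (+-nonNeg (x≤y⇒0≤y-x α≤h+R) (x≤y⇒0≤y-x α≤h+R))
        (x≤y⇒0≤y-x 2R≤α)))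
      where
      lemma : ∀ α h R → (h + R - α) + (h + R - α) + (α - (1ℚ + 1ℚ) * R) ≡ (1ℚ + 1ℚ) * h - α
      lemma = solve-∀ ℚ-ring
      α≤h+R : α ≤ ∣ h ∣ + R
      α≤h+R = ≤-trans (∣x∣≤∣y∣+∣x-y∣ (a 0) h) (≤-reflexive (cong (λ y → ∣ h ∣ + y)
        (trans (∣x-y∣≡∣y-x∣ (a 0) h) (cong ∣_∣ (minus (a 0) (inv x * horner (a ∘ suc) (inv x) n))))))
        where
        minus : ∀ x y → x + y - x ≡ y
        minus = solve-∀ ℚ-ring
    lower : 1ℚ ≤ ξ * ∣ h ∣
    lower = *-cancelˡ-≤ {2ℚ} (<-≤-trans 0<1 1≤2) (begin
      2ℚ * 1ℚ               ≡⟨ cong (2ℚ *_) αinvα≡1 ⟨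
      2ℚ * (α * inv α)      ≡⟨ lemma α (inv α) ⟩
      α * (2ℚ * inv α)      ≤⟨ *-monoʳ-≤ (<⇒≤ 0<α) 2/α≤ξ ⟩
      α * ξ                 ≤⟨ *-monoˡ-≤ (0≤∣p∣ x) α≤2h ⟩
      2ℚ * ∣ h ∣ * ξ        ≡⟨ lemma′ ∣ h ∣ ξ ⟩
      2ℚ * (ξ * ∣ h ∣)      ∎)
      where
      lemma : ∀ a b → (1ℚ + 1ℚ) * (a * b) ≡ a * ((1ℚ + 1ℚ) * b)
      lemma = solve-∀ ℚ-ring
      lemma′ : ∀ a b → (1ℚ + 1ℚ) * a * b ≡ (1ℚ + 1ℚ) * (b * a)
      lemma′ = solve-∀ ℚ-ring

truncated-size : ∀ {e U r} → 0ℚ < r → Leading e U → Growth r e →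
  ∃[ X ] (∀ x → x ≢ 0ℚ → fromℕ X ≤ ∣ x ∣ → ∀ n →
    ∣ truncated U e x (suc n) ∣ ≤ ∣ x ∣ * ∣ x ∣ ^ℤ U × ∣ x ∣ ^ℤ U ≤ ∣ x ∣ * ∣ truncated U e x (suc n) ∣)
truncated-size {e} {U} {r} 0<r (eU≢0 , _) (K , 0≤K , e≤) =
  let X , size = horner-size (from U e) {K * r ^ℤ (ℤ.- U)} {r} (*-nonNeg 0≤K (<⇒≤ (^ℤ-pos 0<r (ℤ.- U))))
        (<⇒≤ 0<r)
                   (λ eq → eU≢0 (trans (cong e (sym (ℤₚ.+-identityʳ U))) eq))
                   (λ i → ≤-trans (e≤ (U ℤ.- + i))
                       (≤-reflexive (trans (cong (K *_) (power i)) (sym (*-assoc K (r ^ℤ (ℤ.- U)) (r ^ i))))))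
  in  X , λ x x≢0 large n →
        let upper , lower = size x x≢0 large n
            ζ = ∣ x ∣ ^ℤ U
            0≤ζ = <⇒≤ (^ℤ-pos (x≢0⇒0<∣x∣ x≢0) U)
            H = ∣ horner (from U e) (inv x) (suc n) ∣
            eq : ∣ truncated U e x (suc n) ∣ ≡ ζ * H
            eq = trans (cong ∣_∣ (truncated≡horner U e x≢0 (suc n))) (trans (∣p*q∣≡∣p∣*∣q∣ (x ^ℤ U) _)
                (cong (_* H) (∣^ℤ∣ x≢0 U)))
        in  subst (_≤ ∣ x ∣ * ζ) (sym eq) (≤-trans (*-monoʳ-≤ 0≤ζ upper) (≤-reflexive (*-comm ζ ∣ x ∣)))
          , subst (λ y → ζ ≤ ∣ x ∣ * y) (sym eq) (≤-trans (≤-reflexive (sym (*-identityʳ ζ)))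
              (≤-trans (*-monoʳ-≤ 0≤ζ lower) (≤-reflexive (lemma ζ ∣ x ∣ H))))
  where
  lemma : ∀ z x h → z * (x * h) ≡ x * (z * h)
  lemma = solve-∀ ℚ-ring
  power : ∀ i → r ^ℤ (ℤ.- (U ℤ.- + i)) ≡ r ^ℤ (ℤ.- U) * r ^ i
  power zero    = trans (cong (λ j → r ^ℤ (ℤ.- j)) (ℤₚ.+-identityʳ U)) (sym (*-identityʳ (r ^ℤ (ℤ.- U))))
  power (suc i) = trans (cong (r ^ℤ_) (trans (cong (λ j → ℤ.- (U ℤ.- j)) (ℤₚ.pos-+ 1 i)) (exponent U (+ i))))
    (trans (x^ℤ[k+1] (≢-sym (<⇒≢ 0<r)) (ℤ.- (U ℤ.- + i))) (trans (cong (r *_) (power i))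
        (lemma r (r ^ℤ (ℤ.- U)) (r ^ i))))
    where
    exponent : ∀ U i → ℤ.- (U ℤ.- (+ 1 ℤ.+ i)) ≡ ℤ.- (U ℤ.- i) ℤ.+ + 1
    exponent = ℤ-Solver.solve-∀

-- As in `limit-≥`, the bound starts at index 1: a truncation without terms is 0 and would violate
-- the lower bounds.
limit-≤ : ∀ {u v B} → u ∼ (λ _ → v) → (∀ n → ∣ u (suc n) ∣ ≤ B) → ∣ v ∣ ≤ B
limit-≤ {u} {v} {B} u∼v u≤B = ≮⇒≥ λ B<v →
  let ε = ∣ v ∣ - B
      N , near = close u∼v ε (subst (_< ε) (+-inverseʳ B) (+-monoˡ-< (- B) B<v))
  in  <-irrefl refl (begin-strict
        ∣ v ∣                             ≤⟨ ∣x∣≤∣y∣+∣x-y∣ v (u (suc N)) ⟩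
        ∣ u (suc N) ∣ + ∣ v - u (suc N) ∣ ≡⟨ cong (λ y → ∣ u (suc N) ∣ + y) (∣x-y∣≡∣y-x∣ v (u (suc N))) ⟩
        ∣ u (suc N) ∣ + ∣ u (suc N) - v ∣ <⟨ +-mono-≤-< (u≤B N) (near (suc N) (ℕₚ.n≤1+n N)) ⟩
        B + (∣ v ∣ - B)                   ≡⟨ lemma B ∣ v ∣ ⟩
        ∣ v ∣                             ∎)
  where
  open ≤-Reasoning
  lemma : ∀ x y → x + (y - x) ≡ y
  lemma = solve-∀ ℚ-ring

limit-≥ : ∀ {u v B} → u ∼ (λ _ → v) → (∀ n → B ≤ ∣ u (suc n) ∣) → B ≤ ∣ v ∣
limit-≥ {u} {v} {B} u∼v B≤u = ≮⇒≥ λ v<B →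
  let ε = B - ∣ v ∣
      N , near = close u∼v ε (subst (_< ε) (+-inverseʳ ∣ v ∣) (+-monoˡ-< (- ∣ v ∣) v<B))
  in  <-irrefl refl (begin-strict
        B                           ≤⟨ B≤u N ⟩
        ∣ u (suc N) ∣               ≤⟨ ∣x∣≤∣y∣+∣x-y∣ (u (suc N)) v ⟩
        ∣ v ∣ + ∣ u (suc N) - v ∣   <⟨ +-monoʳ-< ∣ v ∣ (near (suc N) (ℕₚ.n≤1+n N)) ⟩
        ∣ v ∣ + (B - ∣ v ∣)         ≡⟨ lemma ∣ v ∣ B ⟩
        B                           ∎)
  where
  open ≤-Reasoning
  lemma : ∀ x y → x + (y - x) ≡ y
  lemma = solve-∀ ℚ-ring

polynomial-size : ∀ p {D} → Leading (act p δ) (+ D) →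
  ∃[ X ] (∀ x → x ≢ 0ℚ → fromℕ X ≤ ∣ x ∣ → ∣ evalᴾ p x ∣ ≤ ∣ x ∣ * ∣ x ∣ ^ D × ∣ x ∣ ^ D ≤ ∣ x ∣ * ∣ evalᴾ p x
      ∣)
polynomial-size p {D} lead =
  let X , size = truncated-size {act p δ} {+ D} 0<1 lead (growth-act p 0<1 (growth-δ 0<1))
  in  X , λ x x≢0 large →
        let u∼p = evaluate-leading-polynomial p x≢0 lead
        in  limit-≤ u∼p (λ n → proj₁ (size x x≢0 large n))
          , ≤-trans (limit-≥ {v = x * evalᴾ p x} (∼-* x u∼p) (λ n → ≤-trans (proj₂ (size x x≢0 large n))
              (≤-reflexive (sym (∣p*q∣≡∣p∣*∣q∣ x (truncated (+ D) (act p δ) x (suc n)))))))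
              (≤-reflexive (∣p*q∣≡∣p∣*∣q∣ x (evalᴾ p x)))

-- Transport of an approximation along the iterated functional equation.

unsigned : ∀ Q P → ∃[ P′ ] (∀ x → ∣ fromℕ ℤ.∣ Q ∣ * x - fromℤ P′ ∣ ≡ ∣ fromℤ Q * x - fromℤ P ∣)
unsigned (+ n)      P = P , λ x → refl
unsigned -[1+ n ]   P = ℤ.- P , λ x → trans (cong (λ y → ∣ fromℕ (suc n) * x - y ∣) (fromℤ-neg P))
  (trans (sym (∣-p∣≡∣p∣ (fromℕ (suc n) * x - - fromℤ P))) (cong ∣_∣ (trans (lemma (fromℕ (suc n)) x (fromℤ P))
    (cong (λ y → y * x - fromℤ P) (sym (fromℤ-neg (+ suc n)))))))
  where
  lemma : ∀ q x p → - (q * x - - p) ≡ - q * x - p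
  lemma = solve-∀ ℚ-ring

-- Transported from F₁ to F₀ = (A F₁ + C) / B, the error T becomes ALT.
goodApproximation : ∀ {F₀ F₁ T : ℕ → ℚ} {ξ q p : ℚ} {m D D′ L : ℕ} (A B C y z : ℤ) → 2ℚ ≤ ξ →
  A ≢ ℤ.0ℤ → B ≢ ℤ.0ℤ → ∣ fromℤ A ∣ ≤ ξ ^ m → ∣ fromℤ B ∣ ≤ ξ ^ m →
  (λ n → fromℤ B * F₀ n) ∼ (λ n → fromℤ A * F₁ n + fromℤ C) →
  1 ℕ.≤ L → fromℕ L ≤ ξ → fromℕ L * q ≡ fromℤ y → fromℕ L * p ≡ fromℤ z →
  ∣ q ∣ ≤ ξ * ξ ^ D → ξ ^ D ≤ ξ * ∣ q ∣ →
  T ∼ (λ n → q * F₁ n - p) →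
  (∀ n → ξ ^ D′ * ∣ T (suc n) ∣ ≤ ξ) → (∀ n → 1ℚ ≤ ξ * (ξ ^ D′ * ∣ T (suc n) ∣)) →
  GoodApproximation F₀ ξ (3 ℕ.+ m) D D′
goodApproximation {F₀} {F₁} {T} {ξ} {q} {p} {m} {D} {D′} {L} A B C y z 2≤ξ A≢0 B≢0 A≤ B≤ F₀∼F₁ 1≤L L≤ξ Lq≡y Lp≡z
    q≤ ≤q T∼ T≤ ≤T = record
  { P         = proj₁ (unsigned Q₀ P₀)
  ; Q         = ℤ.∣ Q₀ ∣
  ; 1≤Q       = fromℕ-cancel-≤ (≤-trans 1≤∣Q₀∣ (≤-reflexive (fromℤ-∣∣ Q₀)))
  ; Q-lower   = begin
      ξ ^ D                        ≤⟨ ≤q ⟩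
      ξ * ∣ q ∣                    ≤⟨ *-monoʳ-≤ 0≤ξ ∣q∣≤∣Q₀∣ ⟩
      ξ * ∣ fromℤ Q₀ ∣             ≤⟨ *-monoˡ-≤ (0≤∣p∣ (fromℤ Q₀)) (≤-trans (≤-reflexive (sym (*-identityʳ ξ)))
          (^-monoʳ-≤ 1≤ξ {1} {3 ℕ.+ m} (ℕ.s≤s ℕ.z≤n))) ⟩
      ξ ^ (3 ℕ.+ m) * ∣ fromℤ Q₀ ∣ ≡⟨ cong (ξ ^ (3 ℕ.+ m) *_) (fromℤ-∣∣ Q₀) ⟩
      ξ ^ (3 ℕ.+ m) * fromℕ ℤ.∣ Q₀ ∣ ∎
  ; Q-upper   = begin
      fromℕ ℤ.∣ Q₀ ∣               ≡⟨ fromℤ-∣∣ Q₀ ⟨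
      ∣ fromℤ Q₀ ∣                 ≡⟨ cong ∣_∣ Q₀≡ ⟩
      ∣ fromℤ B * (fromℕ L * q) ∣  ≡⟨ trans (∣p*q∣≡∣p∣*∣q∣ (fromℤ B) (fromℕ L * q)) (cong (∣ fromℤ B ∣ *_) ∣Lq∣)
          ⟩
      ∣ fromℤ B ∣ * (fromℕ L * ∣ q ∣)
                                   ≤⟨ *-mono-≤ (0≤∣p∣ (fromℤ B)) (*-nonNeg 0≤ξ (*-nonNeg 0≤ξ (^-nonNeg 0≤ξ D)))
                                       B≤
                                        (*-mono-≤ (0≤fromℕ L) (*-nonNeg 0≤ξ (^-nonNeg 0≤ξ D)) L≤ξ q≤) ⟩
      ξ ^ m * (ξ * (ξ * ξ ^ D))    ≡⟨ ^-homo-* ξ m (2 ℕ.+ D) ⟨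
      ξ ^ (m ℕ.+ (2 ℕ.+ D))        ≤⟨ ^-monoʳ-≤ 1≤ξ (ℕₚ.≤-trans (ℕₚ.n≤1+n _) (ℕₚ.≤-reflexive (rearrange m D))) ⟩
      ξ ^ (D ℕ.+ (3 ℕ.+ m))        ∎
  ; err-lower = Eventually-map (λ { {n} (near , 0<n) → subst (λ y → 1ℚ ≤ ξ ^ (D′ ℕ.+ (3 ℕ.+ m)) * y)
      (sym (proj₂ (unsigned Q₀ P₀) (F₀ n))) (lower n 0<n near) }) eventually
  ; err-upper = Eventually-map (λ { {n} (near , 0<n) → subst (λ y → ξ ^ D′ * y ≤ ξ ^ (3 ℕ.+ m))
      (sym (proj₂ (unsigned Q₀ P₀) (F₀ n))) (upper n 0<n near) }) eventually
  }
  where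
  open ≤-Reasoning
  1≤ξ : 1ℚ ≤ ξ
  1≤ξ = ≤-trans 1≤2 2≤ξ
  0<ξ : 0ℚ < ξ
  0<ξ = <-≤-trans 0<1 1≤ξ
  0≤ξ : 0ℚ ≤ ξ
  0≤ξ = <⇒≤ 0<ξ
  Q₀ P₀ : ℤ
  -- `Q₀ F₀ - P₀` is `L` times `q (B F₀) - A p - C q`; replacing `B F₀` by `A F₁ + C` leaves
  -- `A L (q F₁ - p)`.
  Q₀ = B ℤ.* y
  P₀ = A ℤ.* z ℤ.+ C ℤ.* y
  rearrange : ∀ m D → suc (m ℕ.+ (2 ℕ.+ D)) ≡ D ℕ.+ (3 ℕ.+ m)
  rearrange = ℕ-Solver.solve-∀
  Q₀≡ : fromℤ Q₀ ≡ fromℤ B * (fromℕ L * q)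
  Q₀≡ = trans (fromℤ-* B y) (cong (fromℤ B *_) (sym Lq≡y))
  P₀≡ : fromℤ P₀ ≡ fromℤ A * (fromℕ L * p) + fromℤ C * (fromℕ L * q)
  P₀≡ = trans (fromℤ-+ (A ℤ.* z) (C ℤ.* y)) (cong₂ _+_ (trans (fromℤ-* A z) (cong (fromℤ A *_) (sym Lp≡z)))
    (trans (fromℤ-* C y) (cong (fromℤ C *_) (sym Lq≡y))))
  ∣Lq∣ : ∣ fromℕ L * q ∣ ≡ fromℕ L * ∣ q ∣
  ∣Lq∣ = trans (∣p*q∣≡∣p∣*∣q∣ (fromℕ L) q) (cong (_* ∣ q ∣) (0≤p⇒∣p∣≡p (0≤fromℕ L)))
  1≤L′ : 1ℚ ≤ fromℕ L
  1≤L′ = fromℕ-mono-≤ 1≤L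
  ∣q∣≤∣Q₀∣ : ∣ q ∣ ≤ ∣ fromℤ Q₀ ∣
  ∣q∣≤∣Q₀∣ = begin
    ∣ q ∣                            ≡⟨ trans (*-identityˡ (1ℚ * ∣ q ∣)) (*-identityˡ ∣ q ∣) ⟨
    1ℚ * (1ℚ * ∣ q ∣)                ≤⟨ *-mono-≤ 0≤1 (*-nonNeg (0≤fromℕ L) (0≤∣p∣ q)) (i≢0⇒1≤∣i∣ B≢0)
        (*-monoˡ-≤ (0≤∣p∣ q) 1≤L′) ⟩
    ∣ fromℤ B ∣ * (fromℕ L * ∣ q ∣)  ≡⟨ cong (∣ fromℤ B ∣ *_) ∣Lq∣ ⟨
    ∣ fromℤ B ∣ * ∣ fromℕ L * q ∣    ≡⟨ trans (cong ∣_∣ Q₀≡) (∣p*q∣≡∣p∣*∣q∣ (fromℤ B) (fromℕ L * q)) ⟨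
    ∣ fromℤ Q₀ ∣                     ∎
  0<∣q∣ : 0ℚ < ∣ q ∣
  0<∣q∣ = ≰⇒> λ q≤0 → <-irrefl refl
      (<-≤-trans (^-pos 0<ξ D) (≤-trans ≤q (≤-trans (*-monoʳ-≤ 0≤ξ q≤0) (≤-reflexive (*-zeroʳ ξ)))))
  Q₀≢0 : Q₀ ≢ ℤ.0ℤ
  Q₀≢0 Q₀≡0 = <-irrefl refl (<-≤-trans 0<∣q∣ (subst (λ i → ∣ q ∣ ≤ ∣ fromℤ i ∣) Q₀≡0 ∣q∣≤∣Q₀∣))
  1≤∣Q₀∣ : 1ℚ ≤ ∣ fromℤ Q₀ ∣
  1≤∣Q₀∣ = i≢0⇒1≤∣i∣ Q₀≢0
  κ : ℚ
  κ = fromℤ A * fromℕ L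
  ∣κ∣ : ∣ κ ∣ ≡ ∣ fromℤ A ∣ * fromℕ L
  ∣κ∣ = trans (∣p*q∣≡∣p∣*∣q∣ (fromℤ A) (fromℕ L)) (cong (∣ fromℤ A ∣ *_) (0≤p⇒∣p∣≡p {fromℕ L} (0≤fromℕ L)))
  1≤∣κ∣ : 1ℚ ≤ ∣ κ ∣
  1≤∣κ∣ = subst (1ℚ ≤_) (sym ∣κ∣) (*-mono-≤ {1ℚ} {∣ fromℤ A ∣} {1ℚ} {fromℕ L} 0≤1 (0≤fromℕ L)
      (i≢0⇒1≤∣i∣ A≢0) 1≤L′)
  ∣κ∣≤ : ∣ κ ∣ ≤ ξ ^ m * ξ
  ∣κ∣≤ = subst (_≤ ξ ^ m * ξ) (sym ∣κ∣) (*-mono-≤ (0≤∣p∣ (fromℤ A)) 0≤ξ A≤ L≤ξ)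
  G Z : ℕ → ℚ
  G n = fromℤ Q₀ * F₀ n - fromℤ P₀
  Z n = ξ ^ D′ * (κ * T n)
  G∼κT : G ∼ λ n → κ * T n
  G∼κT = ∼-trans (∼-reflexive (λ n → trans (cong₂ (λ a b → a * F₀ n - b) Q₀≡ P₀≡)
             (expand (fromℤ A) (fromℤ B) (fromℤ C) (fromℕ L) q p (F₀ n))))
    (∼-trans (∼-+ (∼-* (fromℕ L * q) F₀∼F₁)
        (∼-reflexive {λ _ → - (fromℤ A * (fromℕ L * p) + fromℤ C * (fromℕ L * q))} (λ _ → refl)))
    (∼-trans (∼-reflexive (λ n → collect (fromℤ A) (fromℤ C) (fromℕ L) q p (F₁ n))) (∼-* κ (∼-sym T∼))))
    where
    expand : ∀ A B C L q p x → B * (L * q) * x - (A * (L * p) + C * (L * q)) ≡ L * q * (B * x) + -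
        (A * (L * p) + C * (L * q))
    expand = solve-∀ ℚ-ring
    collect : ∀ A C L q p x → L * q * (A * x + C) + - (A * (L * p) + C * (L * q)) ≡ A * L * (q * x - p)
    collect = solve-∀ ℚ-ring
  ε : ℚ
  -- Since `ξ * ε ≡ ½`, passing from `Z` to `ξ ^ D′ * G` costs half of the lower bound, and a
  -- further factor `ξ` makes up for it.
  ε = ½ * inv ξ
  0<ε : 0ℚ < ε
  0<ε = ½-pos (inv-pos 0<ξ)
  ξε≡½ : ξ * ε ≡ ½
  ξε≡½ = trans (lemma ξ (inv ξ)) (trans (cong (½ *_) (x*inv-x≡1 ξ (≢-sym (<⇒≢ 0<ξ)))) (*-identityʳ ½))
    where
    lemma : ∀ x y → x * (½ * y) ≡ ½ * (x * y)
    lemma = solve-∀ ℚ-ring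
  eventually : Eventually (λ n → ∣ ξ ^ D′ * G n - Z n ∣ < ε × 0 ℕ.< n)
  eventually = Eventually-∧ (close (∼-* (ξ ^ D′) G∼κT) ε 0<ε) (1 , λ n 1≤n → 1≤n)
  ∣Z∣ : ∀ n → ∣ Z n ∣ ≡ ∣ κ ∣ * (ξ ^ D′ * ∣ T n ∣)
  ∣Z∣ n = trans (∣p*q∣≡∣p∣*∣q∣ (ξ ^ D′) (κ * T n))
      (trans (cong₂ _*_ (0≤p⇒∣p∣≡p (^-nonNeg 0≤ξ D′)) (∣p*q∣≡∣p∣*∣q∣ κ (T n)))
    (lemma (ξ ^ D′) ∣ κ ∣ ∣ T n ∣))
    where
    lemma : ∀ x y z → x * (y * z) ≡ y * (x * z)
    lemma = solve-∀ ℚ-ring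
  ∣ξG∣ : ∀ n → ∣ ξ ^ D′ * G n ∣ ≡ ξ ^ D′ * ∣ G n ∣
  ∣ξG∣ n = trans (∣p*q∣≡∣p∣*∣q∣ (ξ ^ D′) (G n)) (cong (_* ∣ G n ∣) (0≤p⇒∣p∣≡p (^-nonNeg 0≤ξ D′)))
  upper : ∀ n → 0 ℕ.< n → ∣ ξ ^ D′ * G n - Z n ∣ < ε → ξ ^ D′ * ∣ G n ∣ ≤ ξ ^ (3 ℕ.+ m)
  -- The 3 in `3 + m` comes from here: besides `ξ ^ m` for `A`, one factor `ξ` pays for `L`, one for
  -- the bound on `T`, and one for the 2 that arises from adding the limit error.
  upper (suc n) _ near = begin
    ξ ^ D′ * ∣ G (suc n) ∣                                    ≡⟨ ∣ξG∣ (suc n) ⟨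
    ∣ ξ ^ D′ * G (suc n) ∣                                    ≤⟨ ∣x∣≤∣y∣+∣x-y∣ (ξ ^ D′ * G (suc n))
        (Z (suc n)) ⟩
    ∣ Z (suc n) ∣ + ∣ ξ ^ D′ * G (suc n) - Z (suc n) ∣        ≤⟨ +-mono-≤ Z≤ (≤-trans (<⇒≤ near) ε≤) ⟩
    ξ ^ m * ξ * ξ + ξ ^ m * ξ * ξ                             ≡⟨ lemma (ξ ^ m) ξ ⟩
    2ℚ * (ξ * (ξ * ξ ^ m))                                    ≤⟨ *-monoˡ-≤ (^-nonNeg 0≤ξ (2 ℕ.+ m)) 2≤ξ ⟩
    ξ ^ (3 ℕ.+ m)                                             ∎
    where
    lemma : ∀ a x → a * x * x + a * x * x ≡ (1ℚ + 1ℚ) * (x * (x * a))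
    lemma = solve-∀ ℚ-ring
    Z≤ : ∣ Z (suc n) ∣ ≤ ξ ^ m * ξ * ξ
    Z≤ = ≤-trans (≤-reflexive (∣Z∣ (suc n))) (*-mono-≤ (0≤∣p∣ κ) 0≤ξ ∣κ∣≤ (T≤ n))
    1≤ξ^mξξ : 1ℚ ≤ ξ ^ m * ξ * ξ
    1≤ξ^mξξ = ≤-trans (1≤^ 1≤ξ (2 ℕ.+ m)) (≤-reflexive (commute ξ (ξ ^ m)))
      where
      commute : ∀ x a → x * (x * a) ≡ a * x * x
      commute = solve-∀ ℚ-ring
    ε≤ : ε ≤ ξ ^ m * ξ * ξ
    ε≤ = ≤-trans (*-cancelˡ-≤ {ξ} 0<ξ (begin
      ξ * ε    ≡⟨ ξε≡½ ⟩
      ½        ≤⟨ *≤* (ℤ.+≤+ (ℕ.s≤s ℕ.z≤n)) ⟩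
      1ℚ       ≤⟨ 1≤ξ ⟩
      ξ        ≡⟨ *-identityʳ ξ ⟨
      ξ * 1ℚ   ∎)) 1≤ξ^mξξ
  lower : ∀ n → 0 ℕ.< n → ∣ ξ ^ D′ * G n - Z n ∣ < ε → 1ℚ ≤ ξ ^ (D′ ℕ.+ (3 ℕ.+ m)) * ∣ G n ∣
  lower (suc n) _ near = begin
    1ℚ                                          ≤⟨ 0≤y-x⇒x≤y
        (subst (0ℚ ≤_) (lemma g) (+-nonNeg (x≤y⇒0≤y-x 1≤g+½) (x≤y⇒0≤y-x 1≤g+½))) ⟩
    2ℚ * g                                      ≤⟨ *-monoˡ-≤
        (*-nonNeg 0≤ξ (*-nonNeg (^-nonNeg 0≤ξ D′) (0≤∣p∣ (G (suc n))))) 2≤ξ ⟩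
    ξ * g                                       ≡⟨ lemma′ ξ (ξ ^ D′) ∣ G (suc n) ∣ ⟩
    ξ ^ D′ * ξ ^ 2 * ∣ G (suc n) ∣              ≡⟨ cong (_* ∣ G (suc n) ∣) (^-homo-* ξ D′ 2) ⟨
    ξ ^ (D′ ℕ.+ 2) * ∣ G (suc n) ∣              ≤⟨ *-monoˡ-≤ (0≤∣p∣ (G (suc n)))
        (^-monoʳ-≤ 1≤ξ (ℕₚ.+-monoʳ-≤ D′ (ℕ.s≤s (ℕ.s≤s ℕ.z≤n)))) ⟩
    ξ ^ (D′ ℕ.+ (3 ℕ.+ m)) * ∣ G (suc n) ∣      ∎
    where
    g : ℚ
    g = ξ * (ξ ^ D′ * ∣ G (suc n) ∣)
    lemma : ∀ g → (g + ½ - 1ℚ) + (g + ½ - 1ℚ) ≡ (1ℚ + 1ℚ) * g - 1ℚ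
    lemma = solve-∀ ℚ-ring
    lemma′ : ∀ x a h → x * (x * (a * h)) ≡ a * (x * (x * 1ℚ)) * h
    lemma′ = solve-∀ ℚ-ring
    swap : ∀ x k a → k * (x * a) ≡ x * (k * a)
    swap = solve-∀ ℚ-ring
    1≤g+½ : 1ℚ ≤ g + ½
    1≤g+½ = begin
      1ℚ                                        ≤⟨ *-mono-≤ 0≤1 (≤-trans 0≤1 (≤T n)) 1≤∣κ∣ (≤T n) ⟩
      ∣ κ ∣ * (ξ * (ξ ^ D′ * ∣ T (suc n) ∣))    ≡⟨ swap ξ ∣ κ ∣ (ξ ^ D′ * ∣ T (suc n) ∣) ⟩
      ξ * (∣ κ ∣ * (ξ ^ D′ * ∣ T (suc n) ∣))    ≡⟨ cong (ξ *_) (∣Z∣ (suc n)) ⟨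
      ξ * ∣ Z (suc n) ∣                         ≤⟨ *-monoʳ-≤ 0≤ξ (∣x∣≤∣y∣+∣x-y∣ (Z (suc n))
          (ξ ^ D′ * G (suc n))) ⟩
      ξ * (∣ ξ ^ D′ * G (suc n) ∣ + ∣ Z (suc n) - ξ ^ D′ * G (suc n) ∣)
                                                ≤⟨ *-monoʳ-≤ 0≤ξ (+-monoʳ-≤ ∣ ξ ^ D′ * G (suc n) ∣
                                                    (≤-trans (≤-reflexive (∣x-y∣≡∣y-x∣ (Z (suc n))
                                                        (ξ ^ D′ * G (suc n)))) (<⇒≤ near))) ⟩
      ξ * (∣ ξ ^ D′ * G (suc n) ∣ + ε)          ≡⟨ *-distribˡ-+ ξ ∣ ξ ^ D′ * G (suc n) ∣ ε ⟩
      ξ * ∣ ξ ^ D′ * G (suc n) ∣ + ξ * ε        ≡⟨ cong₂ _+_ (cong (ξ *_) (∣ξG∣ (suc n))) ξε≡½ ⟩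
      g + ½                                     ∎

-- Denominators and sizes of polynomial values.

Clears : ℕ → Poly → Set
Clears L p = ∀ i → ∃[ j ] fromℕ L * evalᴾ p (fromℤ i) ≡ fromℤ j

clears-*ˡ : ∀ K {L p} → Clears L p → Clears (K ℕ.* L) p
clears-*ˡ K {L} {p} clears i = let j , eq = clears i in + K ℤ.* j ,
  trans (cong (_* evalᴾ p (fromℤ i)) (fromℕ-* K L)) (trans (*-assoc (fromℕ K) (fromℕ L) (evalᴾ p (fromℤ i)))
    (trans (cong (fromℕ K *_) eq) (sym (fromℤ-* (+ K) j))))

clears-*ʳ : ∀ {L p} K → Clears L p → Clears (L ℕ.* K) p
clears-*ʳ {L} {p} K clears = subst (λ n → Clears n p) (ℕₚ.*-comm K L) (clears-*ˡ K {L} {p} clears)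

clearDenominators : ∀ p → ∃[ L ] 1 ℕ.≤ L × Clears L p
clearDenominators []      = 1 , ℕₚ.≤-refl , λ i → + 0 , refl
clearDenominators (a ∷ p) =
  let L , 1≤L , clears = clearDenominators p
      e = ↧ₙ a
  in  e ℕ.* L , ℕₚ.*-mono-≤ {1} {e} {1} {L} (ℕ.s≤s ℕ.z≤n) 1≤L , λ i →
        let j , eq = clears i
            x = fromℤ i
        in  ↥ a ℤ.* + L ℤ.+ + e ℤ.* (i ℤ.* j) , (begin
          fromℕ (e ℕ.* L) * (a + x * evalᴾ p x)
            ≡⟨ cong (_* (a + x * evalᴾ p x)) (fromℕ-* e L) ⟩
          fromℕ e * fromℕ L * (a + x * evalᴾ p x)
            ≡⟨ lemma (fromℕ e) (fromℕ L) a x (evalᴾ p x) ⟩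
          a * fromℕ e * fromℕ L + fromℕ e * (x * (fromℕ L * evalᴾ p x))
            ≡⟨ cong₂ (λ y z → y * fromℕ L + fromℕ e * (x * z)) (sym (↥p≡p*↧p a)) eq ⟩
          fromℤ (↥ a) * fromℕ L + fromℕ e * (x * fromℤ j)
            ≡⟨ cong₂ _+_ (sym (fromℤ-* (↥ a) (+ L))) (trans (cong (fromℕ e *_) (sym (fromℤ-* i j)))
                (sym (fromℤ-* (+ e) (i ℤ.* j)))) ⟩
          fromℤ (↥ a ℤ.* + L) + fromℤ (+ e ℤ.* (i ℤ.* j))
            ≡⟨ fromℤ-+ (↥ a ℤ.* + L) (+ e ℤ.* (i ℤ.* j)) ⟨
          fromℤ (↥ a ℤ.* + L ℤ.+ + e ℤ.* (i ℤ.* j)) ∎)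
  where
  open ≡-Reasoning
  lemma : ∀ e L a x v → e * L * (a + x * v) ≡ a * e * L + e * (x * (L * v))
  lemma = solve-∀ ℚ-ring

n≤2^n : ∀ n → fromℕ n ≤ 2ℚ ^ n
n≤2^n n = ≤-trans (fromℕ-mono-≤ (ℕₚ.<⇒≤ (n<m^n {2} ℕₚ.≤-refl n))) (≤-reflexive (fromℕ-^ 2 n))

0≤2 : 0ℚ ≤ 2ℚ
0≤2 = ≤-trans 0≤1 1≤2

-- A bound without a constant factor, so that nothing accumulates in products over many levels.
-- Coefficients are absorbed by `n ≤ 2 ^ n ≤ ∣ x ∣ ^ n`.
eval-bound : ∀ p → ∃[ m ] (∀ x → 2ℚ ≤ ∣ x ∣ → ∣ evalᴾ p x ∣ ≤ ∣ x ∣ ^ m)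
eval-bound []      = 0 , λ x _ → 0≤1
eval-bound (a ∷ p) =
  let m , p≤ = eval-bound p
      n , a≤n = archimedean ∣ a ∣
  in  suc (suc m ℕ.+ n) , λ x 2≤ξ →
        let ξ = ∣ x ∣
            1≤ξ = ≤-trans 1≤2 2≤ξ
            0≤ξ = 0≤∣p∣ x
            a≤ξ = ≤-trans a≤n (≤-trans (n≤2^n n) (≤-trans (^-monoˡ-≤ 0≤2 2≤ξ n)
                (^-monoʳ-≤ 1≤ξ (ℕₚ.m≤n+m n (suc m)))))
            xp≤ξ = ≤-trans (≤-reflexive (∣p*q∣≡∣p∣*∣q∣ x (evalᴾ p x))) (≤-trans (*-monoʳ-≤ 0≤ξ (p≤ x 2≤ξ))
                (^-monoʳ-≤ 1≤ξ (ℕₚ.m≤m+n (suc m) n)))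
        in  ≤-trans (∣p+q∣≤∣p∣+∣q∣ a (x * evalᴾ p x)) (≤-trans (+-mono-≤ a≤ξ xp≤ξ)
              (≤-trans (≤-reflexive (lemma (ξ ^ (suc m ℕ.+ n)))) (*-monoˡ-≤ (^-nonNeg 0≤ξ (suc m ℕ.+ n)) 2≤ξ)))
  where
  lemma : ∀ y → y + y ≡ (1ℚ + 1ℚ) * y
  lemma = solve-∀ ℚ-ring

scaled-eval-bound : ∀ L p → ∃[ m ] (∀ x → 2ℚ ≤ ∣ x ∣ → ∣ fromℕ L * evalᴾ p x ∣ ≤ ∣ x ∣ ^ m)
scaled-eval-bound L p =
  let m , p≤ = eval-bound p
  in  L ℕ.+ m , λ x 2≤ξ → ≤-trans (≤-reflexive (trans (∣p*q∣≡∣p∣*∣q∣ (fromℕ L) (evalᴾ p x))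
        (cong (_* ∣ evalᴾ p x ∣) (0≤p⇒∣p∣≡p (0≤fromℕ L)))))
        (≤-trans (*-mono-≤ (0≤fromℕ L) (^-nonNeg (0≤∣p∣ x) m) (≤-trans (n≤2^n L) (^-monoˡ-≤ 0≤2 2≤ξ L))
            (p≤ x 2≤ξ))
          (≤-reflexive (sym (^-homo-* ∣ x ∣ L m))))

-- Good approximations to `f(b)` from the convergents of `f`.

module _ (d : ℕ) (2≤d : 2 ℕ.≤ d) (A B C : Poly) (f : Laurent)
  (equation : ⟦ B ⟧ *ᴸ f ≈ ⟦ A ⟧ *ᴸ (f ∘z^ d) +ᴸ ⟦ C ⟧)
  (cf : ContinuedFraction f) (b : ℤ) (2≤b : 2 ℕ.≤ ℤ.∣ b ∣)
  (ρ : ℝ) (radius : IsRadius f ρ) (inside : ρ <ᴿ ∣ fromℤ b ∣)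
  (nonzero : ∀ t → evalᴾ A (fromℤ b ^ (d ℕ.^ t)) * evalᴾ B (fromℤ b ^ (d ℕ.^ t)) ≢ 0ℚ) where

  private
    open Convergents cf
    open ContinuedFraction cf using (numer; denom)

    instance
      d-nonZero : ℕ.NonZero d
      d-nonZero = ℕ.>-nonZero (ℕₚ.≤-trans (ℕ.s≤s ℕ.z≤n) 2≤d)

    β : ℕ
    β = ℤ.∣ b ∣

    x : ℕ → ℚ
    x t = fromℤ b ^ (d ℕ.^ t)

    ξ : ℕ → ℚ
    ξ t = ∣ x t ∣

    ξ≡ : ∀ t → ξ t ≡ fromℕ (β ℕ.^ (d ℕ.^ t))
    ξ≡ t = trans (∣x^n∣≡∣x∣^n (fromℤ b) (d ℕ.^ t)) (trans (cong (_^ (d ℕ.^ t)) (fromℤ-∣∣ b))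
        (sym (fromℕ-^ β (d ℕ.^ t))))

    t<ξ : ∀ t → fromℕ t < ξ t
    t<ξ t = subst (fromℕ t <_) (sym (ξ≡ t)) (fromℕ-mono-< (ℕₚ.<-trans (n<m^n 2≤d t) (n<m^n 2≤b (d ℕ.^ t))))

    b≤ξ : ∀ t → ∣ fromℤ b ∣ ≤ ξ t
    b≤ξ t = subst₂ _≤_ (trans (cong fromℕ (ℕₚ.^-identityʳ β)) (sym (fromℤ-∣∣ b))) (sym (ξ≡ t))
      (fromℕ-mono-≤ (ℕₚ.^-monoʳ-≤ β {{ℕ.>-nonZero (ℕₚ.≤-trans (ℕ.s≤s ℕ.z≤n) 2≤b)}}
          (ℕₚ.≤-trans (ℕ.s≤s ℕ.z≤n) (n<m^n 2≤d t))))

    2≤ξ : ∀ t → 2ℚ ≤ ξ t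
    2≤ξ t = ≤-trans (≤-trans (fromℕ-mono-≤ {2} {β} 2≤b) (≤-reflexive (sym (fromℤ-∣∣ b)))) (b≤ξ t)

    1≤ξ : ∀ t → 1ℚ ≤ ξ t
    1≤ξ t = ≤-trans 1≤2 (2≤ξ t)

    x≢0 : ∀ t → x t ≢ 0ℚ
    x≢0 t = 0<∣x∣⇒x≢0 (<-≤-trans 0<1 (1≤ξ t))

    x-suc : ∀ t → x t ^ d ≡ x (suc t)
    x-suc t = trans (^-assocʳ (fromℤ b) (d ℕ.^ t) d) (cong (fromℤ b ^_) (ℕₚ.*-comm (d ℕ.^ t) d))

    x-integer : ∀ t → fromℤ (b ℤ.^ (d ℕ.^ t)) ≡ x t
    x-integer t = fromℤ-^ b (d ℕ.^ t)

    x₀ : x 0 ≡ fromℤ b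
    x₀ = *-identityʳ (fromℤ b)

    converges-x : ∀ t → Converges f (x t)
    converges-x t = let s , s<b , ρ≤s = inside in converges radius (x t) (s , <-≤-trans s<b (b≤ξ t) , ρ≤s)

    F : ℕ → ℕ → ℚ
    F t = partialSum f (x t)

    step-equation : ∀ t → (λ n → evalᴾ B (x t) * F t n) ∼ λ n → evalᴾ A (x t) * F (suc t) n + evalᴾ C (x t)
    step-equation t = subst (λ y → (λ n → evalᴾ B (x t) * F t n) ∼ λ n → evalᴾ A (x t) * partialSum f y n +
        evalᴾ C (x t)) (x-suc t)
      (evaluate-equation d A B C f (x≢0 t) equation (converges-x t) (subst (Converges f) (sym (x-suc t))
          (converges-x (suc t))))

    L : ℕ
    L = proj₁ (clearDenominators A) ℕ.* (proj₁ (clearDenominators B) ℕ.* proj₁ (clearDenominators C))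

    1≤L : 1 ℕ.≤ L
    1≤L = ℕₚ.*-mono-≤ {1} {_} {1} (proj₁ (proj₂ (clearDenominators A)))
      (ℕₚ.*-mono-≤ {1} {_} {1} (proj₁ (proj₂ (clearDenominators B))) (proj₁ (proj₂ (clearDenominators C))))

    L≢0 : fromℕ L ≢ 0ℚ
    L≢0 = ≢-sym (<⇒≢ (<-≤-trans 0<1 (fromℕ-mono-≤ 1≤L)))

    clears-A : Clears L A
    clears-A = clears-*ʳ {_} {A} _ (proj₂ (proj₂ (clearDenominators A)))
    clears-B : Clears L B
    clears-B = clears-*ˡ (proj₁ (clearDenominators A)) {_} {B}
        (clears-*ʳ {_} {B} _ (proj₂ (proj₂ (clearDenominators B))))
    clears-C : Clears L C
    clears-C = clears-*ˡ (proj₁ (clearDenominators A)) {_} {C} (clears-*ˡ (proj₁ (clearDenominators B)) {_} {C}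
        (proj₂ (proj₂ (clearDenominators C))))

    integral : ∀ {K p} → Clears K p → ∀ t → ∃[ j ] fromℕ K * evalᴾ p (x t) ≡ fromℤ j
    integral {K} {p} clears t = let j , eq = clears (b ℤ.^ (d ℕ.^ t)) in
      j , trans (cong (λ y → fromℕ K * evalᴾ p y) (sym (x-integer t))) eq

    m : ℕ
    m = proj₁ (scaled-eval-bound L A) ℕ.+ proj₁ (scaled-eval-bound L B)

    A≤ : ∀ t → ∣ fromℕ L * evalᴾ A (x t) ∣ ≤ ξ t ^ m
    A≤ t = ≤-trans (proj₂ (scaled-eval-bound L A) (x t) (2≤ξ t))
        (^-monoʳ-≤ (1≤ξ t) (ℕₚ.m≤m+n (proj₁ (scaled-eval-bound L A)) (proj₁ (scaled-eval-bound L B))))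
    B≤ : ∀ t → ∣ fromℕ L * evalᴾ B (x t) ∣ ≤ ξ t ^ m
    B≤ t = ≤-trans (proj₂ (scaled-eval-bound L B) (x t) (2≤ξ t))
        (^-monoʳ-≤ (1≤ξ t) (ℕₚ.m≤n+m (proj₁ (scaled-eval-bound L B)) (proj₁ (scaled-eval-bound L A))))

    scaled≢0 : ∀ {v j} → v ≢ 0ℚ → fromℕ L * v ≡ fromℤ j → j ≢ ℤ.0ℤ
    scaled≢0 {v} v≢0 eq refl = v≢0 (*-cancel eq)
      where
      *-cancel : fromℕ L * v ≡ 0ℚ → v ≡ 0ℚ
      *-cancel Lv≡0 with p*q≡0⇒ Lv≡0
      ... | inj₁ L≡0 = contradiction L≡0 L≢0
      ... | inj₂ v≡0 = v≡0

    A≢0 : ∀ t → evalᴾ A (x t) ≢ 0ℚ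
    A≢0 t eq = nonzero t (trans (cong (_* evalᴾ B (x t)) eq) (*-zeroˡ (evalᴾ B (x t))))
    B≢0 : ∀ t → evalᴾ B (x t) ≢ 0ℚ
    B≢0 t eq = nonzero t (trans (cong (evalᴾ A (x t) *_) eq) (*-zeroʳ (evalᴾ A (x t))))

    -- The iterated equation multiplied by `L ^ t`, which makes its coefficients integers. As `m`
    -- bounds the scaled values of `A` and `B`, the accumulated factor `L ^ t` is covered by the
    -- same estimate.
    record Transfer (t : ℕ) : Set where
      field
        𝐀 𝐁 𝐂 : ℤ
        𝐀≢0 : 𝐀 ≢ ℤ.0ℤ
        𝐁≢0 : 𝐁 ≢ ℤ.0ℤ
        𝐀≤  : ∣ fromℤ 𝐀 ∣ ≤ ξ t ^ m
        𝐁≤  : ∣ fromℤ 𝐁 ∣ ≤ ξ t ^ m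
        relation : (λ n → fromℤ 𝐁 * F 0 n) ∼ λ n → fromℤ 𝐀 * F t n + fromℤ 𝐂

    -- The exponent m is preserved because 2m ≤ dm.
    product-bound : ∀ t {i j} → ∣ fromℤ i ∣ ≤ ξ t ^ m → ∣ fromℤ j ∣ ≤ ξ t ^ m →
      ∣ fromℤ (i ℤ.* j) ∣ ≤ ξ (suc t) ^ m
    product-bound t {i} {j} i≤ j≤ = begin
      ∣ fromℤ (i ℤ.* j) ∣           ≡⟨ trans (cong ∣_∣ (fromℤ-* i j)) (∣p*q∣≡∣p∣*∣q∣ (fromℤ i) (fromℤ j)) ⟩
      ∣ fromℤ i ∣ * ∣ fromℤ j ∣     ≤⟨ *-mono-≤ (0≤∣p∣ (fromℤ i)) (^-nonNeg (0≤∣p∣ (x t)) m) i≤ j≤ ⟩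
      ξ t ^ m * ξ t ^ m             ≡⟨ ^-homo-* (ξ t) m m ⟨
      ξ t ^ (m ℕ.+ m)               ≤⟨ ^-monoʳ-≤ (1≤ξ t)
          (subst (ℕ._≤ d ℕ.* m) (cong (m ℕ.+_) (ℕₚ.+-identityʳ m)) (ℕₚ.*-monoˡ-≤ m 2≤d)) ⟩
      ξ t ^ (d ℕ.* m)               ≡⟨ ^-assocʳ (ξ t) d m ⟨
      (ξ t ^ d) ^ m                 ≡⟨ cong (_^ m) (trans (sym (∣x^n∣≡∣x∣^n (x t) d)) (cong ∣_∣ (x-suc t))) ⟩
      ξ (suc t) ^ m                 ∎
      where open ≤-Reasoning

    ij≢0 : ∀ {i j} → i ≢ ℤ.0ℤ → j ≢ ℤ.0ℤ → i ℤ.* j ≢ ℤ.0ℤ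
    ij≢0 {i} i≢0 j≢0 ij≡0 with ℤₚ.i*j≡0⇒i≡0∨j≡0 i ij≡0
    ... | inj₁ i≡0 = i≢0 i≡0
    ... | inj₂ j≡0 = j≢0 j≡0

    transfer : ∀ t → Transfer t
    transfer zero = record
      { 𝐀 = + 1 ; 𝐁 = + 1 ; 𝐂 = + 0 ; 𝐀≢0 = λ () ; 𝐁≢0 = λ ()
      ; 𝐀≤ = 1≤^ (1≤ξ 0) m ; 𝐁≤ = 1≤^ (1≤ξ 0) m
      ; relation = ∼-reflexive (λ n → sym (+-identityʳ (1ℚ * F 0 n))) }
    transfer (suc t) =
      let open Transfer (transfer t)
          a , La≡ = integral {L} {A} clears-A t
          b′ , Lb≡ = integral {L} {B} clears-B t
          c′ , Lc≡ = integral {L} {C} clears-C t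
          vA = evalᴾ A (x t)
          vB = evalᴾ B (x t)
          vC = evalᴾ C (x t)
      in record
      { 𝐀 = 𝐀 ℤ.* a ; 𝐁 = 𝐁 ℤ.* b′ ; 𝐂 = 𝐀 ℤ.* c′ ℤ.+ 𝐂 ℤ.* b′
      ; 𝐀≢0 = ij≢0 𝐀≢0 (scaled≢0 (A≢0 t) La≡)
      ; 𝐁≢0 = ij≢0 𝐁≢0 (scaled≢0 (B≢0 t) Lb≡)
      ; 𝐀≤ = product-bound t {𝐀} {a} 𝐀≤ (subst (λ y → ∣ y ∣ ≤ ξ t ^ m) La≡ (A≤ t))
      ; 𝐁≤ = product-bound t {𝐁} {b′} 𝐁≤ (subst (λ y → ∣ y ∣ ≤ ξ t ^ m) Lb≡ (B≤ t))
      ; relation =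
          -- The relation at `t` is multiplied by `L * vB`, which makes `vB * F t` appear; the
          -- functional equation at `x t` replaces it by `vA * F (suc t) + vC`.
          ∼-trans (∼-reflexive (λ n → trans
              (cong (_* F 0 n) (trans (fromℤ-* 𝐁 b′) (cong (fromℤ 𝐁 *_) (sym Lb≡))))
                    (eq₁ (fromℤ 𝐁) (fromℕ L) vB (F 0 n))))
          (∼-trans (∼-* (fromℕ L * vB) relation)
          (∼-trans (∼-reflexive (λ n → eq₂ (fromℕ L) vB (fromℤ 𝐀) (F t n) (fromℤ 𝐂)))
          (∼-trans (∼-+ (∼-* (fromℕ L * fromℤ 𝐀) (step-equation t)) (∼-reflexive {λ _ → fromℕ L * vB * fromℤ 𝐂}
              (λ _ → refl)))
          (∼-reflexive (λ n → trans (eq₃ (fromℕ L) vA vB vC (fromℤ 𝐀) (F (suc t) n) (fromℤ 𝐂))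
            (cong₂ _+_
              (cong (_* F (suc t) n) (trans (cong (fromℤ 𝐀 *_) La≡) (sym (fromℤ-* 𝐀 a))))
              (trans (cong₂ _+_ (trans (cong (fromℤ 𝐀 *_) Lc≡) (sym (fromℤ-* 𝐀 c′)))
                  (trans (cong (fromℤ 𝐂 *_) Lb≡) (sym (fromℤ-* 𝐂 b′))))
                (sym (fromℤ-+ (𝐀 ℤ.* c′) (𝐂 ℤ.* b′))))))))))
      }
      where
      eq₁ : ∀ B L v F → B * (L * v) * F ≡ L * v * (B * F)
      eq₁ = solve-∀ ℚ-ring
      eq₂ : ∀ L v A F C → L * v * (A * F + C) ≡ L * A * (v * F) + L * v * C
      eq₂ = solve-∀ ℚ-ring
      eq₃ : ∀ L a b c A F C → L * A * (a * F + c) + L * b * C ≡ A * (L * a) * F + (A * (L * c) + C * (L * b))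
      eq₃ = solve-∀ ℚ-ring

    0<b : 0ℚ < ∣ fromℤ b ∣
    0<b = <-≤-trans 0<1 (≤-trans (≤-trans 1≤2 (fromℕ-mono-≤ {2} {β} 2≤b)) (≤-reflexive (sym (fromℤ-∣∣ b))))

    growth-remainder : ∀ k → Growth ∣ fromℤ b ∣ (remainder k)
    growth-remainder k = growth-- (growth-act (denom k) 0<b (growth-coeff f (0<∣x∣⇒x≢0 0<b)
        (converges radius (fromℤ b) inside)))
      (growth-act (numer k) 0<b (growth-δ 0<b))

    approximations : ∀ k → ∃[ t₀ ] (∀ t → t₀ ℕ.≤ t →
      GoodApproximation (partialSum f (fromℤ b)) (fromℕ (β ℕ.^ (d ℕ.^ t))) (3 ℕ.+ m) (D k) (D (suc k)))
    approximations k =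
      let Lp , 1≤Lp , clears-p = clearDenominators (numer k)
          Lq , 1≤Lq , clears-q = clearDenominators (denom k)
          Lpq = Lp ℕ.* Lq
          X₁ , denom-size = polynomial-size (denom k) (leading-denom k)
          X₂ , remainder-size = truncated-size 0<b (leading-remainder k) (growth-remainder k)
      -- As `t < ξ t`, from this level on `ξ t` exceeds each of the three constants that depend on
      -- `k`: the clearing factor and the thresholds for the sizes of the denominator and of the
      -- remainder.
      in  Lpq ℕ.+ (X₁ ℕ.+ X₂) , λ t t₀≤t →
        let open Transfer (transfer t)
            large = ≤-trans (fromℕ-mono-≤ t₀≤t) (<⇒≤ (t<ξ t))
            L≤ξ , X≤ξ = fromℕ-≤-+ {Lpq} {X₁ ℕ.+ X₂} large
            X₁≤ξ , X₂≤ξ = fromℕ-≤-+ {X₁} {X₂} X≤ξ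
            y , Lq≡y = integral {Lpq} {denom k} (clears-*ˡ Lp {Lq} {denom k} clears-q) t
            z , Lp≡z = integral {Lpq} {numer k} (clears-*ʳ {Lp} {numer k} Lq clears-p) t
            q≤ , ≤q = denom-size (x t) (x≢0 t) X₁≤ξ
            D′ = D (suc k)
            T = truncated (ℤ.- + D′) (remainder k) (x t)
            scaled : ∀ n → ξ t ^ D′ * ∣ T (suc n) ∣ ≤ ξ t × 1ℚ ≤ ξ t * (ξ t ^ D′ * ∣ T (suc n) ∣)
            scaled n = scale t D′ (remainder-size (x t) (x≢0 t) X₂≤ξ n)
        in  subst₂ (λ F₀ X → GoodApproximation F₀ X (3 ℕ.+ m) (D k) D′) (cong (partialSum f) x₀) (ξ≡ t)
              (goodApproximation {F 0} {F t} {T} {ξ t} {evalᴾ (denom k) (x t)} {evalᴾ (numer k) (x t)} {m} {D k}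
                  {D′} {Lpq}
                𝐀 𝐁 𝐂 y z (2≤ξ t) 𝐀≢0 𝐁≢0 𝐀≤ 𝐁≤ relation (ℕₚ.*-mono-≤ {1} {Lp} {1} {Lq} 1≤Lp 1≤Lq) L≤ξ Lq≡y Lp≡z
                    q≤ ≤q
                (evaluate-form f (denom k) (numer k) (x≢0 t) (converges-x t) (proj₂ (leading-remainder k)))
                (λ n → proj₁ (scaled n)) (λ n → proj₂ (scaled n)))
      where
      scale : ∀ t D′ {T} → ∣ T ∣ ≤ ξ t * ξ t ^ℤ (ℤ.- + D′) × ξ t ^ℤ (ℤ.- + D′) ≤ ξ t * ∣ T ∣ →
        ξ t ^ D′ * ∣ T ∣ ≤ ξ t × 1ℚ ≤ ξ t * (ξ t ^ D′ * ∣ T ∣)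
      scale t D′ {T} (upper , lower) =
        ≤-trans (*-monoʳ-≤ 0≤X upper)
            (≤-reflexive (trans (swap X (ξ t) ζ) (trans (cong (ξ t *_) Xζ≡1) (*-identityʳ (ξ t))))) ,
        ≤-trans (≤-reflexive (sym Xζ≡1)) (≤-trans (*-monoʳ-≤ 0≤X lower) (≤-reflexive (swap X (ξ t) ∣ T ∣)))
        where
        X ζ : ℚ
        X = ξ t ^ D′
        ζ = ξ t ^ℤ (ℤ.- + D′)
        0≤X : 0ℚ ≤ X
        0≤X = ^-nonNeg (0≤∣p∣ (x t)) D′
        Xζ≡1 : X * ζ ≡ 1ℚ
        Xζ≡1 = ^ℤ-inverse (≢-sym (<⇒≢ (<-≤-trans 0<1 (1≤ξ t)))) (+ D′)
        swap : ∀ a b c → a * (b * c) ≡ b * (a * c)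
        swap = solve-∀ ℚ-ring

  exponent-of-value : irrationalityExponent (value f (fromℤ b) (converges radius (fromℤ b) inside))
    ≡∞ 1+ limsup (λ k → ratio (D (suc k)) (D k))
  exponent-of-value = Exponent.exponent≡ (value f (fromℤ b) (converges radius (fromℤ b) inside)) β d 2≤b 2≤d D
      D-increasing (3 ℕ.+ m) approximations

limsup-cong : ∀ {u v} → u ≗ v → ∀ r → cut (limsup u) r → cut (limsup v) r
limsup-cong u≗v r (s , r<s , often) = s , r<s , λ N →
  let k , N≤k , s<uk = often N in k , N≤k , subst (s <_) (u≗v k) s<uk

theorem3p13 : (d : ℕ) → 2 ℕ.≤ d →
    (A B C : Poly) → ¬ IsZeroᴾ A → ¬ IsZeroᴾ B → ¬ IsZeroᴾ C →
    (f : Laurent) →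
    ⟦ B ⟧ *ᴸ f ≈ ⟦ A ⟧ *ᴸ (f ∘z^ d) +ᴸ ⟦ C ⟧ →
    ¬ IsRational f →
    (cf : ContinuedFraction f) →
    (b : ℤ) → 2 ℕ.≤ ℤ.∣ b ∣ →
    (ρ : ℝ) (radius : IsRadius f ρ) (inside : ρ <ᴿ ∣ fromℤ b ∣) →
    (∀ t → evalᴾ A (fromℤ b ^ (d ℕ.^ t)) * evalᴾ B (fromℤ b ^ (d ℕ.^ t)) ≢ 0ℚ) →
    irrationalityExponent (value f (fromℤ b) (converges radius (fromℤ b) inside))
    ≡∞ 1+ limsup (λ k → ratio (deg (ContinuedFraction.denom cf (suc k))) (deg (ContinuedFraction.denom cf k)))
theorem3p13 d 2≤d A B C _ _ _ f equation _ cf b 2≤b ρ radius inside nonzero r =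
  -- `cut (1+ x) r` unfolds to `cut x (r - 1ℚ)`, so the congruence is applied at `r - 1ℚ`.
  mk⇔ (λ h → limsup-cong (λ k → sym (ratios k)) (r - 1ℚ) (Equivalence.to main h))
      (λ h → Equivalence.from main (limsup-cong ratios (r - 1ℚ) h))
  where
  open Convergents cf
  main = exponent-of-value d 2≤d A B C f equation cf b 2≤b ρ radius inside nonzero r
  ratios : ∀ k → ratio (deg (ContinuedFraction.denom cf (suc k))) (deg (ContinuedFraction.denom cf k)) ≡ ratio
      (D (suc k)) (D k)
  ratios k = cong₂ ratio (deg-denom (suc k)) (deg-denom k)
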